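{- Let $C,D$ be CGV configurations, $\Gamma$ a typing environment, $\phi$ a thread marker and $T$ a type. If $\Gamma\vdash_{\mathtt C}^{\phi} C:T$ and ($C\equiv_{\mathtt C} D$ or $C\longrightarrow_{\mathtt C} D$), then $\Gamma\vdash_{\mathtt C}^{\phi} D:T$.
   Context: **Terms.** Runtime terms of CGV (Concurrent GV), with $x,y$ variables, $\ell,i,j$ labels, $I$ a set of labels: $M,N,L ::= x \mid () \mid \lambda x.M \mid M\,N \mid (M,N) \mid \mathsf{let}\,(x,y)=M\,\mathsf{in}\,N \mid \mathsf{new} \mid \mathsf{spawn}\,M \mid \mathsf{send}\,M \mid \mathsf{recv}\,M \mid \mathsf{select}\,\ell\,M \mid \mathsf{case}\,M\,\mathsf{of}\,\{i:N_i\}_{i\in I} \mid M\{\!\{N/x\}\!\} \mid \mathsf{send}'(M,N)$. Here $M\{\!\{N/x\}\!\}$ is an explicit substitution (binding $x$ in $M$); $\lambda x.M$ binds $x$ in $M$; $\mathsf{let}\,(x,y)=M\,\mathsf{in}\,N$ binds $x,y$ in $N$. $\mathrm{fn}(\cdot)$ denotes free variables. In $(\lambda x.M)\,N$ assume $x\notin\mathrm{fn}(N)$; in $\mathsf{let}\,(x,y)=M\,\mathsf{in}\,N$ assume $x\neq y$ and $x,y\notin\mathrm{fn}(M)$. $M\{y/x\}$ is ordinary capture-avoiding substitution. Reduction contexts: $\mathcal R ::= [] \mid \mathcal R\,M \mid \mathsf{spawn}\,\mathcal R \mid \mathsf{send}\,\mathcal R \mid \mathsf{recv}\,\mathcal R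 \mid \mathsf{let}\,(x,y)=\mathcal R\,\mathsf{in}\,M \mid \mathsf{select}\,\ell\,\mathcal R \mid \mathsf{case}\,\mathcal R\,\mathsf{of}\,\{i:M_i\}_{i\in I} \mid \mathcal R\{\!\{M/x\}\!\} \mid M\{\!\{\mathcal R/x\}\!\} \mid \mathsf{send}'(M,\mathcal R)$. $\mathcal R[M]$ fills the hole; $\mathrm{fn}(\mathcal R)=\mathrm{fn}(\mathcal R[()])$; similarly for other contexts. Term structural congruence $\equiv_{\mathtt M}$ is the least congruence with: (SC-SubExt) if $x\notin\mathrm{fn}(\mathcal R)$ then $(\mathcal R[M])\{\!\{N/x\}\!\}\equiv_{\mathtt M}\mathcal R[M\{\!\{N/x\}\!\}]$. Term reduction $\longrightarrow_{\mathtt M}$: $(\lambda x.M)\,N\longrightarrow_{\mathtt M} M\{\!\{N/x\}\!\}$; $\mathsf{let}\,(x,y)=(M_1,M_2)\,\mathsf{in}\,N\longrightarrow_{\mathtt M} N\{\!\{M_1/x\}\!\}\{\!\{M_2/y\}\!\}$ (order of the two substitutions arbitrary); $M\{\!\{y/x\}\!\}\longrightarrow_{\mathtt M} M\{y/x\}$ ($y$ a variable); $x\{\!\{M/x\}\!\}\longrightarrow_{\mathtt M} M$; $\mathsf{send}\,(M,N)\longrightarrow_{\mathtt M}\mathsf{send}'(M,N)$; closed under reduction contexts and under $\equiv_{\mathtt M}$ on both sides. **Configurations.** Markers $\phi ::= \mathsf{main}$ (main) $\mid\lozenge$ (child). Messages $m ::= M \mid \ell$. Configurations $C,D,E ::=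 \phi\,M \mid C\parallel D \mid (\nu x[\vec m\rangle y)C \mid C\{\!\{M/x\}\!\}$, where $\vec m$ is a finite sequence of messages ($\epsilon$ empty); $(\nu x[\vec m\rangle y)$ binds $x,y$, and $C\{\!\{M/x\}\!\}$ binds $x$ in $C$. Thread contexts $\mathcal F ::= \phi\,\mathcal R \mid C\{\!\{\mathcal R/x\}\!\}$; $\hat{\mathcal F}$ denotes a thread context whose hole is not under an explicit substitution, i.e. not built with the clause $\mathcal R\{\!\{M/x\}\!\}$. Configuration contexts $\mathcal G ::= [] \mid \mathcal G\parallel C \mid (\nu x[\vec m\rangle y)\mathcal G \mid \mathcal G\{\!\{M/x\}\!\}$. Structural congruence $\equiv_{\mathtt C}$ is the least congruence with: $M\equiv_{\mathtt M}M'$ implies $\phi\,M\equiv_{\mathtt C}\phi\,M'$; $(\nu x[\epsilon\rangle y)C\equiv_{\mathtt C}(\nu y[\epsilon\rangle x)C$; $(\nu x[\vec m\rangle y)(\nu z[\vec n\rangle w)C\equiv_{\mathtt C}(\nu z[\vec n\rangle w)(\nu x[\vec m\rangle y)C$; if $x,y\notin\mathrm{fn}(C)$ then $(\nu x[\vec m\rangle y)(C\parallel D)\equiv_{\mathtt C}C\parallel(\nu x[\vec m\rangle y)D$ and $(\nu x[\epsilon\rangle y)C\equiv_{\mathtt C}C$; $(\nu x[\vec m\rangle y)(\hat{\mathcal F}[\mathsf{send}'(M,x)]\parallel C)\equiv_{\mathtt C}(\nu x[M,\vec m\rangle y)(\hat{\mathcal F}[x]\parallel C)$; $(\nu x[\vec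 m\rangle y)(\mathcal F[\mathsf{select}\,\ell\,x]\parallel C)\equiv_{\mathtt C}(\nu x[\ell,\vec m\rangle y)(\mathcal F[x]\parallel C)$; $C\parallel\lozenge\,()\equiv_{\mathtt C}C$; $\parallel$ commutative and associative; $\phi\,(M\{\!\{N/x\}\!\})\equiv_{\mathtt C}(\phi\,M)\{\!\{N/x\}\!\}$; if $x\notin\mathrm{fn}(\mathcal G)$ then $(\mathcal G[C])\{\!\{M/x\}\!\}\equiv_{\mathtt C}\mathcal G[C\{\!\{M/x\}\!\}]$. Configuration reduction $\longrightarrow_{\mathtt C}$: $\mathcal F[\mathsf{new}]\longrightarrow_{\mathtt C}(\nu x[\epsilon\rangle y)(\mathcal F[(x,y)])$; $\hat{\mathcal F}[\mathsf{spawn}\,(M,N)]\longrightarrow_{\mathtt C}\hat{\mathcal F}[N]\parallel\lozenge\,M$; $(\nu x[\vec m,M\rangle y)(\hat{\mathcal F}[\mathsf{recv}\,y]\parallel C)\longrightarrow_{\mathtt C}(\nu x[\vec m\rangle y)(\hat{\mathcal F}[(M,y)]\parallel C)$; if $j\in I$, $(\nu x[\vec m,j\rangle y)(\mathcal F[\mathsf{case}\,y\,\mathsf{of}\,\{i:M_i\}_{i\in I}]\parallel C)\longrightarrow_{\mathtt C}(\nu x[\vec m\rangle y)(\mathcal F[M_j\,y]\parallel C)$; if $C\longrightarrow_{\mathtt C}C'$ then $\mathcal G[C]\longrightarrow_{\mathtt C}\mathcal G[C']$; if $M\longrightarrow_{\mathtt M}M'$ then $\mathcal F[M]\longrightarrow_{\mathtt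 C}\mathcal F[M']$; closed under $\equiv_{\mathtt C}$ on both sides. **Types.** $T,U ::= T\times U \mid T\multimap U \mid \mathbf 1 \mid S$ and session types $S ::= {!}T.S \mid {?}T.S \mid \oplus\{i:S_i\}_{i\in I} \mid \&\{i:S_i\}_{i\in I} \mid \mathsf{end}$. Duality: $\overline{{!}T.S}={?}T.\overline S$, $\overline{{?}T.S}={!}T.\overline S$, $\overline{\oplus\{i:S_i\}}=\&\{i:\overline{S_i}\}$, $\overline{\&\{i:S_i\}}=\oplus\{i:\overline{S_i}\}$, $\overline{\mathsf{end}}=\mathsf{end}$. Environments $\Gamma,\Delta$ assign types to variables (unordered); writing $\Gamma,\Delta$ presupposes disjoint variables. **Term typing** $\Gamma\vdash_{\mathtt M}M:T$: (T-Var) $x:T\vdash_{\mathtt M}x:T$. (T-Abs) $\Gamma,x:T\vdash_{\mathtt M}M:U$ gives $\Gamma\vdash_{\mathtt M}\lambda x.M:T\multimap U$. (T-App) $\Gamma\vdash_{\mathtt M}M:T\multimap U$, $\Delta\vdash_{\mathtt M}N:T$ give $\Gamma,\Delta\vdash_{\mathtt M}M\,N:U$. (T-Unit) $\emptyset\vdash_{\mathtt M}():\mathbf 1$. (T-Pair) $\Gamma\vdash_{\mathtt M}M:T$, $\Delta\vdash_{\mathtt M}N:U$ give $\Gamma,\Delta\vdash_{\mathtt M}(M,N):T\times U$. (T-Split) $\Gamma\vdash_{\mathtt M}M:T\times T'$, $\Delta,x:T,y:T'\vdash_{\mathtt M}N:U$ give $\Gamma,\Delta\vdash_{\mathtt M}\mathsf{let}\,(x,y)=M\,\mathsf{in}\,N:U$.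 (T-New) $\emptyset\vdash_{\mathtt M}\mathsf{new}:S\times\overline S$. (T-Spawn) $\Gamma\vdash_{\mathtt M}M:\mathbf 1\times T$ gives $\Gamma\vdash_{\mathtt M}\mathsf{spawn}\,M:T$. (T-EndL) $\Gamma\vdash_{\mathtt M}M:T$ gives $\Gamma,x:\mathsf{end}\vdash_{\mathtt M}M:T$. (T-EndR) $\emptyset\vdash_{\mathtt M}x:\mathsf{end}$. (T-Send) $\Gamma\vdash_{\mathtt M}M:T\times{!}T.S$ gives $\Gamma\vdash_{\mathtt M}\mathsf{send}\,M:S$. (T-Recv) $\Gamma\vdash_{\mathtt M}M:{?}T.S$ gives $\Gamma\vdash_{\mathtt M}\mathsf{recv}\,M:T\times S$. (T-Select) $\Gamma\vdash_{\mathtt M}M:\oplus\{i:S_i\}_{i\in I}$, $j\in I$ give $\Gamma\vdash_{\mathtt M}\mathsf{select}\,j\,M:S_j$. (T-Case) $\Gamma\vdash_{\mathtt M}M:\&\{i:S_i\}_{i\in I}$ and $\Delta\vdash_{\mathtt M}N_i:S_i\multimap U$ for all $i\in I$ give $\Gamma,\Delta\vdash_{\mathtt M}\mathsf{case}\,M\,\mathsf{of}\,\{i:N_i\}_{i\in I}:U$. (T-Sub) $\Gamma,x:T\vdash_{\mathtt M}M:U$, $\Delta\vdash_{\mathtt M}N:T$ give $\Gamma,\Delta\vdash_{\mathtt M}M\{\!\{N/x\}\!\}:U$. (T-Send') $\Gamma\vdash_{\mathtt M}M:T$, $\Delta\vdash_{\mathtt M}N:{!}T.S$ give $\Gamma,\Delta\vdash_{\mathtt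 M}\mathsf{send}'(M,N):S$. **Buffer typing** $\Gamma\vdash_{\mathtt B}[\vec m\rangle:S'>S$: (T-Buf) $\emptyset\vdash_{\mathtt B}[\epsilon\rangle:S'>S'$. (T-BufSend) $\Gamma\vdash_{\mathtt M}M:T$, $\Delta\vdash_{\mathtt B}[\vec m\rangle:S'>S$ give $\Gamma,\Delta\vdash_{\mathtt B}[\vec m,M\rangle:S'>{!}T.S$. (T-BufSelect) $\Gamma\vdash_{\mathtt B}[\vec m\rangle:S'>S_j$, $j\in I$ give $\Gamma\vdash_{\mathtt B}[\vec m,j\rangle:S'>\oplus\{i:S_i\}_{i\in I}$. **Configuration typing** $\Gamma\vdash_{\mathtt C}^{\phi}C:T$, with $\mathsf{main}+\lozenge=\lozenge+\mathsf{main}=\mathsf{main}$, $\lozenge+\lozenge=\lozenge$, $\mathsf{main}+\mathsf{main}$ undefined: (T-Main) $\Gamma\vdash_{\mathtt M}M:T$ gives $\Gamma\vdash_{\mathtt C}^{\mathsf{main}}\mathsf{main}\,M:T$. (T-Child) $\Gamma\vdash_{\mathtt M}M:\mathbf 1$ gives $\Gamma\vdash_{\mathtt C}^{\lozenge}\lozenge\,M:\mathbf 1$. (T-ParL) $\Gamma\vdash_{\mathtt C}^{\lozenge}C:\mathbf 1$, $\Delta\vdash_{\mathtt C}^{\phi}D:T$ give $\Gamma,\Delta\vdash_{\mathtt C}^{\lozenge+\phi}C\parallel D:T$. (T-ParR) $\Gamma\vdash_{\mathtt C}^{\phi}C:T$, $\Delta\vdash_{\mathtt C}^{\lozenge}D:\mathbf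 1$ give $\Gamma,\Delta\vdash_{\mathtt C}^{\phi+\lozenge}C\parallel D:T$. (T-Res) $\Gamma\vdash_{\mathtt B}[\vec m\rangle:S'>S$, $\Delta,x:S',y:\overline S\vdash_{\mathtt C}^{\phi}C:T$ give $\Gamma,\Delta\vdash_{\mathtt C}^{\phi}(\nu x[\vec m\rangle y)C:T$. (T-ResBuf) $\Gamma,y:\overline S\vdash_{\mathtt B}[\vec m\rangle:S'>S$, $\Delta,x:S'\vdash_{\mathtt C}^{\phi}C:T$ give $\Gamma,\Delta\vdash_{\mathtt C}^{\phi}(\nu x[\vec m\rangle y)C:T$. (T-ConfSub) $\Gamma,x:T\vdash_{\mathtt C}^{\phi}C:U$, $\Delta\vdash_{\mathtt M}M:T$ give $\Gamma,\Delta\vdash_{\mathtt C}^{\phi}C\{\!\{M/x\}\!\}:U$.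
   Formalization: T-EndR is restricted to variables not bound in the enclosing term or configuration, and label sets I are non-empty: with unrestricted T-EndR, the send' congruence read right to left can duplicate a linear endpoint; with I empty, case discards any environment, so the claim fails. -}

module Defs where

open import Data.Fin using (Fin; zero; suc; lift; _↑ʳ_)
open import Data.Fin.Patterns using (0F; 1F)
open import Data.Fin.Subset using (Subset; ⊤; outside; _∈_)
open import Data.List using (List; []; _∷_; _∷ʳ_; map)
open import Data.Maybe using (Maybe; just; nothing)
open import Data.Nat using (ℕ; zero; suc; _≤_)
open import Data.Vec using (Vec; []; _∷_; replicate; _[_]≔_)
open import Relation.Binary.PropositionalEquality using (_≡_)

-- Labels and families indexed by a set of labels

Label : Set
Label = ℕ

-- `Family A 0` is the type of families {i : aᵢ}_{i∈I} with I a finite non-empty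
-- set of labels.  They are listed by ascending label (`Family A k` only has
-- labels ≥ k), and the bounds are irrelevant, so each family has exactly one
-- representation and _≡_ does not depend on an ordering of I.  Non-emptiness
-- matters for typing: with I = ∅ the rule for case would let a branching
-- discard an arbitrary environment.
data Family (A : Set) : ℕ → Set where
  last : ∀ {k} (i : Label) → .(k ≤ i) → A → Family A k
  cons : ∀ {k} (i : Label) → .(k ≤ i) → A → Family A (suc i) → Family A k

-- `j ↦ a ∈ᶠ as` : j ∈ I and a is the member of the family with index j.
data _↦_∈ᶠ_ {A : Set} (j : Label) (a : A) : ∀ {k} → Family A k → Set where
  last  : ∀ {k} .{p : k ≤ j} → j ↦ a ∈ᶠ last j p a
  here  : ∀ {k} .{p : k ≤ j} {as} → j ↦ a ∈ᶠ cons j p a as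
  there : ∀ {k i} .{p : k ≤ i} {b as} → j ↦ a ∈ᶠ as → j ↦ a ∈ᶠ cons i p b as

-- Both families are indexed by the same I, and R aᵢ bᵢ for all i ∈ I.
data Pointwise {A B : Set} (R : A → B → Set) : ∀ {k} → Family A k → Family B k → Set where
  last : ∀ {k i} .{p : k ≤ i} {a b} → R a b → Pointwise R (last i p a) (last i p b)
  cons : ∀ {k i} .{p : k ≤ i} {a b as bs} → R a b → Pointwise R as bs →
         Pointwise R {k} (cons i p a as) (cons i p b bs)

-- Types

infixr 7 _⊗_
infixr 6 _⊸_
infixr 8 !_∙_ ¿_∙_

mutual
  data Type : Set where
    _⊗_  : Type → Type → Type
    _⊸_  : Type → Type → Type
    𝟙    : Type
    sess : Session → Type

  data Session : Set where
    !_∙_ : Type → Session → Session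
    ¿_∙_ : Type → Session → Session
    ⊕_   : Family Session 0 → Session
    &_   : Family Session 0 → Session
    end  : Session

mutual
  dual : Session → Session
  dual (! T ∙ S) = ¿ T ∙ dual S
  dual (¿ T ∙ S) = ! T ∙ dual S
  dual (⊕ Ss)    = & duals Ss
  dual (& Ss)    = ⊕ duals Ss
  dual end       = end

  duals : ∀ {k} → Family Session k → Family Session k
  duals (last i p S)    = last i p (dual S)
  duals (cons i p S Ss) = cons i p (dual S) (duals Ss)

-- Syntax is well-scoped de Bruijn, which builds in α-equivalence and the
-- convention that bound variables differ from all other variables:
-- "x ∉ fn(E)" is expressed by E being a weakening, and an expression moved
-- across a binder cannot mention what that binder binds.

infixl 9 _·_
infixl 8 _⟪_⟫

-- Binders: ƛ M and M ⟪ N ⟫ (the explicit substitution M{{N/x}}) bind x = 0 in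
-- M; split M N is let (x,y) = M in N, with x = 0 and y = 1 in N.
data Term (n : ℕ) : Set where
  var    : Fin n → Term n
  unit   : Term n
  ƛ      : Term (suc n) → Term n
  _·_    : Term n → Term n → Term n
  pair   : Term n → Term n → Term n
  split  : Term n → Term (suc (suc n)) → Term n
  new    : Term n
  spawn  : Term n → Term n
  send   : Term n → Term n
  recv   : Term n → Term n
  select : Label → Term n → Term n
  case   : Term n → Family (Term n) 0 → Term n
  _⟪_⟫   : Term (suc n) → Term n → Term n
  send′  : Term n → Term n → Term n

mutual
  ren : ∀ {m n} → (Fin m → Fin n) → Term m → Term n
  ren ρ (var x)      = var (ρ x)
  ren ρ unit         = unit
  ren ρ (ƛ M)        = ƛ (ren (lift 1 ρ) M)
  ren ρ (M · N)      = ren ρ M · ren ρ N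
  ren ρ (pair M N)   = pair (ren ρ M) (ren ρ N)
  ren ρ (split M N)  = split (ren ρ M) (ren (lift 2 ρ) N)
  ren ρ new          = new
  ren ρ (spawn M)    = spawn (ren ρ M)
  ren ρ (send M)     = send (ren ρ M)
  ren ρ (recv M)     = recv (ren ρ M)
  ren ρ (select ℓ M) = select ℓ (ren ρ M)
  ren ρ (case M Ns)  = case (ren ρ M) (rens ρ Ns)
  ren ρ (M ⟪ N ⟫)    = ren (lift 1 ρ) M ⟪ ren ρ N ⟫
  ren ρ (send′ M N)  = send′ (ren ρ M) (ren ρ N)

  rens : ∀ {m n k} → (Fin m → Fin n) → Family (Term m) k → Family (Term n) k
  rens ρ (last i p M)    = last i p (ren ρ M)
  rens ρ (cons i p M Ms) = cons i p (ren ρ M) (rens ρ Ms)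

-- Substituting a variable for a variable needs no more than a renaming:
-- M{y/x}, with x = 0 in M, is ren (0↦ y) M.
0↦ : ∀ {n} → Fin n → Fin (suc n) → Fin n
0↦ y zero    = y
0↦ y (suc x) = x

swap : ∀ {n} → Fin (suc (suc n)) → Fin (suc (suc n))
swap zero          = 1F
swap (suc zero)    = 0F
swap (suc (suc x)) = suc (suc x)

swap₂ : ∀ {n} → Fin (suc (suc (suc (suc n)))) → Fin (suc (suc (suc (suc n))))
swap₂ zero                      = suc (suc 0F)
swap₂ (suc zero)                = suc (suc 1F)
swap₂ (suc (suc zero))          = 0F
swap₂ (suc (suc (suc zero)))    = 1F
swap₂ (suc (suc (suc (suc x)))) = suc (suc (suc (suc x)))

-- Scope of the hole of a context whose hole lies under k binders

under : ℕ → ℕ → ℕ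
under zero    n = n
under (suc k) n = under k (suc n)

wkUnder : ∀ k {n} → Fin n → Fin (under k n)
wkUnder zero    x = x
wkUnder (suc k) x = wkUnder k (suc x)

liftUnder : ∀ k {m n} → (Fin m → Fin n) → Fin (under k m) → Fin (under k n)
liftUnder zero    ρ = ρ
liftUnder (suc k) ρ = liftUnder k (lift 1 ρ)

-- Turns the innermost variable into the one bound just outside the k binders.
sink : ∀ k {n} → Fin (suc (under k n)) → Fin (under k (suc n))
sink k zero    = wkUnder k zero
sink k (suc x) = liftUnder k suc x

-- Reduction contexts.  Only R ⟪ M ⟫ˡ, which is 𝓡{{M/x}}, binds at the hole, so
-- RCtx 0 n are exactly the contexts whose hole is not under an explicit
-- substitution.
data RCtx : ℕ → ℕ → Set where
  □       : ∀ {n} → RCtx 0 n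
  _·□_    : ∀ {k n} → RCtx k n → Term n → RCtx k n
  spawn□  : ∀ {k n} → RCtx k n → RCtx k n
  send□   : ∀ {k n} → RCtx k n → RCtx k n
  recv□   : ∀ {k n} → RCtx k n → RCtx k n
  split□  : ∀ {k n} → RCtx k n → Term (suc (suc n)) → RCtx k n
  select□ : ∀ {k n} → Label → RCtx k n → RCtx k n
  case□   : ∀ {k n} → RCtx k n → Family (Term n) 0 → RCtx k n
  _⟪_⟫ˡ   : ∀ {k n} → RCtx k (suc n) → Term n → RCtx (suc k) n
  _⟪_⟫ʳ   : ∀ {k n} → Term (suc n) → RCtx k n → RCtx k n
  send′□  : ∀ {k n} → Term n → RCtx k n → RCtx k n

infix 10 _[_]ᴿ _[_]ᶠ _[_]ᴳ

_[_]ᴿ : ∀ {k n} → RCtx k n → Term (under k n) → Term n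
□           [ L ]ᴿ = L
(R ·□ M)    [ L ]ᴿ = R [ L ]ᴿ · M
spawn□ R    [ L ]ᴿ = spawn (R [ L ]ᴿ)
send□ R     [ L ]ᴿ = send (R [ L ]ᴿ)
recv□ R     [ L ]ᴿ = recv (R [ L ]ᴿ)
split□ R M  [ L ]ᴿ = split (R [ L ]ᴿ) M
select□ ℓ R [ L ]ᴿ = select ℓ (R [ L ]ᴿ)
case□ R Ms  [ L ]ᴿ = case (R [ L ]ᴿ) Ms
(R ⟪ M ⟫ˡ)  [ L ]ᴿ = (R [ L ]ᴿ) ⟪ M ⟫
(M ⟪ R ⟫ʳ)  [ L ]ᴿ = M ⟪ R [ L ]ᴿ ⟫
send′□ M R  [ L ]ᴿ = send′ M (R [ L ]ᴿ)

renᴿ : ∀ {k m n} → (Fin m → Fin n) → RCtx k m → RCtx k n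
renᴿ ρ □             = □
renᴿ ρ (R ·□ M)      = renᴿ ρ R ·□ ren ρ M
renᴿ ρ (spawn□ R)    = spawn□ (renᴿ ρ R)
renᴿ ρ (send□ R)     = send□ (renᴿ ρ R)
renᴿ ρ (recv□ R)     = recv□ (renᴿ ρ R)
renᴿ ρ (split□ R M)  = split□ (renᴿ ρ R) (ren (lift 2 ρ) M)
renᴿ ρ (select□ ℓ R) = select□ ℓ (renᴿ ρ R)
renᴿ ρ (case□ R Ms)  = case□ (renᴿ ρ R) (rens ρ Ms)
renᴿ ρ (R ⟪ M ⟫ˡ)    = renᴿ (lift 1 ρ) R ⟪ ren ρ M ⟫ˡ
renᴿ ρ (M ⟪ R ⟫ʳ)    = ren (lift 1 ρ) M ⟪ renᴿ ρ R ⟫ʳ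
renᴿ ρ (send′□ M R)  = send′□ (ren ρ M) (renᴿ ρ R)

-- Term structural congruence

infix 4 _≡ᴹ_ _⟶ᴹ_ _≡ᶜ_ _⟶ᶜ_

data _≡ᴹ_ {n : ℕ} : Term n → Term n → Set where
  SC-SubExt : ∀ {k} (R : RCtx k n) (M : Term (suc (under k n))) (N : Term n) →
              (renᴿ suc R [ ren (sink k) M ]ᴿ) ⟪ N ⟫
                ≡ᴹ R [ M ⟪ ren (wkUnder k) N ⟫ ]ᴿ

  refl  : ∀ {M} → M ≡ᴹ M
  sym   : ∀ {M N} → M ≡ᴹ N → N ≡ᴹ M
  trans : ∀ {L M N} → L ≡ᴹ M → M ≡ᴹ N → L ≡ᴹ N

  ƛ      : ∀ {M M′} → M ≡ᴹ M′ → ƛ M ≡ᴹ ƛ M′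
  _·_    : ∀ {M M′ N N′} → M ≡ᴹ M′ → N ≡ᴹ N′ → M · N ≡ᴹ M′ · N′
  pair   : ∀ {M M′ N N′} → M ≡ᴹ M′ → N ≡ᴹ N′ → pair M N ≡ᴹ pair M′ N′
  split  : ∀ {M M′ N N′} → M ≡ᴹ M′ → N ≡ᴹ N′ → split M N ≡ᴹ split M′ N′
  spawn  : ∀ {M M′} → M ≡ᴹ M′ → spawn M ≡ᴹ spawn M′
  send   : ∀ {M M′} → M ≡ᴹ M′ → send M ≡ᴹ send M′
  recv   : ∀ {M M′} → M ≡ᴹ M′ → recv M ≡ᴹ recv M′
  select : ∀ {ℓ M M′} → M ≡ᴹ M′ → select ℓ M ≡ᴹ select ℓ M′
  case   : ∀ {M M′ Ns Ns′} → M ≡ᴹ M′ → Pointwise _≡ᴹ_ Ns Ns′ → case M Ns ≡ᴹ case M′ Ns′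
  _⟪_⟫   : ∀ {M M′ N N′} → M ≡ᴹ M′ → N ≡ᴹ N′ → M ⟪ N ⟫ ≡ᴹ M′ ⟪ N′ ⟫
  send′  : ∀ {M M′ N N′} → M ≡ᴹ M′ → N ≡ᴹ N′ → send′ M N ≡ᴹ send′ M′ N′

-- Term reduction

data _⟶ᴹ_ {n : ℕ} : Term n → Term n → Set where
  E-Lam       : ∀ {M N} → ƛ M · N ⟶ᴹ M ⟪ N ⟫
  -- The two orders of the substitutions; the one performed first is under the
  -- binder of the other.
  E-Split₁    : ∀ {M₁ M₂ N} →
                split (pair M₁ M₂) N ⟶ᴹ (N ⟪ ren suc M₁ ⟫) ⟪ M₂ ⟫
  E-Split₂    : ∀ {M₁ M₂ N} →
                split (pair M₁ M₂) N ⟶ᴹ (ren swap N ⟪ ren suc M₂ ⟫) ⟪ M₁ ⟫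
  E-SubstName : ∀ {M y} → M ⟪ var y ⟫ ⟶ᴹ ren (0↦ y) M
  E-NameSubst : ∀ {M} → var 0F ⟪ M ⟫ ⟶ᴹ M
  E-Send      : ∀ {M N} → send (pair M N) ⟶ᴹ send′ M N
  E-Lift      : ∀ {k} (R : RCtx k n) {M M′} → M ⟶ᴹ M′ → R [ M ]ᴿ ⟶ᴹ R [ M′ ]ᴿ
  E-LiftSC    : ∀ {M M′ N N′} → M ≡ᴹ M′ → M′ ⟶ᴹ N′ → N′ ≡ᴹ N → M ⟶ᴹ N

-- Configurations

data Marker : Set where
  main ◇ : Marker

data Message (n : ℕ) : Set where
  term  : Term n → Message n
  label : Label → Message n

Buffer : ℕ → Set
Buffer n = List (Message n)

infixr 6 _∥_
infix  7 _▸_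

-- φ ▸ M is the thread φ M.  ν ms C is (νx[ms⟩y)C, with x = 0 and y = 1 in C; the
-- messages are in the scope of x and y as well, as the buffer may contain y.
data Conf (n : ℕ) : Set where
  _▸_  : Marker → Term n → Conf n
  _∥_  : Conf n → Conf n → Conf n
  ν    : Buffer (suc (suc n)) → Conf (suc (suc n)) → Conf n
  _⟪_⟫ : Conf (suc n) → Term n → Conf n

renᵐ : ∀ {m n} → (Fin m → Fin n) → Message m → Message n
renᵐ ρ (term M)  = term (ren ρ M)
renᵐ ρ (label ℓ) = label ℓ

renᴮ : ∀ {m n} → (Fin m → Fin n) → Buffer m → Buffer n
renᴮ ρ = map (renᵐ ρ)

renᶜ : ∀ {m n} → (Fin m → Fin n) → Conf m → Conf n
renᶜ ρ (φ ▸ M)   = φ ▸ ren ρ M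
renᶜ ρ (C ∥ D)   = renᶜ ρ C ∥ renᶜ ρ D
renᶜ ρ (ν ms C)  = ν (renᴮ (lift 2 ρ) ms) (renᶜ (lift 2 ρ) C)
renᶜ ρ (C ⟪ M ⟫) = renᶜ (lift 1 ρ) C ⟪ ren ρ M ⟫

-- Thread contexts; the hatted ones are those in TCtx 0 n.
data TCtx (k n : ℕ) : Set where
  _▸_  : Marker → RCtx k n → TCtx k n
  _⟪_⟫ : Conf (suc n) → RCtx k n → TCtx k n

_[_]ᶠ : ∀ {k n} → TCtx k n → Term (under k n) → Conf n
(φ ▸ R)   [ L ]ᶠ = φ ▸ R [ L ]ᴿ
(C ⟪ R ⟫) [ L ]ᶠ = C ⟪ R [ L ]ᴿ ⟫

renᶠ : ∀ {k m n} → (Fin m → Fin n) → TCtx k m → TCtx k n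
renᶠ ρ (φ ▸ R)   = φ ▸ renᴿ ρ R
renᶠ ρ (C ⟪ R ⟫) = renᶜ (lift 1 ρ) C ⟪ renᴿ ρ R ⟫

data GCtx : ℕ → ℕ → Set where
  □    : ∀ {n} → GCtx 0 n
  _∥□_ : ∀ {k n} → GCtx k n → Conf n → GCtx k n
  ν□   : ∀ {k n} → Buffer (suc (suc n)) → GCtx k (suc (suc n)) → GCtx (suc (suc k)) n
  _⟪_⟫ : ∀ {k n} → GCtx k (suc n) → Term n → GCtx (suc k) n

_[_]ᴳ : ∀ {k n} → GCtx k n → Conf (under k n) → Conf n
□         [ E ]ᴳ = E
(G ∥□ C)  [ E ]ᴳ = G [ E ]ᴳ ∥ C
ν□ ms G   [ E ]ᴳ = ν ms (G [ E ]ᴳ)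
(G ⟪ M ⟫) [ E ]ᴳ = (G [ E ]ᴳ) ⟪ M ⟫

renᴳ : ∀ {k m n} → (Fin m → Fin n) → GCtx k m → GCtx k n
renᴳ ρ □         = □
renᴳ ρ (G ∥□ C)  = renᴳ ρ G ∥□ renᶜ ρ C
renᴳ ρ (ν□ ms G) = ν□ (renᴮ (lift 2 ρ) ms) (renᴳ (lift 2 ρ) G)
renᴳ ρ (G ⟪ M ⟫) = renᴳ (lift 1 ρ) G ⟪ ren ρ M ⟫

-- Structural congruence of configurations

data _≡ᶜ_ {n : ℕ} : Conf n → Conf n → Set where
  SC-TermSC    : ∀ {φ M M′} → M ≡ᴹ M′ → φ ▸ M ≡ᶜ φ ▸ M′
  SC-ResSwap   : ∀ {C} → ν [] C ≡ᶜ ν [] (renᶜ swap C)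
  SC-ResComm   : ∀ {ms ns C} →
                 ν ms (ν (renᴮ (lift 2 (2 ↑ʳ_)) ns) C)
                   ≡ᶜ ν ns (ν (renᴮ (lift 2 (2 ↑ʳ_)) ms) (renᶜ swap₂ C))
  SC-ResExt    : ∀ {ms C D} → ν ms (renᶜ (2 ↑ʳ_) C ∥ D) ≡ᶜ C ∥ ν ms D
  SC-ResNil    : ∀ {C} → ν [] (renᶜ (2 ↑ʳ_) C) ≡ᶜ C
  SC-Send′     : ∀ {ms M C} (F : TCtx 0 (suc (suc n))) →
                 ν ms (F [ send′ M (var 0F) ]ᶠ ∥ C)
                   ≡ᶜ ν (term M ∷ ms) (F [ var 0F ]ᶠ ∥ C)
  SC-Select    : ∀ {k ms ℓ C} (F : TCtx k (suc (suc n))) →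
                 ν ms (F [ select ℓ (var (wkUnder k 0F)) ]ᶠ ∥ C)
                   ≡ᶜ ν (label ℓ ∷ ms) (F [ var (wkUnder k 0F) ]ᶠ ∥ C)
  SC-ParNil    : ∀ {C} → C ∥ ◇ ▸ unit ≡ᶜ C
  SC-ParComm   : ∀ {C D} → C ∥ D ≡ᶜ D ∥ C
  SC-ParAssoc  : ∀ {C D E} → C ∥ (D ∥ E) ≡ᶜ (C ∥ D) ∥ E
  SC-ConfSub   : ∀ {φ M N} → φ ▸ (M ⟪ N ⟫) ≡ᶜ (φ ▸ M) ⟪ N ⟫
  SC-ConfSubExt : ∀ {k} (G : GCtx k n) (C : Conf (suc (under k n))) (M : Term n) →
                  (renᴳ suc G [ renᶜ (sink k) C ]ᴳ) ⟪ M ⟫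
                    ≡ᶜ G [ C ⟪ ren (wkUnder k) M ⟫ ]ᴳ

  refl  : ∀ {C} → C ≡ᶜ C
  sym   : ∀ {C D} → C ≡ᶜ D → D ≡ᶜ C
  trans : ∀ {C D E} → C ≡ᶜ D → D ≡ᶜ E → C ≡ᶜ E

  _∥_  : ∀ {C C′ D D′} → C ≡ᶜ C′ → D ≡ᶜ D′ → C ∥ D ≡ᶜ C′ ∥ D′
  ν    : ∀ {ms C C′} → C ≡ᶜ C′ → ν ms C ≡ᶜ ν ms C′
  _⟪-⟫ : ∀ {C C′ M} → C ≡ᶜ C′ → C ⟪ M ⟫ ≡ᶜ C′ ⟪ M ⟫

-- Configuration reduction

data _⟶ᶜ_ {n : ℕ} : Conf n → Conf n → Set where
  E-New     : ∀ {k} (F : TCtx k n) →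
              F [ new ]ᶠ
                ⟶ᶜ ν [] (renᶠ (2 ↑ʳ_) F [ pair (var (wkUnder k 0F)) (var (wkUnder k 1F)) ]ᶠ)
  E-Spawn   : ∀ {M N} (F : TCtx 0 n) → F [ spawn (pair M N) ]ᶠ ⟶ᶜ F [ N ]ᶠ ∥ ◇ ▸ M
  E-Recv    : ∀ {ms M C} (F : TCtx 0 (suc (suc n))) →
              ν (ms ∷ʳ term M) (F [ recv (var 1F) ]ᶠ ∥ C)
                ⟶ᶜ ν ms (F [ pair M (var 1F) ]ᶠ ∥ C)
  E-Case    : ∀ {k ms j Ms Mⱼ C} (F : TCtx k (suc (suc n))) → j ↦ Mⱼ ∈ᶠ Ms →
              ν (ms ∷ʳ label j) (F [ case (var (wkUnder k 1F)) Ms ]ᶠ ∥ C)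
                ⟶ᶜ ν ms (F [ Mⱼ · var (wkUnder k 1F) ]ᶠ ∥ C)
  E-LiftC   : ∀ {k} (G : GCtx k n) {C C′} → C ⟶ᶜ C′ → G [ C ]ᴳ ⟶ᶜ G [ C′ ]ᴳ
  E-LiftM   : ∀ {k} (F : TCtx k n) {M M′} → M ⟶ᴹ M′ → F [ M ]ᶠ ⟶ᶜ F [ M′ ]ᶠ
  E-ConfLiftSC : ∀ {C C′ D D′} → C ≡ᶜ C′ → C′ ⟶ᶜ D′ → D′ ≡ᶜ D → C ⟶ᶜ D

-- Typing environments: finite partial maps from the variables in scope.

Env : ℕ → Set
Env n = Vec (Maybe Type) n

∅ : ∀ {n} → Env n
∅ = replicate _ nothing

infix 5 _∶_

_∶_ : ∀ {n} → Fin n → Type → Env n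
x ∶ T = ∅ [ x ]≔ just T

-- Θ ≔ Γ , Δ : Γ and Δ have disjoint variables and Θ is the environment Γ,Δ.
infix 4 _≔_,_

data _≔_,_ : ∀ {n} → Env n → Env n → Env n → Set where
  []   : [] ≔ [] , []
  none : ∀ {n} {Θ Γ Δ : Env n} → Θ ≔ Γ , Δ → nothing ∷ Θ ≔ nothing ∷ Γ , nothing ∷ Δ
  inˡ  : ∀ {n T} {Θ Γ Δ : Env n} → Θ ≔ Γ , Δ → just T ∷ Θ ≔ just T ∷ Γ , nothing ∷ Δ
  inʳ  : ∀ {n T} {Θ Γ Δ : Env n} → Θ ≔ Γ , Δ → just T ∷ Θ ≔ nothing ∷ Γ , just T ∷ Δ

-- Term typing.  In V ∣ Γ ⊢ M ∶ T, the set V consists of the variables in scope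
-- that are not bound by an enclosing binder.  It is only used in T-EndR, whose
-- variable, lacking an assignment in the environment, has to be such a free
-- one: the type of a bound variable is always recorded by its binder, and uses
-- of it go through T-Var.  Without this, a bound x : end could occur any number
-- of times, or x could occur at type end beside its actual session type, and
-- reading SC-Send′ from right to left would then use x : !T.S twice.
infix 3 _∣_⊢_∶_

data _∣_⊢_∶_ {n : ℕ} (V : Subset n) : Env n → Term n → Type → Set where
  T-Var    : ∀ {x T} → V ∣ x ∶ T ⊢ var x ∶ T
  T-Abs    : ∀ {Γ M T U} → outside ∷ V ∣ just T ∷ Γ ⊢ M ∶ U → V ∣ Γ ⊢ ƛ M ∶ T ⊸ U
  T-App    : ∀ {Θ Γ Δ M N T U} → Θ ≔ Γ , Δ →
             V ∣ Γ ⊢ M ∶ T ⊸ U → V ∣ Δ ⊢ N ∶ T → V ∣ Θ ⊢ M · N ∶ U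
  T-Unit   : V ∣ ∅ ⊢ unit ∶ 𝟙
  T-Pair   : ∀ {Θ Γ Δ M N T U} → Θ ≔ Γ , Δ →
             V ∣ Γ ⊢ M ∶ T → V ∣ Δ ⊢ N ∶ U → V ∣ Θ ⊢ pair M N ∶ T ⊗ U
  T-Split  : ∀ {Θ Γ Δ M N T T′ U} → Θ ≔ Γ , Δ →
             V ∣ Γ ⊢ M ∶ T ⊗ T′ →
             outside ∷ outside ∷ V ∣ just T ∷ just T′ ∷ Δ ⊢ N ∶ U →
             V ∣ Θ ⊢ split M N ∶ U
  T-New    : ∀ {S} → V ∣ ∅ ⊢ new ∶ sess S ⊗ sess (dual S)
  T-Spawn  : ∀ {Γ M T} → V ∣ Γ ⊢ M ∶ 𝟙 ⊗ T → V ∣ Γ ⊢ spawn M ∶ T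
  T-EndL   : ∀ {Θ Γ x M T} → Θ ≔ Γ , x ∶ sess end → V ∣ Γ ⊢ M ∶ T → V ∣ Θ ⊢ M ∶ T
  T-EndR   : ∀ {x} → x ∈ V → V ∣ ∅ ⊢ var x ∶ sess end
  T-Send   : ∀ {Γ M T S} → V ∣ Γ ⊢ M ∶ T ⊗ sess (! T ∙ S) → V ∣ Γ ⊢ send M ∶ sess S
  T-Recv   : ∀ {Γ M T S} → V ∣ Γ ⊢ M ∶ sess (¿ T ∙ S) → V ∣ Γ ⊢ recv M ∶ T ⊗ sess S
  T-Select : ∀ {Γ M j Ss Sⱼ} → V ∣ Γ ⊢ M ∶ sess (⊕ Ss) → j ↦ Sⱼ ∈ᶠ Ss →
             V ∣ Γ ⊢ select j M ∶ sess Sⱼ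
  T-Case   : ∀ {Θ Γ Δ M Ns Ss U} → Θ ≔ Γ , Δ →
             V ∣ Γ ⊢ M ∶ sess (& Ss) →
             Pointwise (λ N S → V ∣ Δ ⊢ N ∶ sess S ⊸ U) Ns Ss →
             V ∣ Θ ⊢ case M Ns ∶ U
  T-Sub    : ∀ {Θ Γ Δ M N T U} → Θ ≔ Γ , Δ →
             outside ∷ V ∣ just T ∷ Γ ⊢ M ∶ U → V ∣ Δ ⊢ N ∶ T →
             V ∣ Θ ⊢ M ⟪ N ⟫ ∶ U
  T-Send′  : ∀ {Θ Γ Δ M N T S} → Θ ≔ Γ , Δ →
             V ∣ Γ ⊢ M ∶ T → V ∣ Δ ⊢ N ∶ sess (! T ∙ S) →
             V ∣ Θ ⊢ send′ M N ∶ sess S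

-- Buffer typing

infix 3 _∣_⊢ᴮ_∶_>_

data _∣_⊢ᴮ_∶_>_ {n : ℕ} (V : Subset n) : Env n → Buffer n → Session → Session → Set where
  T-Buf       : ∀ {S′} → V ∣ ∅ ⊢ᴮ [] ∶ S′ > S′
  T-BufSend   : ∀ {Θ Γ Δ M ms T S′ S} → Θ ≔ Γ , Δ →
                V ∣ Γ ⊢ M ∶ T → V ∣ Δ ⊢ᴮ ms ∶ S′ > S →
                V ∣ Θ ⊢ᴮ ms ∷ʳ term M ∶ S′ > ! T ∙ S
  T-BufSelect : ∀ {Γ ms j S′ Ss Sⱼ} →
                V ∣ Γ ⊢ᴮ ms ∶ S′ > Sⱼ → j ↦ Sⱼ ∈ᶠ Ss →
                V ∣ Γ ⊢ᴮ ms ∷ʳ label j ∶ S′ > ⊕ Ss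

-- Configuration typing

_⊹_ : Marker → Marker → Maybe Marker
main ⊹ main = nothing
main ⊹ ◇    = just main
◇    ⊹ main = just main
◇    ⊹ ◇    = just ◇

infix 3 _∣_⊢ᶜ[_]_∶_

data _∣_⊢ᶜ[_]_∶_ {n : ℕ} (V : Subset n) : Env n → Marker → Conf n → Type → Set where
  T-Main    : ∀ {Γ M T} → V ∣ Γ ⊢ M ∶ T → V ∣ Γ ⊢ᶜ[ main ] main ▸ M ∶ T
  T-Child   : ∀ {Γ M} → V ∣ Γ ⊢ M ∶ 𝟙 → V ∣ Γ ⊢ᶜ[ ◇ ] ◇ ▸ M ∶ 𝟙
  T-ParL    : ∀ {Θ Γ Δ φ ψ C D T} → Θ ≔ Γ , Δ → ◇ ⊹ φ ≡ just ψ →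
              V ∣ Γ ⊢ᶜ[ ◇ ] C ∶ 𝟙 → V ∣ Δ ⊢ᶜ[ φ ] D ∶ T →
              V ∣ Θ ⊢ᶜ[ ψ ] C ∥ D ∶ T
  T-ParR    : ∀ {Θ Γ Δ φ ψ C D T} → Θ ≔ Γ , Δ → φ ⊹ ◇ ≡ just ψ →
              V ∣ Γ ⊢ᶜ[ φ ] C ∶ T → V ∣ Δ ⊢ᶜ[ ◇ ] D ∶ 𝟙 →
              V ∣ Θ ⊢ᶜ[ ψ ] C ∥ D ∶ T
  T-Res     : ∀ {Θ Γ Δ φ ms C S′ S T} → Θ ≔ Γ , Δ →
              outside ∷ outside ∷ V ∣ nothing ∷ nothing ∷ Γ ⊢ᴮ ms ∶ S′ > S →
              outside ∷ outside ∷ V ∣ just (sess S′) ∷ just (sess (dual S)) ∷ Δ ⊢ᶜ[ φ ] C ∶ T →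
              V ∣ Θ ⊢ᶜ[ φ ] ν ms C ∶ T
  T-ResBuf  : ∀ {Θ Γ Δ φ ms C S′ S T} → Θ ≔ Γ , Δ →
              outside ∷ outside ∷ V ∣ nothing ∷ just (sess (dual S)) ∷ Γ ⊢ᴮ ms ∶ S′ > S →
              outside ∷ outside ∷ V ∣ just (sess S′) ∷ nothing ∷ Δ ⊢ᶜ[ φ ] C ∶ T →
              V ∣ Θ ⊢ᶜ[ φ ] ν ms C ∶ T
  T-ConfSub : ∀ {Θ Γ Δ φ C M T U} → Θ ≔ Γ , Δ →
              outside ∷ V ∣ just T ∷ Γ ⊢ᶜ[ φ ] C ∶ U → V ∣ Δ ⊢ M ∶ T →
              V ∣ Θ ⊢ᶜ[ φ ] C ⟪ M ⟫ ∶ U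

-- The judgement for a whole configuration: all variables in scope are free.
infix 3 _⊢[_]_∶_

_⊢[_]_∶_ : ∀ {n} → Env n → Marker → Conf n → Type → Set
Γ ⊢[ φ ] C ∶ T = ⊤ ∣ Γ ⊢ᶜ[ φ ] C ∶ T

module Submission where

-- Typing is first recast without T-EndL, which is absorbed by the leaves of a
-- derivation, and with environments that are functions split pointwise; the two
-- presentations are equivalent.  Typing is then preserved and reflected by injective
-- renamings (an environment entry outside of the image must have type end), and a
-- typing of a filled context splits into a typing of the context and one of its hole
-- that can be modified independently.  What remains is to move resources along
-- environment splits: in SC-SubExt, SC-ResExt and their relatives an entry of type end
-- that was given to an expression that cannot mention it goes to its neighbour, and in
-- the rules for buffers the type of an endpoint changes along the path from its binder
-- to the hole.

open import Data.Bool using (Bool; true; false)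
open import Data.Fin using (Fin; zero; suc; lift; _↑ʳ_; _≟_)
open import Data.Fin.Patterns using (0F; 1F; 2F; 3F)
open import Data.Fin.Properties using (any?; suc-injective)
open import Data.Fin.Subset using (Subset; ⊤; outside; _∈_)
open import Data.List using ([]; _∷_; _∷ʳ_)
open import Data.Maybe as Maybe using (Maybe; just; nothing)
open import Data.Maybe.Properties using (just-injective)
open import Data.Nat using (ℕ; zero; suc; _+_; _≤_; _≤?_)
open import Data.Nat.Properties using (≤-trans; <⇒≤; <-irrefl)
open import Data.Product using (∃; _×_; _,_; proj₁; proj₂; -,_)
open import Data.Sum using (_⊎_; inj₁; inj₂)
open import Data.Vec using (Vec; []; _∷_; lookup; tabulate; replicate; here; there)
open import Data.Vec.Functional using () renaming (_∷_ to _◃_)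
open import Data.Vec.Properties
  using (lookup-replicate; lookup∘tabulate; tabulate∘lookup; lookup∘update; lookup∘update′; lookup⇒[]=)
open import Function using (_∘_)
open import Function.Definitions using (Injective)
open import Relation.Binary.PropositionalEquality
  using (_≡_; _≢_; refl; cong; subst; subst₂; module ≡-Reasoning)
  renaming (sym to ≡-sym; trans to ≡-trans)
open import Relation.Nullary using (yes; no; contradiction; recompute)
open import Defs

variable
  k m n : ℕ
  a b c θ γ δ : Maybe Type
  T U : Type
  S S′ : Session

Ctx : ℕ → Set
Ctx n = Fin n → Maybe Type

Vars : ℕ → Set
Vars n = Fin n → Bool

data Part : (θ γ δ : Maybe Type) → Set where
  none  : Part nothing nothing nothing
  left  : Part (just T) (just T) nothing
  right : Part (just T) nothing (just T)

record Split {n} (Θ Γ Δ : Ctx n) : Set where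
  constructor mk
  field part : ∀ x → Part (Θ x) (Γ x) (Δ x)
open Split public

infix 4 _⊑₁_ _⊑_

data _⊑₁_ : Maybe Type → Maybe Type → Set where
  same : a ⊑₁ a
  drop : nothing ⊑₁ just (sess end)

record _⊑_ {n} (Γ Γ′ : Ctx n) : Set where
  constructor mk
  field at : ∀ x → Γ x ⊑₁ Γ′ x
open _⊑_ public

Unr : Maybe Type → Set
Unr a = nothing ⊑₁ a

variable
  V V′ : Vars n
  Γ Γ′ Γ₁ Γ₂ Δ Δ′ Δ₁ Δ₂ Θ Θ′ Ξ Ξ′ : Ctx n

⊑₁-trans : a ⊑₁ b → b ⊑₁ c → a ⊑₁ c
⊑₁-trans same q = q
⊑₁-trans drop same = drop

⊑₁-reflexive : a ≡ b → a ⊑₁ b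
⊑₁-reflexive refl = same

⊑-reflexive : (∀ x → Γ x ≡ Γ′ x) → Γ ⊑ Γ′
⊑-reflexive eq = mk λ x → ⊑₁-reflexive (eq x)

⊑-cons : Γ ⊑ Γ′ → (b ◃ Γ) ⊑ (b ◃ Γ′)
⊑-cons p = mk λ { zero → same ; (suc x) → at p x }

◃-η : ∀ {A : Set} {Γ : Fin (suc n) → A} x → Γ x ≡ (Γ zero ◃ Γ ∘ suc) x
◃-η zero    = refl
◃-η (suc x) = refl

part-swap : Part θ γ δ → Part θ δ γ
part-swap none = none
part-swap left = right
part-swap right = left

part-right : Part θ nothing θ
part-right {just _}  = right
part-right {nothing} = none

part-left : Part θ θ nothing
part-left = part-swap part-right

part-absent : γ ≡ nothing → Part θ γ θ
part-absent refl = part-right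

part-nothingˡ : Part θ nothing δ → θ ≡ δ
part-nothingˡ none = refl
part-nothingˡ right = refl

part-unr : Part θ γ δ → Unr γ → Unr δ → Unr θ
part-unr none _ _ = same
part-unr left p _ = p
part-unr right _ q = q

part-unrˡ : Part θ γ δ → Unr γ → δ ⊑₁ θ
part-unrˡ none _ = same
part-unrˡ left p = p
part-unrˡ right _ = same

part-justʳ : Part θ γ (just T) → θ ≡ just T × γ ≡ nothing
part-justʳ right = refl , refl

part-justˡ : Part θ (just T) δ → θ ≡ just T × δ ≡ nothing
part-justˡ left = refl , refl

part-assocʳ : Part θ γ δ → Part γ a b → ∃ λ e → Part θ a e × Part e b δ
part-assocʳ none  none  = -, none , none
part-assocʳ left  left  = -, left , none
part-assocʳ left  right = -, right , left
part-assocʳ right none  = -, right , right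

part-weaken : Part θ γ δ → θ ⊑₁ a → ∃ λ c → γ ⊑₁ c × Part a c δ
part-weaken p    same = -, same , p
part-weaken none drop = -, drop , left

split-swap : Split Θ Γ Δ → Split Θ Δ Γ
split-swap s = mk λ x → part-swap (part s x)

split-assocʳ : Split Θ Γ Δ → Split Γ Γ₁ Γ₂ → ∃ λ E → Split Θ Γ₁ E × Split E Γ₂ Δ
split-assocʳ s t = (λ x → proj₁ (p x)) , mk (λ x → proj₁ (proj₂ (p x))) , mk (λ x → proj₂ (proj₂ (p x)))
  where p = λ x → part-assocʳ (part s x) (part t x)

split-assocˡ : Split Θ Γ Δ → Split Δ Δ₁ Δ₂ → ∃ λ E → Split Θ E Δ₂ × Split E Γ Δ₁
split-assocˡ s t with _ , s′ , t′ ← split-assocʳ (split-swap s) (split-swap t) =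
  -, split-swap s′ , split-swap t′

split-pull : Split Θ Γ Δ → Split Δ Δ₁ Δ₂ → ∃ λ E → Split Θ Δ₁ E × Split E Γ Δ₂
split-pull s t with _ , s′ , t′ ← split-assocʳ (split-swap s) t = -, s′ , split-swap t′

split-exchange : Split Θ Γ Δ → Split Γ Γ₁ Γ₂ → ∃ λ E → Split Θ E Γ₂ × Split E Γ₁ Δ
split-exchange s t with _ , s′ , t′ ← split-assocˡ (split-swap s) t = -, s′ , split-swap t′

split-cons : Part θ γ δ → Split Θ Γ Δ → Split (θ ◃ Θ) (γ ◃ Γ) (δ ◃ Δ)
split-cons p s = mk λ { zero → p ; (suc x) → part s x }

split-uncons : {Γ : Ctx (suc n)} → Part θ (Γ zero) δ → Split Θ (Γ ∘ suc) Δ → Split (θ ◃ Θ) Γ (δ ◃ Δ)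
split-uncons p s = mk λ { zero → p ; (suc x) → part s x }

split-cons₂ : Part θ γ δ → Part a b c → Split Θ Γ Δ → Split (θ ◃ a ◃ Θ) (γ ◃ b ◃ Γ) (δ ◃ c ◃ Δ)
split-cons₂ p q s = split-cons p (split-cons q s)

split-∘ : (ρ : Fin m → Fin n) → Split Θ Γ Δ → Split (Θ ∘ ρ) (Γ ∘ ρ) (Δ ∘ ρ)
split-∘ ρ s = mk λ x → part s (ρ x)

split-weakenˡ : Split Θ Γ Δ → Θ ⊑ Θ′ → ∃ λ Γ′ → Γ ⊑ Γ′ × Split Θ′ Γ′ Δ
split-weakenˡ s p = (λ x → proj₁ (q x)) , mk (λ x → proj₁ (proj₂ (q x))) , mk (λ x → proj₂ (proj₂ (q x)))
  where q = λ x → part-weaken (part s x) (at p x)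

split-weakenʳ : Split Θ Γ Δ → Θ ⊑ Θ′ → ∃ λ Δ′ → Δ ⊑ Δ′ × Split Θ′ Γ Δ′
split-weakenʳ s p with _ , q , s′ ← split-weakenˡ (split-swap s) p = -, q , split-swap s′

split-unrˡ : Split Θ Γ Δ → (∀ x → Unr (Γ x)) → Δ ⊑ Θ
split-unrˡ s u = mk λ x → part-unrˡ (part s x) (u x)

split-resp : (∀ x → Θ x ≡ Θ′ x) → Split Θ Γ Δ → Split Θ′ Γ Δ
split-resp eq s = mk λ x → subst (λ θ → Part θ _ _) (eq x) (part s x)

infixl 9 _[_≔_]

_[_≔_] : Ctx n → Fin n → Type → Ctx n
(Γ [ x ≔ T ]) y with y ≟ x
... | yes _ = just T
... | no  _ = Γ y

[≔]-here : ∀ (Γ : Ctx n) x → (Γ [ x ≔ T ]) x ≡ just T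
[≔]-here Γ x with x ≟ x
... | yes _ = refl
... | no x≢x = contradiction refl x≢x

[≔]-there : ∀ {x y} → y ≢ x → (Γ [ x ≔ T ]) y ≡ Γ y
[≔]-there {x = x} {y} y≢x with y ≟ x
... | yes y≡x = contradiction y≡x y≢x
... | no  _ = refl

split-retype : ∀ {x} → Split Θ Γ Δ → Δ x ≡ just T → Split (Θ [ x ≔ U ]) Γ (Δ [ x ≔ U ])
split-retype {Θ = Θ} {Γ} {Δ} {T = T} {U} {x} s eq = mk go
  where
  go : ∀ y → Part ((Θ [ x ≔ U ]) y) (Γ y) ((Δ [ x ≔ U ]) y)
  go y with y ≟ x
  ... | no _ = part s y
  ... | yes refl =
    subst (λ γ → Part _ γ _) (≡-sym (proj₂ (part-justʳ (subst (Part _ _) eq (part s x))))) right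

split-justʳ : ∀ {x} → Split Θ Γ Δ → Δ x ≡ just T → Θ x ≡ just T
split-justʳ s eq = proj₁ (part-justʳ (subst (Part _ _) eq (part s _)))

split-emptyˡ : ∀ {x} → Split Θ Γ Δ → Δ x ≡ just T → Γ x ≡ nothing
split-emptyˡ s eq = proj₂ (part-justʳ (subst (Part _ _) eq (part s _)))

split-nothing : ∀ {x} → Split Θ Γ Δ → Θ x ≡ nothing → Γ x ≡ nothing × Δ x ≡ nothing
split-nothing {x = x} s eq with part-both ← subst (λ θ → Part θ _ _) eq (part s x) = go part-both
  where
  go : Part nothing γ δ → γ ≡ nothing × δ ≡ nothing
  go none = refl , refl

-- Scope of the hole of a context

extend : ∀ {A : Set} → Vec A k → (Fin n → A) → Fin (under k n) → A
extend []      Ξ = Ξ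
extend (b ∷ B) Ξ = extend B (b ◃ Ξ)

bound : ∀ k → Fin k → Fin (under k n)
bound (suc k) zero    = wkUnder k zero
bound (suc k) (suc i) = bound k i

data UnderView (k : ℕ) {n} : Fin (under k n) → Set where
  inner : ∀ i → UnderView k (bound k i)
  outer : ∀ x → UnderView k (wkUnder k x)

underView : ∀ k (y : Fin (under k n)) → UnderView k y
underView zero y = outer y
underView (suc k) y with underView k y
... | inner i       = inner (suc i)
... | outer zero    = inner zero
... | outer (suc x) = outer x

extend-wkUnder : ∀ {A : Set} (B : Vec A k) (Ξ : Fin n → A) x → extend B Ξ (wkUnder k x) ≡ Ξ x
extend-wkUnder []      Ξ x = refl
extend-wkUnder (b ∷ B) Ξ x = extend-wkUnder B (b ◃ Ξ) (suc x)

extend-bound : ∀ {A : Set} (B : Vec A k) (Ξ : Fin n → A) i → extend B Ξ (bound k i) ≡ lookup B i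
extend-bound (b ∷ B) Ξ zero    = extend-wkUnder B (b ◃ Ξ) zero
extend-bound (b ∷ B) Ξ (suc i) = extend-bound B (b ◃ Ξ) i

wkUnder-injective : ∀ k → Injective {A = Fin n} _≡_ _≡_ (wkUnder k)
wkUnder-injective k {x} {y} eq = just-injective (begin
  just x                                       ≡⟨ extend-wkUnder (replicate k nothing) just x ⟨
  extend (replicate k nothing) just (wkUnder k x) ≡⟨ cong (extend (replicate k nothing) just) eq ⟩
  extend (replicate k nothing) just (wkUnder k y) ≡⟨ extend-wkUnder (replicate k nothing) just y ⟩
  just y                                       ∎)
  where open ≡-Reasoning

bound≢wkUnder : ∀ k {n} i (x : Fin n) → bound k i ≢ wkUnder k x
bound≢wkUnder (suc k) zero    x eq with () ← wkUnder-injective k eq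
bound≢wkUnder (suc k) (suc i) x eq = bound≢wkUnder k i (suc x) eq

liftUnder-wkUnder : ∀ k (ρ : Fin m → Fin n) x → liftUnder k ρ (wkUnder k x) ≡ wkUnder k (ρ x)
liftUnder-wkUnder zero    ρ x = refl
liftUnder-wkUnder (suc k) ρ x = liftUnder-wkUnder k (lift 1 ρ) (suc x)

liftUnder-bound : ∀ k (ρ : Fin m → Fin n) i → liftUnder k ρ (bound k i) ≡ bound k i
liftUnder-bound (suc k) ρ zero    = liftUnder-wkUnder k (lift 1 ρ) zero
liftUnder-bound (suc k) ρ (suc i) = liftUnder-bound k (lift 1 ρ) i

unsink : ∀ k → Fin (under k (suc n)) → Fin (suc (under k n))
unsink k = extend (tabulate (suc ∘ bound k)) (zero ◃ (suc ∘ wkUnder k))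

unsink∘sink : ∀ k (z : Fin (suc (under k n))) → unsink k (sink k z) ≡ z
unsink∘sink k zero = extend-wkUnder (tabulate (suc ∘ bound k)) (zero ◃ (suc ∘ wkUnder k)) zero
unsink∘sink k (suc z) with underView k z
... | inner i = ≡-trans (cong (unsink k) (liftUnder-bound k suc i))
                 (≡-trans (extend-bound (tabulate (suc ∘ bound k)) (zero ◃ (suc ∘ wkUnder k)) i)
                   (lookup∘tabulate (suc ∘ bound k) i))
... | outer x = ≡-trans (cong (unsink k) (liftUnder-wkUnder k suc x))
                  (extend-wkUnder (tabulate (suc ∘ bound k)) (zero ◃ (suc ∘ wkUnder k)) (suc x))

sink-injective : ∀ k → Injective {A = Fin (suc (under k n))} _≡_ _≡_ (sink k)
sink-injective k {y} {z} eq =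
  ≡-trans (≡-sym (unsink∘sink k y)) (≡-trans (cong (unsink k) eq) (unsink∘sink k z))

sink-surjective : ∀ k (y : Fin (under k (suc n))) → ∃ λ z → sink k z ≡ y
sink-surjective k y with underView k y
... | inner i       = suc (bound k i) , liftUnder-bound k suc i
... | outer zero    = zero , refl
... | outer (suc x) = suc (wkUnder k x) , liftUnder-wkUnder k suc x

extend-sink : ∀ {A : Set} (B : Vec A k) (Ξ : Fin (suc n) → A) z →
              extend B Ξ (sink k z) ≡ (Ξ zero ◃ extend B (Ξ ∘ suc)) z
extend-sink B Ξ zero = extend-wkUnder B Ξ zero
extend-sink {k = k} B Ξ (suc z) with underView k z
... | inner i = ≡-trans (cong (extend B Ξ) (liftUnder-bound k suc i))
                  (≡-trans (extend-bound B Ξ i) (≡-sym (extend-bound B (Ξ ∘ suc) i)))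
... | outer x = ≡-trans (cong (extend B Ξ) (liftUnder-wkUnder k suc x))
                  (≡-trans (extend-wkUnder B Ξ (suc x)) (≡-sym (extend-wkUnder B (Ξ ∘ suc) x)))

extend-⊑ : (B : Vec (Maybe Type) k) → Ξ ⊑ Ξ′ → extend B Ξ ⊑ extend B Ξ′
extend-⊑ []      p = p
extend-⊑ (b ∷ B) p = extend-⊑ B (⊑-cons p)

extend-retype : ∀ {x} (B : Vec (Maybe Type) k) y →
                extend B (Ξ [ x ≔ T ]) y ≡ (extend B Ξ [ wkUnder k x ≔ T ]) y
extend-retype {k = k} {Ξ = Ξ} {T = T} {x} B y with underView k y
... | inner i = ≡-trans (extend-bound B (Ξ [ x ≔ T ]) i)
                  (≡-sym (≡-trans ([≔]-there (bound≢wkUnder k i x)) (extend-bound B Ξ i)))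
... | outer z with z ≟ x
...   | yes refl = ≡-trans (extend-wkUnder B (Ξ [ z ≔ T ]) z)
                     (≡-trans ([≔]-here Ξ z) (≡-sym ([≔]-here (extend B Ξ) (wkUnder k z))))
...   | no z≢x = ≡-trans (extend-wkUnder B (Ξ [ x ≔ T ]) z)
                   (≡-trans ([≔]-there z≢x)
                     (≡-sym (≡-trans ([≔]-there (z≢x ∘ wkUnder-injective k)) (extend-wkUnder B Ξ z))))

split-extendʳ : (B : Vec (Maybe Type) k) → Split Ξ Γ Δ →
                Split (extend B Ξ) (extend B Γ) (extend (replicate k nothing) Δ)
split-extendʳ []      s = s
split-extendʳ (b ∷ B) s = split-extendʳ B (split-cons part-left s)

-- Renamings

Off : (Fin m → Fin n) → Ctx n → Set
Off ρ Γ = ∀ y → (∀ x → ρ x ≢ y) → Unr (Γ y)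

-- `own y` is the variable that hands its share of the environment to y.  A
-- renaming need not be injective: a variable of type end may also be mapped to a
-- free variable, which needs no share.
record Renaming (ρ : Fin m → Fin n) (V : Vars m) (V′ : Vars n) (Γ : Ctx m) (Γ′ : Ctx n) : Set where
  field
    free : ∀ x → V x ≡ true → V′ (ρ x) ≡ true
    own  : Fin n → Maybe (Fin m)
    fwd  : ∀ x → Γ x ≡ just T →
           own (ρ x) ≡ just x × Γ′ (ρ x) ≡ just T ⊎ T ≡ sess end × V′ (ρ x) ≡ true
    bwd  : ∀ y → Unr (Γ′ y) ⊎ ∃ λ x → own y ≡ just x × ρ x ≡ y × Γ x ≡ Γ′ y
open Renaming public

record Pullback (ρ : Fin m → Fin n) (V : Vars m) (V′ : Vars n) (Γ : Ctx m) (Γ′ : Ctx n) : Set where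
  field
    inj  : Injective _≡_ _≡_ ρ
    free : ∀ x → V′ (ρ x) ≡ true → V x ≡ true
    env  : ∀ x → Γ′ (ρ x) ≡ Γ x
open Pullback public

variable
  ρ : Fin m → Fin n

renaming-lift : ∀ j {V : Vars (j + m)} {V′ : Vars (j + n)}
                {Γ : Ctx (suc (j + m))} {Γ′ : Ctx (suc (j + n))} →
                Γ zero ≡ Γ′ zero → Renaming (lift j ρ) V V′ (Γ ∘ suc) (Γ′ ∘ suc) →
                Renaming (lift (suc j) ρ) (false ◃ V) (false ◃ V′) Γ Γ′
renaming-lift {ρ = ρ} j {Γ = Γ} {Γ′} eq₀ r = record
  { free = λ { (suc x) p → free r x p }
  ; own  = just zero ◃ (Maybe.map suc ∘ own r)
  ; fwd  = fwd′
  ; bwd  = bwd′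
  }
  where
  fwd′ : ∀ {T} x → Γ x ≡ just T → _
  fwd′ zero    eq = inj₁ (refl , ≡-trans (≡-sym eq₀) eq)
  fwd′ (suc x) eq with fwd r x eq
  ... | inj₁ (o , eq′) = inj₁ (cong (Maybe.map suc) o , eq′)
  ... | inj₂ p         = inj₂ p
  bwd′ : ∀ y → _
  bwd′ zero    = inj₂ (zero , refl , refl , eq₀)
  bwd′ (suc y) with bwd r y
  ... | inj₁ p                  = inj₁ p
  ... | inj₂ (x , o , eq , eq′) =
    inj₂ (suc x , cong (Maybe.map suc) o , cong suc eq , eq′)

renaming-lift₁ : Renaming ρ V V′ Γ Γ′ → Renaming (lift 1 ρ) (false ◃ V) (false ◃ V′) (b ◃ Γ) (b ◃ Γ′)
renaming-lift₁ = renaming-lift 0 refl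

renaming-lift₂ : Renaming ρ V V′ Γ Γ′ →
                 Renaming (lift 2 ρ) (false ◃ false ◃ V) (false ◃ false ◃ V′) (a ◃ b ◃ Γ) (a ◃ b ◃ Γ′)
renaming-lift₂ r = renaming-lift 1 refl (renaming-lift 0 refl r)

pullback-lift : ∀ j {V : Vars (j + m)} {V′ : Vars (j + n)}
                {Γ : Ctx (suc (j + m))} {Γ′ : Ctx (suc (j + n))} →
                Γ′ zero ≡ Γ zero → Pullback (lift j ρ) V V′ (Γ ∘ suc) (Γ′ ∘ suc) →
                Pullback (lift (suc j) ρ) (false ◃ V) (false ◃ V′) Γ Γ′
pullback-lift j eq₀ r = record
  { inj  = λ { {zero} {zero} _ → refl ; {suc x} {suc y} eq → cong suc (inj r (suc-injective eq)) }
  ; free = λ { (suc x) p → free r x p }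
  ; env  = λ { zero → eq₀ ; (suc x) → env r x }
  }

pullback-lift₁ : Pullback ρ V V′ Γ Γ′ → Pullback (lift 1 ρ) (false ◃ V) (false ◃ V′) (b ◃ Γ) (b ◃ Γ′)
pullback-lift₁ = pullback-lift 0 refl

pullback-lift₂ : Pullback ρ V V′ Γ Γ′ →
                 Pullback (lift 2 ρ) (false ◃ false ◃ V) (false ◃ false ◃ V′) (a ◃ b ◃ Γ) (a ◃ b ◃ Γ′)
pullback-lift₂ r = pullback-lift 1 refl (pullback-lift 0 refl r)

renaming-inj : Injective _≡_ _≡_ ρ → (∀ x → V x ≡ true → V′ (ρ x) ≡ true) →
               (∀ x → Γ′ (ρ x) ≡ Γ x) → Off ρ Γ′ → Renaming ρ V V′ Γ Γ′
renaming-inj {ρ = ρ} {V′ = V′} {Γ′ = Γ′} {Γ = Γ} ρ-inj V⊆ eq off = record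
  { free = V⊆ ; own = owner ; fwd = λ x e → inj₁ (owner-ρ x , ≡-trans (eq x) e) ; bwd = bwd′ }
  where
  owner : ∀ y → Maybe _
  owner y with any? (λ x → ρ x ≟ y)
  ... | yes (x , _) = just x
  ... | no _        = nothing
  owner-ρ : ∀ x → owner (ρ x) ≡ just x
  owner-ρ x with any? (λ z → ρ z ≟ ρ x)
  ... | yes (z , e) = cong just (ρ-inj e)
  ... | no ¬p       = contradiction (x , refl) ¬p
  bwd′ : ∀ y → Unr (Γ′ y) ⊎ ∃ λ x → owner y ≡ just x × ρ x ≡ y × Γ x ≡ Γ′ y
  bwd′ y with any? (λ x → ρ x ≟ y)
  ... | yes (x , refl) = inj₂ (x , refl , refl , ≡-sym (eq x))
  ... | no ¬p          = inj₁ (off y λ x e → ¬p (x , e))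

-- The owner of a variable decides which side of the split it goes to.
renaming-split : Renaming ρ V V′ Γ Γ′ → Split Γ Γ₁ Γ₂ →
                 ∃ λ Γ₁′ → ∃ λ Γ₂′ → Split Γ′ Γ₁′ Γ₂′ × Renaming ρ V V′ Γ₁ Γ₁′ × Renaming ρ V V′ Γ₂ Γ₂′
renaming-split {ρ = ρ} {V = V} {V′ = V′} {Γ = Γ} {Γ′ = Γ′} {Γ₁ = Γ₁} {Γ₂ = Γ₂} r s =
  (λ y → l (own r y) y) , (λ y → r′ (own r y) y) , mk (λ y → lr (own r y) y) ,
  record { free = free r ; own = own r ; fwd = fwd₁ ; bwd = bwd₁ } ,
  record { free = free r ; own = own r ; fwd = fwd₂ ; bwd = bwd₂ }
  where
  pick : Maybe Type → Maybe Type → Maybe Type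
  pick (just _) g = g
  pick nothing  g = nothing
  rest : Maybe Type → Maybe Type → Maybe Type
  rest (just _) g = nothing
  rest nothing  g = g
  l r′ : Maybe _ → _ → Maybe Type
  l (just x) y = pick (Γ₁ x) (Γ′ y)
  l nothing  y = nothing
  r′ (just x) y = rest (Γ₁ x) (Γ′ y)
  r′ nothing  y = Γ′ y
  lr : ∀ o y → Part (Γ′ y) (l o y) (r′ o y)
  lr nothing y = part-right
  lr (just x) y with Γ₁ x
  ... | just _  = part-left
  ... | nothing = part-right
  fwd₁ : ∀ {T} x → Γ₁ x ≡ just T →
         own r (ρ x) ≡ just x × l (own r (ρ x)) (ρ x) ≡ just T ⊎ T ≡ sess end × V′ (ρ x) ≡ true
  fwd₁ x eq with fwd r x (proj₁ (part-justˡ (subst (λ γ → Part _ γ _) eq (part s x))))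
  ... | inj₂ p = inj₂ p
  ... | inj₁ (o , eq′) rewrite o | eq = inj₁ (refl , eq′)
  fwd₂ : ∀ {T} x → Γ₂ x ≡ just T →
         own r (ρ x) ≡ just x × r′ (own r (ρ x)) (ρ x) ≡ just T ⊎ T ≡ sess end × V′ (ρ x) ≡ true
  fwd₂ x eq with part-justʳ (subst (Part _ _) eq (part s x))
  ... | Γx , Γ₁x with fwd r x Γx
  ...   | inj₂ p = inj₂ p
  ...   | inj₁ (o , eq′) rewrite o | Γ₁x = inj₁ (refl , eq′)
  bwd₁ : ∀ y → Unr (l (own r y) y) ⊎ ∃ λ x → own r y ≡ just x × ρ x ≡ y × Γ₁ x ≡ l (own r y) y
  bwd₁ y with bwd r y
  bwd₁ y | inj₂ (x , o , eq , eq′) rewrite o with Γ₁ x in e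
  ... | nothing = inj₁ same
  ... | just _ = inj₂ (x , refl , eq ,
    ≡-trans (≡-trans e (≡-sym (proj₁ (part-justˡ (subst (λ γ → Part _ γ _) e (part s x)))))) eq′)
  bwd₁ y | inj₁ u with own r y
  ... | nothing = inj₁ same
  ... | just x with Γ₁ x
  ...   | nothing = inj₁ same
  ...   | just _  = inj₁ u
  bwd₂ : ∀ y → Unr (r′ (own r y) y) ⊎ ∃ λ x → own r y ≡ just x × ρ x ≡ y × Γ₂ x ≡ r′ (own r y) y
  bwd₂ y with bwd r y
  bwd₂ y | inj₂ (x , o , eq , eq′) rewrite o with Γ₁ x in e
  ... | just _ = inj₁ same
  ... | nothing = inj₂ (x , refl , eq ,
    ≡-trans (≡-sym (part-nothingˡ (subst (λ γ → Part _ γ _) e (part s x)))) eq′)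
  bwd₂ y | inj₁ u with own r y
  ... | nothing = inj₁ u
  ... | just x with Γ₁ x
  ...   | nothing = inj₁ u
  ...   | just _  = inj₁ same

pullback-split : Pullback ρ V V′ Γ Γ′ → Split Γ′ Γ₁ Γ₂ → Split Γ (Γ₁ ∘ ρ) (Γ₂ ∘ ρ)
pullback-split r s = mk λ x → subst (λ θ → Part θ _ _) (env r x) (part s _)

pullback-of : Pullback ρ V V′ Γ Γ′ → Pullback ρ V V′ (Δ ∘ ρ) Δ
pullback-of r = record { inj = inj r ; free = free r ; env = λ _ → refl }

off-split : Split Γ Γ₁ Γ₂ → Off ρ Γ₁ → Off ρ Γ₂ → Off ρ Γ
off-split s p q y y∉ = part-unr (part s y) (p y y∉) (q y y∉)

off-lift : ∀ j {ρ : Fin m → Fin n} {Γ : Ctx (suc (j + n))} →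
           Off (lift (suc j) ρ) Γ → Off (lift j ρ) (Γ ∘ suc)
off-lift j p y y∉ = p (suc y) λ { (suc x) eq → y∉ x (suc-injective eq) }

renaming-unr : Renaming ρ V V′ Γ Γ′ → (∀ x → Unr (Γ x)) → ∀ y → Unr (Γ′ y)
renaming-unr r u y with bwd r y
... | inj₁ p                 = p
... | inj₂ (x , _ , _ , eq) = subst Unr eq (u x)

renaming-suc : Renaming suc V (false ◃ V) Γ (nothing ◃ Γ)
renaming-suc = renaming-inj suc-injective (λ _ v → v) (λ _ → refl)
  λ { zero _ → same ; (suc y) y∉ → contradiction refl (y∉ y) }

pullback-suc : {V : Vars n} {Γ : Ctx (suc n)} → Pullback suc V (false ◃ V) (Γ ∘ suc) Γ
pullback-suc = record { inj = suc-injective ; free = λ _ v → v ; env = λ _ → refl }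

renaming-suc² : Renaming (2 ↑ʳ_) V (false ◃ false ◃ V) Γ (nothing ◃ nothing ◃ Γ)
renaming-suc² = renaming-inj (suc-injective ∘ suc-injective) (λ _ v → v) (λ _ → refl)
  λ { 0F _ → same ; 1F _ → same ; (suc (suc y)) y∉ → contradiction refl (y∉ y) }

pullback-suc² : {V : Vars n} {Γ : Ctx (suc (suc n))} →
                Pullback (2 ↑ʳ_) V (false ◃ false ◃ V) (λ x → Γ (suc (suc x))) Γ
pullback-suc² = record { inj = suc-injective ∘ suc-injective ; free = λ _ v → v ; env = λ _ → refl }

falses : ∀ k → Vec Bool k
falses k = replicate k false

nothings : ∀ k → Vec (Maybe Type) k
nothings k = replicate k nothing

renaming-wkUnder : ∀ k {V : Vars n} {Γ : Ctx n} →
                   Renaming (wkUnder k) V (extend (falses k) V) Γ (extend (nothings k) Γ)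
renaming-wkUnder k {V} {Γ} = renaming-inj (wkUnder-injective k)
  (λ x v → ≡-trans (extend-wkUnder (falses k) V x) v) (extend-wkUnder (nothings k) Γ) off
  where
  off : Off (wkUnder k) (extend (nothings k) Γ)
  off y y∉ with underView k y
  ... | outer x = contradiction refl (y∉ x)
  ... | inner i = ⊑₁-reflexive
    (≡-sym (≡-trans (extend-bound (nothings k) Γ i) (lookup-replicate i nothing)))

pullback-wkUnder : ∀ k {V : Vars n} {Γ : Ctx (under k n)} →
                   Pullback (wkUnder k) V (extend (falses k) V) (Γ ∘ wkUnder k) Γ
pullback-wkUnder k {V} = record
  { inj  = wkUnder-injective k
  ; free = λ x v → ≡-trans (≡-sym (extend-wkUnder (falses k) V x)) v
  ; env  = λ _ → refl
  }

renaming-sink : ∀ k {V : Vars n} {B : Vec (Maybe Type) k} {Ξ : Ctx n} →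
                Renaming (sink k {n}) (false ◃ extend (falses k) V) (extend (falses k) (false ◃ V))
                  (a ◃ extend B Ξ) (extend B (a ◃ Ξ))
renaming-sink {n = n} {a = a} k {V} {B} {Ξ} = renaming-inj (sink-injective {n = n} k)
  (λ x v → ≡-trans (extend-sink (falses k) (false ◃ V) x) v) (extend-sink B (a ◃ Ξ))
  λ y y∉ → contradiction (proj₂ (sink-surjective k y)) (y∉ (proj₁ (sink-surjective k y)))

pullback-sink : ∀ k {V : Vars n} {B : Vec (Maybe Type) k} {Ξ : Ctx n} →
                Pullback (sink k {n}) (false ◃ extend (falses k) V) (extend (falses k) (false ◃ V))
                  (a ◃ extend B Ξ) (extend B (a ◃ Ξ))
pullback-sink {n = n} {a = a} k {V} {B} {Ξ} = record
  { inj  = sink-injective {n = n} k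
  ; free = λ x v → ≡-trans (≡-sym (extend-sink (falses k) (false ◃ V) x)) v
  ; env  = extend-sink B (a ◃ Ξ)
  }

bijective-renaming : (∀ x → ρ (ρ x) ≡ x) → (∀ x → V x ≡ true → V′ (ρ x) ≡ true) →
                     Renaming ρ V V′ (Γ ∘ ρ) Γ
bijective-renaming {ρ = ρ} inv V⊆ = renaming-inj
  (λ {x} {y} eq → ≡-trans (≡-sym (inv x)) (≡-trans (cong ρ eq) (inv y)))
  V⊆ (λ _ → refl) λ y y∉ → contradiction (inv y) (y∉ (ρ y))

bijective-pullback : (∀ x → ρ (ρ x) ≡ x) → (∀ x → V′ (ρ x) ≡ true → V x ≡ true) →
                     Pullback ρ V V′ (Γ ∘ ρ) Γ
bijective-pullback {ρ = ρ} inv V⊇ = record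
  { inj  = λ {x} {y} eq → ≡-trans (≡-sym (inv x)) (≡-trans (cong ρ eq) (inv y))
  ; free = V⊇
  ; env  = λ _ → refl
  }

-- What the binders of a context give to an expression that does not mention them
-- can be given to its neighbour instead.
split-extend-off : ∀ (B : Vec (Maybe Type) k) {Ξ : Ctx n} {Γ Δ} → Split (extend B Ξ) Γ Δ → Off (wkUnder k) Δ →
                   Γ ⊑ extend B (Γ ∘ wkUnder k) × Split Ξ (Γ ∘ wkUnder k) (Δ ∘ wkUnder k)
split-extend-off {k = k} B {Ξ} {Γ} {Δ} s off =
  mk go , mk λ x → subst (λ θ → Part θ _ _) (extend-wkUnder B Ξ x) (part s (wkUnder k x))
  where
  go : ∀ y → Γ y ⊑₁ extend B (Γ ∘ wkUnder k) y
  go y with underView k y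
  ... | outer x = ⊑₁-reflexive (≡-sym (extend-wkUnder B _ x))
  ... | inner i = subst (Γ (bound k i) ⊑₁_)
    (≡-trans (extend-bound B Ξ i) (≡-sym (extend-bound B _ i)))
    (part-unrˡ (part-swap (part s (bound k i))) (off _ λ x e → bound≢wkUnder k i x (≡-sym e)))

-- Terms

infix 3 _∣_⊩_∶_

variable
  M N : Term n

data _∣_⊩_∶_ {n} (V : Vars n) (Γ : Ctx n) : Term n → Type → Set where
  T-Var    : ∀ {x T} → Γ x ≡ just T → (∀ y → y ≢ x → Unr (Γ y)) → V ∣ Γ ⊩ var x ∶ T
  T-EndR   : ∀ {x} → V x ≡ true → (∀ y → Unr (Γ y)) → V ∣ Γ ⊩ var x ∶ sess end
  T-Abs    : ∀ {M T U} → false ◃ V ∣ just T ◃ Γ ⊩ M ∶ U → V ∣ Γ ⊩ ƛ M ∶ T ⊸ U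
  T-App    : ∀ {Γ₁ Γ₂ M N T U} → Split Γ Γ₁ Γ₂ →
             V ∣ Γ₁ ⊩ M ∶ T ⊸ U → V ∣ Γ₂ ⊩ N ∶ T → V ∣ Γ ⊩ M · N ∶ U
  T-Unit   : (∀ y → Unr (Γ y)) → V ∣ Γ ⊩ unit ∶ 𝟙
  T-Pair   : ∀ {Γ₁ Γ₂ M N T U} → Split Γ Γ₁ Γ₂ →
             V ∣ Γ₁ ⊩ M ∶ T → V ∣ Γ₂ ⊩ N ∶ U → V ∣ Γ ⊩ pair M N ∶ T ⊗ U
  T-Split  : ∀ {Γ₁ Γ₂ M N T T′ U} → Split Γ Γ₁ Γ₂ →
             V ∣ Γ₁ ⊩ M ∶ T ⊗ T′ → false ◃ false ◃ V ∣ just T ◃ just T′ ◃ Γ₂ ⊩ N ∶ U →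
             V ∣ Γ ⊩ split M N ∶ U
  T-New    : ∀ {S} → (∀ y → Unr (Γ y)) → V ∣ Γ ⊩ new ∶ sess S ⊗ sess (dual S)
  T-Spawn  : ∀ {M T} → V ∣ Γ ⊩ M ∶ 𝟙 ⊗ T → V ∣ Γ ⊩ spawn M ∶ T
  T-Send   : ∀ {M T S} → V ∣ Γ ⊩ M ∶ T ⊗ sess (! T ∙ S) → V ∣ Γ ⊩ send M ∶ sess S
  T-Recv   : ∀ {M T S} → V ∣ Γ ⊩ M ∶ sess (¿ T ∙ S) → V ∣ Γ ⊩ recv M ∶ T ⊗ sess S
  T-Select : ∀ {M j Ss Sⱼ} → V ∣ Γ ⊩ M ∶ sess (⊕ Ss) → j ↦ Sⱼ ∈ᶠ Ss →
             V ∣ Γ ⊩ select j M ∶ sess Sⱼ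
  T-Case   : ∀ {Γ₁ Γ₂ M Ns Ss U} → Split Γ Γ₁ Γ₂ → V ∣ Γ₁ ⊩ M ∶ sess (& Ss) →
             Pointwise (λ N S → V ∣ Γ₂ ⊩ N ∶ sess S ⊸ U) Ns Ss →
             V ∣ Γ ⊩ case M Ns ∶ U
  T-Sub    : ∀ {Γ₁ Γ₂ M N T U} → Split Γ Γ₁ Γ₂ →
             false ◃ V ∣ just T ◃ Γ₁ ⊩ M ∶ U → V ∣ Γ₂ ⊩ N ∶ T →
             V ∣ Γ ⊩ M ⟪ N ⟫ ∶ U
  T-Send′  : ∀ {Γ₁ Γ₂ M N T S} → Split Γ Γ₁ Γ₂ →
             V ∣ Γ₁ ⊩ M ∶ T → V ∣ Γ₂ ⊩ N ∶ sess (! T ∙ S) →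
             V ∣ Γ ⊩ send′ M N ∶ sess S

Branches : Vars n → Ctx n → Type → ∀ {j} → Family (Term n) j → Family Session j → Set
Branches V Γ U = Pointwise (λ N S → V ∣ Γ ⊩ N ∶ sess S ⊸ U)

⊑-unr : Γ ⊑ Γ′ → (∀ y → Unr (Γ y)) → ∀ y → Unr (Γ′ y)
⊑-unr p u y = ⊑₁-trans (u y) (at p y)

mutual
  weaken : Γ ⊑ Γ′ → V ∣ Γ ⊩ M ∶ T → V ∣ Γ′ ⊩ M ∶ T
  weaken {Γ′ = Γ′} p (T-Var {x} eq u) =
    T-Var (⊑₁-just (subst (_⊑₁ Γ′ x) eq (at p x))) (λ y y≢x → ⊑₁-trans (u y y≢x) (at p y))
    where
    ⊑₁-just : just T ⊑₁ a → a ≡ just T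
    ⊑₁-just same = refl
  weaken p (T-EndR v u) = T-EndR v (⊑-unr p u)
  weaken p (T-Abs d) = T-Abs (weaken (⊑-cons p) d)
  weaken p (T-App s d e) with _ , q , s′ ← split-weakenˡ s p = T-App s′ (weaken q d) e
  weaken p (T-Unit u) = T-Unit (⊑-unr p u)
  weaken p (T-Pair s d e) with _ , q , s′ ← split-weakenˡ s p = T-Pair s′ (weaken q d) e
  weaken p (T-Split s d e) with _ , q , s′ ← split-weakenˡ s p = T-Split s′ (weaken q d) e
  weaken p (T-New u) = T-New (⊑-unr p u)
  weaken p (T-Spawn d) = T-Spawn (weaken p d)
  weaken p (T-Send d) = T-Send (weaken p d)
  weaken p (T-Recv d) = T-Recv (weaken p d)
  weaken p (T-Select d j) = T-Select (weaken p d) j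
  weaken p (T-Case s d e) with _ , q , s′ ← split-weakenˡ s p = T-Case s′ (weaken q d) e
  weaken p (T-Sub s d e) with _ , q , s′ ← split-weakenʳ s p = T-Sub s′ d (weaken q e)
  weaken p (T-Send′ s d e) with _ , q , s′ ← split-weakenˡ s p = T-Send′ s′ (weaken q d) e

resp : (∀ x → Γ x ≡ Γ′ x) → V ∣ Γ ⊩ M ∶ T → V ∣ Γ′ ⊩ M ∶ T
resp eq = weaken (⊑-reflexive eq)

ren-var : ∀ {x} → Renaming ρ V V′ Γ Γ′ → Γ x ≡ just T → (∀ y → y ≢ x → Unr (Γ y)) →
          V′ ∣ Γ′ ⊩ var (ρ x) ∶ T
ren-var {x = x} r eq u with fwd r x eq
... | inj₁ (o , eq′) = T-Var eq′ unr
  where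
  unr : ∀ y → _ → _
  unr y y≢ with bwd r y
  ... | inj₁ p = p
  ... | inj₂ (z , _ , refl , e) = subst Unr e (u z λ { refl → y≢ refl })
... | inj₂ (refl , v) = T-EndR v (renaming-unr r unr)
  where
  unr : ∀ y → _
  unr y with y ≟ x
  ... | yes refl = subst Unr (≡-sym eq) drop
  ... | no y≢x   = u y y≢x

mutual
  ren⁺ : Renaming ρ V V′ Γ Γ′ → V ∣ Γ ⊩ M ∶ T → V′ ∣ Γ′ ⊩ ren ρ M ∶ T
  ren⁺ r (T-Var eq u) = ren-var r eq u
  ren⁺ r (T-EndR v u) = T-EndR (free r _ v) (renaming-unr r u)
  ren⁺ r (T-Abs d) = T-Abs (ren⁺ (renaming-lift₁ r) d)
  ren⁺ r (T-App s d e) with _ , _ , s′ , r₁ , r₂ ← renaming-split r s =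
    T-App s′ (ren⁺ r₁ d) (ren⁺ r₂ e)
  ren⁺ r (T-Unit u) = T-Unit (renaming-unr r u)
  ren⁺ r (T-Pair s d e) with _ , _ , s′ , r₁ , r₂ ← renaming-split r s =
    T-Pair s′ (ren⁺ r₁ d) (ren⁺ r₂ e)
  ren⁺ r (T-Split s d e) with _ , _ , s′ , r₁ , r₂ ← renaming-split r s =
    T-Split s′ (ren⁺ r₁ d) (ren⁺ (renaming-lift₂ r₂) e)
  ren⁺ r (T-New u) = T-New (renaming-unr r u)
  ren⁺ r (T-Spawn d) = T-Spawn (ren⁺ r d)
  ren⁺ r (T-Send d) = T-Send (ren⁺ r d)
  ren⁺ r (T-Recv d) = T-Recv (ren⁺ r d)
  ren⁺ r (T-Select d j) = T-Select (ren⁺ r d) j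
  ren⁺ r (T-Case s d e) with _ , _ , s′ , r₁ , r₂ ← renaming-split r s =
    T-Case s′ (ren⁺ r₁ d) (rens⁺ r₂ e)
  ren⁺ r (T-Sub s d e) with _ , _ , s′ , r₁ , r₂ ← renaming-split r s =
    T-Sub s′ (ren⁺ (renaming-lift₁ r₁) d) (ren⁺ r₂ e)
  ren⁺ r (T-Send′ s d e) with _ , _ , s′ , r₁ , r₂ ← renaming-split r s =
    T-Send′ s′ (ren⁺ r₁ d) (ren⁺ r₂ e)

  rens⁺ : ∀ {j} {Ns : Family (Term _) j} {Ss} → Renaming ρ V V′ Γ Γ′ →
          Branches V Γ U Ns Ss → Branches V′ Γ′ U (rens ρ Ns) Ss
  rens⁺ r (last d)    = last (ren⁺ r d)
  rens⁺ r (cons d ds) = cons (ren⁺ r d) (rens⁺ r ds)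

mutual
  ren⁻ : (M : Term m) → Pullback ρ V V′ Γ Γ′ → V′ ∣ Γ′ ⊩ ren ρ M ∶ T → V ∣ Γ ⊩ M ∶ T × Off ρ Γ′
  ren⁻ (var x) r (T-Var eq u) =
    T-Var (≡-trans (≡-sym (env r x)) eq) (λ y y≢x → subst Unr (env r y) (u _ λ e → y≢x (inj r e))) ,
    (λ y y∉ → u y λ { refl → y∉ x refl })
  ren⁻ (var x) r (T-EndR v u) = T-EndR (free r x v) (λ y → subst Unr (env r y) (u _)) , (λ y _ → u y)
  ren⁻ unit r (T-Unit u) = T-Unit (λ y → subst Unr (env r y) (u _)) , (λ y _ → u y)
  ren⁻ (ƛ M) r (T-Abs d) with d′ , o ← ren⁻ M (pullback-lift₁ r) d = T-Abs d′ , off-lift 0 o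
  ren⁻ (M · N) r (T-App s d e) with d′ , o ← ren⁻ M (pullback-of r) d | e′ , o′ ← ren⁻ N (pullback-of r) e =
    T-App (pullback-split r s) d′ e′ , off-split s o o′
  ren⁻ (pair M N) r (T-Pair s d e) with d′ , o ← ren⁻ M (pullback-of r) d | e′ , o′ ← ren⁻ N (pullback-of r) e =
    T-Pair (pullback-split r s) d′ e′ , off-split s o o′
  ren⁻ (split M N) r (T-Split s d e)
    with d′ , o ← ren⁻ M (pullback-of r) d | e′ , o′ ← ren⁻ N (pullback-lift₂ (pullback-of r)) e =
    T-Split (pullback-split r s) d′ e′ , off-split s o (off-lift 0 (off-lift 1 o′))
  ren⁻ new r (T-New u) = T-New (λ y → subst Unr (env r y) (u _)) , (λ y _ → u y)
  ren⁻ (spawn M) r (T-Spawn d) with d′ , o ← ren⁻ M r d = T-Spawn d′ , o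
  ren⁻ (send M) r (T-Send d) with d′ , o ← ren⁻ M r d = T-Send d′ , o
  ren⁻ (recv M) r (T-Recv d) with d′ , o ← ren⁻ M r d = T-Recv d′ , o
  ren⁻ (select ℓ M) r (T-Select d j) with d′ , o ← ren⁻ M r d = T-Select d′ j , o
  ren⁻ (case M Ns) r (T-Case s d e)
    with d′ , o ← ren⁻ M (pullback-of r) d | e′ , o′ ← rens⁻ Ns (pullback-of r) e =
    T-Case (pullback-split r s) d′ e′ , off-split s o o′
  ren⁻ (M ⟪ N ⟫) r (T-Sub s d e)
    with d′ , o ← ren⁻ M (pullback-lift₁ (pullback-of r)) d | e′ , o′ ← ren⁻ N (pullback-of r) e =
    T-Sub (pullback-split r s) d′ e′ , off-split s (off-lift 0 o) o′
  ren⁻ (send′ M N) r (T-Send′ s d e) with d′ , o ← ren⁻ M (pullback-of r) d | e′ , o′ ← ren⁻ N (pullback-of r) e =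
    T-Send′ (pullback-split r s) d′ e′ , off-split s o o′

  rens⁻ : ∀ {j} (Ns : Family (Term m) j) {Ss} → Pullback ρ V V′ Γ Γ′ →
          Branches V′ Γ′ U (rens ρ Ns) Ss → Branches V Γ U Ns Ss × Off ρ Γ′
  rens⁻ (last i p N) r (last d) with d′ , o ← ren⁻ N r d = last d′ , o
  rens⁻ (cons i p N Ns) r (cons d ds) with d′ , o ← ren⁻ N r d | ds′ , _ ← rens⁻ Ns r ds = cons d′ ds′ , o

-- Reduction contexts

infix 3 _∣_⊩ᴿ_∶_⟸_∶_

-- In V ∣ Γ ⊩ᴿ R ∶ T ⟸ B ∶ U, the environment Γ is what R uses by itself, and B is
-- what it gives to its hole of type U of the variables that it binds there.
data _∣_⊩ᴿ_∶_⟸_∶_ {n} (V : Vars n) (Γ : Ctx n) :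
     ∀ {k} → RCtx k n → Type → Vec (Maybe Type) k → Type → Set where
  □       : ∀ {U} → (∀ y → Unr (Γ y)) → V ∣ Γ ⊩ᴿ □ ∶ U ⟸ [] ∶ U
  app□    : ∀ {k Γ₁ Γ₂ N T T′ U} {R : RCtx k n} {B} → Split Γ Γ₁ Γ₂ →
            V ∣ Γ₁ ⊩ᴿ R ∶ T′ ⊸ T ⟸ B ∶ U → V ∣ Γ₂ ⊩ N ∶ T′ → V ∣ Γ ⊩ᴿ R ·□ N ∶ T ⟸ B ∶ U
  spawn□  : ∀ {k T U} {R : RCtx k n} {B} →
            V ∣ Γ ⊩ᴿ R ∶ 𝟙 ⊗ T ⟸ B ∶ U → V ∣ Γ ⊩ᴿ spawn□ R ∶ T ⟸ B ∶ U
  send□   : ∀ {k T S U} {R : RCtx k n} {B} →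
            V ∣ Γ ⊩ᴿ R ∶ T ⊗ sess (! T ∙ S) ⟸ B ∶ U → V ∣ Γ ⊩ᴿ send□ R ∶ sess S ⟸ B ∶ U
  recv□   : ∀ {k T S U} {R : RCtx k n} {B} →
            V ∣ Γ ⊩ᴿ R ∶ sess (¿ T ∙ S) ⟸ B ∶ U → V ∣ Γ ⊩ᴿ recv□ R ∶ T ⊗ sess S ⟸ B ∶ U
  split□  : ∀ {k Γ₁ Γ₂ N T T₁ T₂ U} {R : RCtx k n} {B} → Split Γ Γ₁ Γ₂ →
            V ∣ Γ₁ ⊩ᴿ R ∶ T₁ ⊗ T₂ ⟸ B ∶ U →
            false ◃ false ◃ V ∣ just T₁ ◃ just T₂ ◃ Γ₂ ⊩ N ∶ T → V ∣ Γ ⊩ᴿ split□ R N ∶ T ⟸ B ∶ U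
  select□ : ∀ {k j Ss Sⱼ U} {R : RCtx k n} {B} →
            V ∣ Γ ⊩ᴿ R ∶ sess (⊕ Ss) ⟸ B ∶ U → j ↦ Sⱼ ∈ᶠ Ss → V ∣ Γ ⊩ᴿ select□ j R ∶ sess Sⱼ ⟸ B ∶ U
  case□   : ∀ {k Γ₁ Γ₂ Ns Ss T U} {R : RCtx k n} {B} → Split Γ Γ₁ Γ₂ →
            V ∣ Γ₁ ⊩ᴿ R ∶ sess (& Ss) ⟸ B ∶ U → Branches V Γ₂ T Ns Ss →
            V ∣ Γ ⊩ᴿ case□ R Ns ∶ T ⟸ B ∶ U
  subˡ□   : ∀ {k Γ₁ Γ₂ N T T′ U b} {R : RCtx k (suc n)} {B} → Split Γ (Γ₁ ∘ suc) Γ₂ →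
            Part (just T′) (Γ₁ zero) b → false ◃ V ∣ Γ₁ ⊩ᴿ R ∶ T ⟸ B ∶ U → V ∣ Γ₂ ⊩ N ∶ T′ →
            V ∣ Γ ⊩ᴿ R ⟪ N ⟫ˡ ∶ T ⟸ b ∷ B ∶ U
  subʳ□   : ∀ {k Γ₁ Γ₂ M T T′ U} {R : RCtx k n} {B} → Split Γ Γ₁ Γ₂ →
            false ◃ V ∣ just T′ ◃ Γ₁ ⊩ M ∶ T → V ∣ Γ₂ ⊩ᴿ R ∶ T′ ⟸ B ∶ U →
            V ∣ Γ ⊩ᴿ M ⟪ R ⟫ʳ ∶ T ⟸ B ∶ U
  send′□  : ∀ {k Γ₁ Γ₂ M T S U} {R : RCtx k n} {B} → Split Γ Γ₁ Γ₂ →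
            V ∣ Γ₁ ⊩ M ∶ T → V ∣ Γ₂ ⊩ᴿ R ∶ sess (! T ∙ S) ⟸ B ∶ U →
            V ∣ Γ ⊩ᴿ send′□ M R ∶ sess S ⟸ B ∶ U

variable
  B : Vec (Maybe Type) k

plugᴿ : ∀ {k n} {V : Vars n} {Θ Γ Ξ : Ctx n} {R : RCtx k n} {B L} → V ∣ Γ ⊩ᴿ R ∶ T ⟸ B ∶ U → Split Θ Γ Ξ →
        extend (falses k) V ∣ extend B Ξ ⊩ L ∶ U → V ∣ Θ ⊩ R [ L ]ᴿ ∶ T
plugᴿ (□ u) s l = weaken (split-unrˡ s u) l
plugᴿ (app□ t r e) s l with _ , s′ , t′ ← split-exchange s t = T-App s′ (plugᴿ r t′ l) e
plugᴿ (spawn□ r) s l = T-Spawn (plugᴿ r s l)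
plugᴿ (send□ r) s l = T-Send (plugᴿ r s l)
plugᴿ (recv□ r) s l = T-Recv (plugᴿ r s l)
plugᴿ (split□ t r e) s l with _ , s′ , t′ ← split-exchange s t = T-Split s′ (plugᴿ r t′ l) e
plugᴿ (select□ r j) s l = T-Select (plugᴿ r s l) j
plugᴿ (case□ t r e) s l with _ , s′ , t′ ← split-exchange s t = T-Case s′ (plugᴿ r t′ l) e
plugᴿ (subˡ□ t p r e) s l with _ , s′ , t′ ← split-exchange s t =
  T-Sub s′ (plugᴿ r (split-uncons p t′) l) e
plugᴿ (subʳ□ t d r) s l with _ , s′ , t′ ← split-assocʳ s t = T-Sub s′ d (plugᴿ r t′ l)
plugᴿ (send′□ t d r) s l with _ , s′ , t′ ← split-assocʳ s t = T-Send′ s′ d (plugᴿ r t′ l)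

record Plugᴿ {k n} (V : Vars n) (Θ : Ctx n) (R : RCtx k n) (L : Term (under k n)) (T : Type) : Set where
  constructor plugged
  field
    {Γᶠ Γʰ} : Ctx n
    {Bʰ}    : Vec (Maybe Type) k
    {Uʰ}    : Type
    parts   : Split Θ Γᶠ Γʰ
    context : V ∣ Γᶠ ⊩ᴿ R ∶ T ⟸ Bʰ ∶ Uʰ
    hole    : extend (falses k) V ∣ extend Bʰ Γʰ ⊩ L ∶ Uʰ

unplugᴿ : ∀ {k n} {V : Vars n} {Θ} (R : RCtx k n) {L T} → V ∣ Θ ⊩ R [ L ]ᴿ ∶ T → Plugᴿ V Θ R L T
unplugᴿ □ d = plugged (mk λ _ → part-right) (□ λ _ → same) d
unplugᴿ (R ·□ N) (T-App s d e) with plugged t r l ← unplugᴿ R d with _ , s′ , t′ ← split-exchange s t =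
  plugged s′ (app□ t′ r e) l
unplugᴿ (spawn□ R) (T-Spawn d) with plugged t r l ← unplugᴿ R d = plugged t (spawn□ r) l
unplugᴿ (send□ R) (T-Send d) with plugged t r l ← unplugᴿ R d = plugged t (send□ r) l
unplugᴿ (recv□ R) (T-Recv d) with plugged t r l ← unplugᴿ R d = plugged t (recv□ r) l
unplugᴿ (split□ R N) (T-Split s d e) with plugged t r l ← unplugᴿ R d with _ , s′ , t′ ← split-exchange s t =
  plugged s′ (split□ t′ r e) l
unplugᴿ (select□ ℓ R) (T-Select d j) with plugged t r l ← unplugᴿ R d = plugged t (select□ r j) l
unplugᴿ (case□ R Ns) (T-Case s d e) with plugged t r l ← unplugᴿ R d with _ , s′ , t′ ← split-exchange s t =
  plugged s′ (case□ t′ r e) l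
unplugᴿ (R ⟪ N ⟫ˡ) (T-Sub s d e)
  with plugged {Bʰ = B} t r l ← unplugᴿ R d with _ , s′ , t′ ← split-exchange s (split-∘ suc t) =
  plugged s′ (subˡ□ t′ (part t zero) r e) (weaken (extend-⊑ B (⊑-reflexive ◃-η)) l)
unplugᴿ (M ⟪ R ⟫ʳ) (T-Sub s d e) with plugged t r l ← unplugᴿ R e with _ , s′ , t′ ← split-assocˡ s t =
  plugged s′ (subʳ□ t′ d r) l
unplugᴿ (send′□ M R) (T-Send′ s d e) with plugged t r l ← unplugᴿ R e with _ , s′ , t′ ← split-assocˡ s t =
  plugged s′ (send′□ t′ d r) l

renᴿ⁺ : ∀ {k m n} {ρ : Fin m → Fin n} {V : Vars m} {V′ Γ Γ′} {R : RCtx k m} {B} →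
        Renaming ρ V V′ Γ Γ′ → V ∣ Γ ⊩ᴿ R ∶ T ⟸ B ∶ U → V′ ∣ Γ′ ⊩ᴿ renᴿ ρ R ∶ T ⟸ B ∶ U
renᴿ⁺ r (□ u) = □ (renaming-unr r u)
renᴿ⁺ r (app□ s c e) with _ , _ , s′ , r₁ , r₂ ← renaming-split r s =
  app□ s′ (renᴿ⁺ r₁ c) (ren⁺ r₂ e)
renᴿ⁺ r (spawn□ c) = spawn□ (renᴿ⁺ r c)
renᴿ⁺ r (send□ c) = send□ (renᴿ⁺ r c)
renᴿ⁺ r (recv□ c) = recv□ (renᴿ⁺ r c)
renᴿ⁺ r (split□ s c e) with _ , _ , s′ , r₁ , r₂ ← renaming-split r s =
  split□ s′ (renᴿ⁺ r₁ c) (ren⁺ (renaming-lift₂ r₂) e)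
renᴿ⁺ r (select□ c j) = select□ (renᴿ⁺ r c) j
renᴿ⁺ r (case□ s c e) with _ , _ , s′ , r₁ , r₂ ← renaming-split r s =
  case□ s′ (renᴿ⁺ r₁ c) (rens⁺ r₂ e)
renᴿ⁺ r (subˡ□ {Γ₁ = Γ₁} s p c e) with Γ₁′ , _ , s′ , r₁ , r₂ ← renaming-split r s =
  subˡ□ {Γ₁ = Γ₁ zero ◃ Γ₁′} s′ p (renᴿ⁺ (renaming-lift 0 refl r₁) c) (ren⁺ r₂ e)
renᴿ⁺ r (subʳ□ s d c) with _ , _ , s′ , r₁ , r₂ ← renaming-split r s =
  subʳ□ s′ (ren⁺ (renaming-lift₁ r₁) d) (renᴿ⁺ r₂ c)
renᴿ⁺ r (send′□ s d c) with _ , _ , s′ , r₁ , r₂ ← renaming-split r s =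
  send′□ s′ (ren⁺ r₁ d) (renᴿ⁺ r₂ c)

renᴿ⁻ : ∀ {k m n} {ρ : Fin m → Fin n} {V : Vars m} {V′ Γ Γ′} (R : RCtx k m) {B} →
        Pullback ρ V V′ Γ Γ′ → V′ ∣ Γ′ ⊩ᴿ renᴿ ρ R ∶ T ⟸ B ∶ U →
        V ∣ Γ ⊩ᴿ R ∶ T ⟸ B ∶ U × Off ρ Γ′
renᴿ⁻ □ r (□ u) = □ (λ y → subst Unr (env r y) (u _)) , λ y _ → u y
renᴿ⁻ (R ·□ N) r (app□ s c e) with c′ , o ← renᴿ⁻ R (pullback-of r) c | e′ , o′ ← ren⁻ N (pullback-of r) e =
  app□ (pullback-split r s) c′ e′ , off-split s o o′
renᴿ⁻ (spawn□ R) r (spawn□ c) with c′ , o ← renᴿ⁻ R r c = spawn□ c′ , o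
renᴿ⁻ (send□ R) r (send□ c) with c′ , o ← renᴿ⁻ R r c = send□ c′ , o
renᴿ⁻ (recv□ R) r (recv□ c) with c′ , o ← renᴿ⁻ R r c = recv□ c′ , o
renᴿ⁻ (split□ R N) r (split□ s c e)
  with c′ , o ← renᴿ⁻ R (pullback-of r) c | e′ , o′ ← ren⁻ N (pullback-lift₂ (pullback-of r)) e =
  split□ (pullback-split r s) c′ e′ , off-split s o (off-lift 0 (off-lift 1 o′))
renᴿ⁻ (select□ ℓ R) r (select□ c j) with c′ , o ← renᴿ⁻ R r c = select□ c′ j , o
renᴿ⁻ (case□ R Ns) r (case□ s c e)
  with c′ , o ← renᴿ⁻ R (pullback-of r) c | e′ , o′ ← rens⁻ Ns (pullback-of r) e =
  case□ (pullback-split r s) c′ e′ , off-split s o o′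
renᴿ⁻ (R ⟪ N ⟫ˡ) r (subˡ□ s p c e)
  with c′ , o ← renᴿ⁻ R (pullback-of (pullback-lift₁ {b = nothing} r)) c | e′ , o′ ← ren⁻ N (pullback-of r) e =
  subˡ□ (pullback-split r s) p c′ e′ , off-split s (off-lift 0 o) o′
renᴿ⁻ (M ⟪ R ⟫ʳ) r (subʳ□ s d c)
  with d′ , o ← ren⁻ M (pullback-lift₁ (pullback-of r)) d | c′ , o′ ← renᴿ⁻ R (pullback-of r) c =
  subʳ□ (pullback-split r s) d′ c′ , off-split s (off-lift 0 o) o′
renᴿ⁻ (send′□ M R) r (send′□ s d c)
  with d′ , o ← ren⁻ M (pullback-of r) d | c′ , o′ ← renᴿ⁻ R (pullback-of r) c =
  send′□ (pullback-split r s) d′ c′ , off-split s o o′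

-- Subject congruence and subject reduction for terms

⊑-head : a ⊑₁ b → {Γ : Ctx (suc n)} → Γ zero ≡ a → Γ ⊑ (b ◃ Γ ∘ suc)
⊑-head p refl = mk λ { zero → p ; (suc x) → same }

off-suc : {Γ : Ctx (suc n)} → Off suc Γ → Unr (Γ zero)
off-suc o = o zero λ _ ()

SubExt⁺ : ∀ {k n} {V : Vars n} {Γ} (R : RCtx k n) M N →
          V ∣ Γ ⊩ (renᴿ suc R [ ren (sink k) M ]ᴿ) ⟪ N ⟫ ∶ T →
          V ∣ Γ ⊩ R [ M ⟪ ren (wkUnder k) N ⟫ ]ᴿ ∶ T
SubExt⁺ {k = k} R M N (T-Sub s d e)
  with plugged {Bʰ = B} t c l ← unplugᴿ (renᴿ suc R) d
  with c′ , o ← renᴿ⁻ R pullback-suc c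
  with _ , s′ , t′ ← split-assocʳ s (split-∘ suc t)
  with l′ , _ ← ren⁻ M (pullback-sink k {B = B})
                  (weaken (extend-⊑ B (⊑-head (part-unrˡ (part t zero) (off-suc o)) refl)) l) =
  plugᴿ c′ s′ (T-Sub (split-extendʳ B t′) l′ (ren⁺ (renaming-wkUnder k) e))

SubExt⁻ : ∀ {k n} {V : Vars n} {Γ} (R : RCtx k n) M N →
          V ∣ Γ ⊩ R [ M ⟪ ren (wkUnder k) N ⟫ ]ᴿ ∶ T →
          V ∣ Γ ⊩ (renᴿ suc R [ ren (sink k) M ]ᴿ) ⟪ N ⟫ ∶ T
SubExt⁻ {k = k} R M N d
  with plugged {Bʰ = B} t c (T-Sub s l e) ← unplugᴿ R d
  with e′ , o ← ren⁻ N (pullback-wkUnder k) e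
  with p , s′ ← split-extend-off B s o
  with _ , t′ , u ← split-assocˡ t s′ =
  T-Sub t′ (plugᴿ (renᴿ⁺ renaming-suc c) (split-cons right u)
             (ren⁺ (renaming-sink k {B = B}) (weaken (⊑-cons p) l))) e′

mutual
  ≡ᴹ⁺ : M ≡ᴹ N → V ∣ Γ ⊩ M ∶ T → V ∣ Γ ⊩ N ∶ T
  ≡ᴹ⁺ (SC-SubExt R M N) d = SubExt⁺ R M N d
  ≡ᴹ⁺ refl d = d
  ≡ᴹ⁺ (sym p) d = ≡ᴹ⁻ p d
  ≡ᴹ⁺ (trans p q) d = ≡ᴹ⁺ q (≡ᴹ⁺ p d)
  ≡ᴹ⁺ (ƛ p) (T-Abs d) = T-Abs (≡ᴹ⁺ p d)
  ≡ᴹ⁺ (p · q) (T-App s d e) = T-App s (≡ᴹ⁺ p d) (≡ᴹ⁺ q e)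
  ≡ᴹ⁺ (pair p q) (T-Pair s d e) = T-Pair s (≡ᴹ⁺ p d) (≡ᴹ⁺ q e)
  ≡ᴹ⁺ (split p q) (T-Split s d e) = T-Split s (≡ᴹ⁺ p d) (≡ᴹ⁺ q e)
  ≡ᴹ⁺ (spawn p) (T-Spawn d) = T-Spawn (≡ᴹ⁺ p d)
  ≡ᴹ⁺ (send p) (T-Send d) = T-Send (≡ᴹ⁺ p d)
  ≡ᴹ⁺ (recv p) (T-Recv d) = T-Recv (≡ᴹ⁺ p d)
  ≡ᴹ⁺ (select p) (T-Select d j) = T-Select (≡ᴹ⁺ p d) j
  ≡ᴹ⁺ (case p ps) (T-Case s d e) = T-Case s (≡ᴹ⁺ p d) (≡ᴹs⁺ ps e)
  ≡ᴹ⁺ (p ⟪ q ⟫) (T-Sub s d e) = T-Sub s (≡ᴹ⁺ p d) (≡ᴹ⁺ q e)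
  ≡ᴹ⁺ (send′ p q) (T-Send′ s d e) = T-Send′ s (≡ᴹ⁺ p d) (≡ᴹ⁺ q e)

  ≡ᴹs⁺ : ∀ {j} {Ms Ns : Family (Term n) j} {Ss} → Pointwise _≡ᴹ_ Ms Ns →
         Branches V Γ U Ms Ss → Branches V Γ U Ns Ss
  ≡ᴹs⁺ (last p) (last d)       = last (≡ᴹ⁺ p d)
  ≡ᴹs⁺ (cons p ps) (cons d ds) = cons (≡ᴹ⁺ p d) (≡ᴹs⁺ ps ds)

  ≡ᴹ⁻ : M ≡ᴹ N → V ∣ Γ ⊩ N ∶ T → V ∣ Γ ⊩ M ∶ T
  ≡ᴹ⁻ (SC-SubExt R M N) d = SubExt⁻ R M N d
  ≡ᴹ⁻ refl d = d
  ≡ᴹ⁻ (sym p) d = ≡ᴹ⁺ p d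
  ≡ᴹ⁻ (trans p q) d = ≡ᴹ⁻ p (≡ᴹ⁻ q d)
  ≡ᴹ⁻ (ƛ p) (T-Abs d) = T-Abs (≡ᴹ⁻ p d)
  ≡ᴹ⁻ (p · q) (T-App s d e) = T-App s (≡ᴹ⁻ p d) (≡ᴹ⁻ q e)
  ≡ᴹ⁻ (pair p q) (T-Pair s d e) = T-Pair s (≡ᴹ⁻ p d) (≡ᴹ⁻ q e)
  ≡ᴹ⁻ (split p q) (T-Split s d e) = T-Split s (≡ᴹ⁻ p d) (≡ᴹ⁻ q e)
  ≡ᴹ⁻ (spawn p) (T-Spawn d) = T-Spawn (≡ᴹ⁻ p d)
  ≡ᴹ⁻ (send p) (T-Send d) = T-Send (≡ᴹ⁻ p d)
  ≡ᴹ⁻ (recv p) (T-Recv d) = T-Recv (≡ᴹ⁻ p d)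
  ≡ᴹ⁻ (select p) (T-Select d j) = T-Select (≡ᴹ⁻ p d) j
  ≡ᴹ⁻ (case p ps) (T-Case s d e) = T-Case s (≡ᴹ⁻ p d) (≡ᴹs⁻ ps e)
  ≡ᴹ⁻ (p ⟪ q ⟫) (T-Sub s d e) = T-Sub s (≡ᴹ⁻ p d) (≡ᴹ⁻ q e)
  ≡ᴹ⁻ (send′ p q) (T-Send′ s d e) = T-Send′ s (≡ᴹ⁻ p d) (≡ᴹ⁻ q e)

  ≡ᴹs⁻ : ∀ {j} {Ms Ns : Family (Term n) j} {Ss} → Pointwise _≡ᴹ_ Ms Ns →
         Branches V Γ U Ns Ss → Branches V Γ U Ms Ss
  ≡ᴹs⁻ (last p) (last d)       = last (≡ᴹ⁻ p d)
  ≡ᴹs⁻ (cons p ps) (cons d ds) = cons (≡ᴹ⁻ p d) (≡ᴹs⁻ ps ds)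

swap-involutive : ∀ (x : Fin (suc (suc n))) → swap (swap x) ≡ x
swap-involutive 0F            = refl
swap-involutive 1F            = refl
swap-involutive (suc (suc x)) = refl

renaming-swap : ∀ {V : Vars n} {Γ} →
                Renaming swap (false ◃ false ◃ V) (false ◃ false ◃ V) (Γ ∘ swap) Γ
renaming-swap = bijective-renaming swap-involutive λ { (suc (suc x)) v → v }

renaming-0↦-linear : ∀ {y} → Split Θ Γ Δ → Δ y ≡ just T → (∀ z → z ≢ y → Unr (Δ z)) →
                     Renaming (0↦ y) (false ◃ V) V (just T ◃ Γ) Θ
renaming-0↦-linear {Θ = Θ} {Γ} {Δ} {T} {V} {y} s eq u = record
  { free = λ { (suc x) v → v } ; own = owner ; fwd = fwd′ ; bwd = bwd′ }
  where
  owner : Fin _ → Maybe (Fin _)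
  owner z with z ≟ y
  ... | yes _ = just zero
  ... | no  _ = just (suc z)
  fwd′ : ∀ {T′} x → (just T ◃ Γ) x ≡ just T′ →
         owner (0↦ y x) ≡ just x × Θ (0↦ y x) ≡ just T′ ⊎ T′ ≡ sess end × V (0↦ y x) ≡ true
  fwd′ zero refl with y ≟ y
  ... | yes _  = inj₁ (refl , split-justʳ s eq)
  ... | no y≢y = contradiction refl y≢y
  fwd′ (suc x) e with x ≟ y
  ... | no _ = inj₁ (refl , split-justʳ (split-swap s) e)
  ... | yes refl with () ← ≡-trans (≡-sym e) (split-emptyˡ s eq)
  bwd′ : ∀ z → Unr (Θ z) ⊎ ∃ λ x → owner z ≡ just x × 0↦ y x ≡ z × (just T ◃ Γ) x ≡ Θ z
  bwd′ z with z ≟ y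
  ... | yes refl = inj₂ (zero , refl , refl , ≡-sym (split-justʳ s eq))
  ... | no z≢y with u z z≢y
  ...   | p = go (part s z) p
    where
    go : Part (Θ z) (Γ z) (Δ z) → Unr (Δ z) →
         Unr (Θ z) ⊎ ∃ λ x → just (suc z) ≡ just x × 0↦ y x ≡ z × (just T ◃ Γ) x ≡ Θ z
    go q p with Θ z in e₁ | Γ z in e₂ | Δ z | q
    ... | _ | _ | _ | none  = inj₁ same
    ... | _ | _ | _ | left  = inj₂ (suc z , refl , refl , e₂)
    ... | _ | _ | _ | right = inj₁ p

renaming-0↦-free : ∀ {y} → Split Θ Γ Δ → V y ≡ true → (∀ z → Unr (Δ z)) →
                   Renaming (0↦ y) (false ◃ V) V (just (sess end) ◃ Γ) Θ
renaming-0↦-free {Θ = Θ} {Γ} {Δ} {V} {y} s v u = record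
  { free = λ { (suc x) v → v } ; own = just ∘ suc ; fwd = fwd′ ; bwd = bwd′ }
  where
  fwd′ : ∀ {T′} x → (just (sess end) ◃ Γ) x ≡ just T′ →
         just (suc (0↦ y x)) ≡ just x × Θ (0↦ y x) ≡ just T′ ⊎ T′ ≡ sess end × V (0↦ y x) ≡ true
  fwd′ zero refl = inj₂ (refl , v)
  fwd′ (suc x) e = inj₁ (refl , split-justʳ (split-swap s) e)
  bwd′ : ∀ z → Unr (Θ z) ⊎ ∃ λ x → just (suc z) ≡ just x × 0↦ y x ≡ z × (just (sess end) ◃ Γ) x ≡ Θ z
  bwd′ z with Θ z | Γ z in e | Δ z | part s z | u z
  ... | _ | _ | _ | none  | _ = inj₁ same
  ... | _ | _ | _ | left  | _ = inj₂ (suc z , refl , refl , e)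
  ... | _ | _ | _ | right | p = inj₁ p

⟶ᴹ-preserves : M ⟶ᴹ N → V ∣ Γ ⊩ M ∶ T → V ∣ Γ ⊩ N ∶ T
⟶ᴹ-preserves E-Lam (T-App s (T-Abs d) e) = T-Sub s d e
⟶ᴹ-preserves E-Split₁ (T-Split s (T-Pair t d₁ d₂) e) with _ , s′ , t′ ← split-exchange s t =
  T-Sub s′ (T-Sub (split-cons left (split-swap t′)) e (ren⁺ renaming-suc d₁)) d₂
⟶ᴹ-preserves E-Split₂ (T-Split s (T-Pair t d₁ d₂) e)
  with _ , s′ , t′ ← split-exchange s (split-swap t) =
  T-Sub s′ (T-Sub (split-cons left (split-swap t′)) (ren⁺ renaming-swap (resp swapped e))
             (ren⁺ renaming-suc d₂)) d₁
  where
  swapped : ∀ x → (just T ◃ just U ◃ Γ) x ≡ (just U ◃ just T ◃ Γ) (swap x)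
  swapped 0F            = refl
  swapped 1F            = refl
  swapped (suc (suc x)) = refl
⟶ᴹ-preserves E-SubstName (T-Sub s d (T-Var eq u)) = ren⁺ (renaming-0↦-linear s eq u) d
⟶ᴹ-preserves E-SubstName (T-Sub s d (T-EndR v u)) = ren⁺ (renaming-0↦-free s v u) d
⟶ᴹ-preserves E-NameSubst (T-Sub s (T-Var refl u) d) = weaken (split-unrˡ s λ y → u (suc y) λ ()) d
⟶ᴹ-preserves E-Send (T-Send (T-Pair s d e)) = T-Send′ s d e
⟶ᴹ-preserves (E-Lift R p) d with plugged s c l ← unplugᴿ R d = plugᴿ c s (⟶ᴹ-preserves p l)
⟶ᴹ-preserves (E-LiftSC p q p′) d = ≡ᴹ⁺ p′ (⟶ᴹ-preserves q (≡ᴹ⁺ p d))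

-- Configurations

infix 3 _∣_⊩ᴮ_∶_>_ _∣_⊩ᶜ[_]_∶_

variable
  ms ns : Buffer n
  C C′ D : Conf n
  φ ψ : Marker

data _∣_⊩ᴮ_∶_>_ {n} (V : Vars n) (Γ : Ctx n) : Buffer n → Session → Session → Set where
  []    : ∀ {S} → (∀ y → Unr (Γ y)) → V ∣ Γ ⊩ᴮ [] ∶ S > S
  term  : ∀ {Γ₁ Γ₂ M ms T S′ S} → Split Γ Γ₁ Γ₂ → V ∣ Γ₁ ⊩ M ∶ T →
          V ∣ Γ₂ ⊩ᴮ ms ∶ ! T ∙ S′ > S → V ∣ Γ ⊩ᴮ term M ∷ ms ∶ S′ > S
  label : ∀ {j ms Ss Sⱼ S} → j ↦ Sⱼ ∈ᶠ Ss → V ∣ Γ ⊩ᴮ ms ∶ ⊕ Ss > S →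
          V ∣ Γ ⊩ᴮ label j ∷ ms ∶ Sⱼ > S

data Thread : Marker → Type → Set where
  main  : ∀ {T} → Thread main T
  child : Thread ◇ 𝟙

data Join : Marker → Type → Marker → Type → Marker → Type → Set where
  joinˡ : ∀ {φ T} → Join ◇ 𝟙 φ T φ T
  joinʳ : ∀ {φ T} → Join φ T ◇ 𝟙 φ T

-- The two typing rules for restriction become one, in which y : dual S is part of
-- the environment that is split between the buffer and the configuration.
data _∣_⊩ᶜ[_]_∶_ {n} (V : Vars n) (Γ : Ctx n) : Marker → Conf n → Type → Set where
  T-Thread  : ∀ {φ M T} → Thread φ T → V ∣ Γ ⊩ M ∶ T → V ∣ Γ ⊩ᶜ[ φ ] φ ▸ M ∶ T
  T-Par     : ∀ {Γ₁ Γ₂ φ₁ φ₂ φ T₁ T₂ T C D} → Split Γ Γ₁ Γ₂ → Join φ₁ T₁ φ₂ T₂ φ T →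
              V ∣ Γ₁ ⊩ᶜ[ φ₁ ] C ∶ T₁ → V ∣ Γ₂ ⊩ᶜ[ φ₂ ] D ∶ T₂ → V ∣ Γ ⊩ᶜ[ φ ] C ∥ D ∶ T
  T-Res     : ∀ {Γ₁ Γ₂ φ ms C S′ S T} → Split (just (sess (dual S)) ◃ Γ) Γ₁ Γ₂ →
              false ◃ false ◃ V ∣ nothing ◃ Γ₁ ⊩ᴮ ms ∶ S′ > S →
              false ◃ false ◃ V ∣ just (sess S′) ◃ Γ₂ ⊩ᶜ[ φ ] C ∶ T → V ∣ Γ ⊩ᶜ[ φ ] ν ms C ∶ T
  T-ConfSub : ∀ {Γ₁ Γ₂ φ C M T U} → Split Γ Γ₁ Γ₂ →
              false ◃ V ∣ just T ◃ Γ₁ ⊩ᶜ[ φ ] C ∶ U → V ∣ Γ₂ ⊩ M ∶ T →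
              V ∣ Γ ⊩ᶜ[ φ ] C ⟪ M ⟫ ∶ U

weakenᴮ : Γ ⊑ Γ′ → V ∣ Γ ⊩ᴮ ms ∶ S′ > S → V ∣ Γ′ ⊩ᴮ ms ∶ S′ > S
weakenᴮ p ([] u) = [] (⊑-unr p u)
weakenᴮ p (term s d b) with _ , q , s′ ← split-weakenˡ s p = term s′ (weaken q d) b
weakenᴮ p (label j b) = label j (weakenᴮ p b)

weakenᶜ : Γ ⊑ Γ′ → V ∣ Γ ⊩ᶜ[ φ ] C ∶ T → V ∣ Γ′ ⊩ᶜ[ φ ] C ∶ T
weakenᶜ p (T-Thread t d) = T-Thread t (weaken p d)
weakenᶜ p (T-Par s j c d) with _ , q , s′ ← split-weakenˡ s p = T-Par s′ j (weakenᶜ q c) d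
weakenᶜ p (T-Res s b c) with _ , q , s′ ← split-weakenʳ s (⊑-cons p) = T-Res s′ b (weakenᶜ (⊑-cons q) c)
weakenᶜ p (T-ConfSub s c e) with _ , q , s′ ← split-weakenʳ s p = T-ConfSub s′ c (weaken q e)

respᶜ : (∀ x → Γ x ≡ Γ′ x) → V ∣ Γ ⊩ᶜ[ φ ] C ∶ T → V ∣ Γ′ ⊩ᶜ[ φ ] C ∶ T
respᶜ eq = weakenᶜ (⊑-reflexive eq)

renᴮ⁺ : Renaming ρ V V′ Γ Γ′ → V ∣ Γ ⊩ᴮ ms ∶ S′ > S → V′ ∣ Γ′ ⊩ᴮ renᴮ ρ ms ∶ S′ > S
renᴮ⁺ r ([] u) = [] (renaming-unr r u)
renᴮ⁺ r (term s d b) with _ , _ , s′ , r₁ , r₂ ← renaming-split r s = term s′ (ren⁺ r₁ d) (renᴮ⁺ r₂ b)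
renᴮ⁺ r (label j b) = label j (renᴮ⁺ r b)

renᶜ⁺ : Renaming ρ V V′ Γ Γ′ → V ∣ Γ ⊩ᶜ[ φ ] C ∶ T → V′ ∣ Γ′ ⊩ᶜ[ φ ] renᶜ ρ C ∶ T
renᶜ⁺ r (T-Thread t d) = T-Thread t (ren⁺ r d)
renᶜ⁺ r (T-Par s j c d) with _ , _ , s′ , r₁ , r₂ ← renaming-split r s =
  T-Par s′ j (renᶜ⁺ r₁ c) (renᶜ⁺ r₂ d)
renᶜ⁺ r (T-Res s b c) with _ , _ , s′ , r₁ , r₂ ← renaming-split (renaming-lift₁ r) s =
  T-Res s′ (renᴮ⁺ (renaming-lift 1 refl r₁) b) (renᶜ⁺ (renaming-lift 1 refl r₂) c)
renᶜ⁺ r (T-ConfSub s c e) with _ , _ , s′ , r₁ , r₂ ← renaming-split r s =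
  T-ConfSub s′ (renᶜ⁺ (renaming-lift₁ r₁) c) (ren⁺ r₂ e)

renᴮ⁻ : (ms : Buffer m) → Pullback ρ V V′ Γ Γ′ → V′ ∣ Γ′ ⊩ᴮ renᴮ ρ ms ∶ S′ > S →
        V ∣ Γ ⊩ᴮ ms ∶ S′ > S × Off ρ Γ′
renᴮ⁻ [] r ([] u) = [] (λ y → subst Unr (env r y) (u _)) , λ y _ → u y
renᴮ⁻ (term M ∷ ms) r (term s d b)
  with d′ , o ← ren⁻ M (pullback-of r) d | b′ , o′ ← renᴮ⁻ ms (pullback-of r) b =
  term (pullback-split r s) d′ b′ , off-split s o o′
renᴮ⁻ (label ℓ ∷ ms) r (label j b) with b′ , o ← renᴮ⁻ ms r b = label j b′ , o

renᶜ⁻ : (C : Conf m) → Pullback ρ V V′ Γ Γ′ → V′ ∣ Γ′ ⊩ᶜ[ φ ] renᶜ ρ C ∶ T →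
        V ∣ Γ ⊩ᶜ[ φ ] C ∶ T × Off ρ Γ′
renᶜ⁻ (φ ▸ M) r (T-Thread t d) with d′ , o ← ren⁻ M r d = T-Thread t d′ , o
renᶜ⁻ (C ∥ D) r (T-Par s j c d)
  with c′ , o ← renᶜ⁻ C (pullback-of r) c | d′ , o′ ← renᶜ⁻ D (pullback-of r) d =
  T-Par (pullback-split r s) j c′ d′ , off-split s o o′
renᶜ⁻ (ν ms C) r (T-Res s b c)
  with r₁ ← pullback-lift₁ r
  with b′ , o ← renᴮ⁻ ms (pullback-lift 1 refl (pullback-of r₁)) b
     | c′ , o′ ← renᶜ⁻ C (pullback-lift 1 refl (pullback-of r₁)) c =
  T-Res (pullback-split r₁ s) b′ c′ , off-lift 0 (off-split s (off-lift 1 o) (off-lift 1 o′))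
renᶜ⁻ (C ⟪ M ⟫) r (T-ConfSub s c e)
  with c′ , o ← renᶜ⁻ C (pullback-lift₁ (pullback-of r)) c | e′ , o′ ← ren⁻ M (pullback-of r) e =
  T-ConfSub (pullback-split r s) c′ e′ , off-split s (off-lift 0 o) o′

-- Thread and configuration contexts

infix 3 _∣_⊩ᶠ[_]_∶_⟸_∶_ _∣_⊩ᴳ[_]_∶_⟸_∣[_]_

data _∣_⊩ᶠ[_]_∶_⟸_∶_ {n} (V : Vars n) (Γ : Ctx n) :
     ∀ {k} → Marker → TCtx k n → Type → Vec (Maybe Type) k → Type → Set where
  thread□ : ∀ {k φ T U} {R : RCtx k n} {B} → Thread φ T →
            V ∣ Γ ⊩ᴿ R ∶ T ⟸ B ∶ U → V ∣ Γ ⊩ᶠ[ φ ] φ ▸ R ∶ T ⟸ B ∶ U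
  sub□    : ∀ {k Γ₁ Γ₂ φ C T T′ U} {R : RCtx k n} {B} → Split Γ Γ₁ Γ₂ →
            false ◃ V ∣ just T′ ◃ Γ₁ ⊩ᶜ[ φ ] C ∶ T → V ∣ Γ₂ ⊩ᴿ R ∶ T′ ⟸ B ∶ U →
            V ∣ Γ ⊩ᶠ[ φ ] C ⟪ R ⟫ ∶ T ⟸ B ∶ U

plugᶠ : ∀ {k n} {V : Vars n} {Θ Γ Ξ : Ctx n} {F : TCtx k n} {B L} → V ∣ Γ ⊩ᶠ[ φ ] F ∶ T ⟸ B ∶ U →
        Split Θ Γ Ξ → extend (falses k) V ∣ extend B Ξ ⊩ L ∶ U → V ∣ Θ ⊩ᶜ[ φ ] F [ L ]ᶠ ∶ T
plugᶠ (thread□ t r) s l = T-Thread t (plugᴿ r s l)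
plugᶠ (sub□ t c r) s l with _ , s′ , t′ ← split-assocʳ s t = T-ConfSub s′ c (plugᴿ r t′ l)

record Plugᶠ {k n} (V : Vars n) (Θ : Ctx n) (φ : Marker) (F : TCtx k n) (L : Term (under k n)) (T : Type) :
       Set where
  constructor plugged
  field
    {Γᶠ Γʰ} : Ctx n
    {Bʰ}    : Vec (Maybe Type) k
    {Uʰ}    : Type
    parts   : Split Θ Γᶠ Γʰ
    context : V ∣ Γᶠ ⊩ᶠ[ φ ] F ∶ T ⟸ Bʰ ∶ Uʰ
    hole    : extend (falses k) V ∣ extend Bʰ Γʰ ⊩ L ∶ Uʰ

unplugᶠ : ∀ {k n} {V : Vars n} {Θ} (F : TCtx k n) {L} → V ∣ Θ ⊩ᶜ[ φ ] F [ L ]ᶠ ∶ T → Plugᶠ V Θ φ F L T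
unplugᶠ (φ ▸ R) (T-Thread t d) with plugged s r l ← unplugᴿ R d = plugged s (thread□ t r) l
unplugᶠ (C ⟪ R ⟫) (T-ConfSub s c d) with plugged t r l ← unplugᴿ R d with _ , s′ , t′ ← split-assocˡ s t =
  plugged s′ (sub□ t′ c r) l

renᶠ⁺ : ∀ {k m n} {ρ : Fin m → Fin n} {V : Vars m} {V′ Γ Γ′} {F : TCtx k m} {B} →
        Renaming ρ V V′ Γ Γ′ → V ∣ Γ ⊩ᶠ[ φ ] F ∶ T ⟸ B ∶ U → V′ ∣ Γ′ ⊩ᶠ[ φ ] renᶠ ρ F ∶ T ⟸ B ∶ U
renᶠ⁺ r (thread□ t c) = thread□ t (renᴿ⁺ r c)
renᶠ⁺ r (sub□ s d c) with _ , _ , s′ , r₁ , r₂ ← renaming-split r s =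
  sub□ s′ (renᶜ⁺ (renaming-lift₁ r₁) d) (renᴿ⁺ r₂ c)

data _∣_⊩ᴳ[_]_∶_⟸_∣[_]_ {n} (V : Vars n) (Γ : Ctx n) :
     ∀ {k} → Marker → GCtx k n → Type → Vec (Maybe Type) k → Marker → Type → Set where
  □    : ∀ {φ T} → (∀ y → Unr (Γ y)) → V ∣ Γ ⊩ᴳ[ φ ] □ ∶ T ⟸ [] ∣[ φ ] T
  par□ : ∀ {k Γ₁ Γ₂ φ₁ φ₂ φ ψ T₁ T₂ T U D} {G : GCtx k n} {B} → Split Γ Γ₁ Γ₂ →
         Join φ₁ T₁ φ₂ T₂ φ T → V ∣ Γ₁ ⊩ᴳ[ φ₁ ] G ∶ T₁ ⟸ B ∣[ ψ ] U → V ∣ Γ₂ ⊩ᶜ[ φ₂ ] D ∶ T₂ →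
         V ∣ Γ ⊩ᴳ[ φ ] G ∥□ D ∶ T ⟸ B ∣[ ψ ] U
  res□ : ∀ {k Γ₁ Γ₂ φ ψ ms S′ S T U a b c} {G : GCtx k (suc (suc n))} {B} →
         Part (just (sess (dual S))) a b → Part (just (sess S′)) (Γ₂ zero) c →
         Split (a ◃ Γ) Γ₁ (Γ₂ ∘ suc) → false ◃ false ◃ V ∣ nothing ◃ Γ₁ ⊩ᴮ ms ∶ S′ > S →
         false ◃ false ◃ V ∣ Γ₂ ⊩ᴳ[ φ ] G ∶ T ⟸ B ∣[ ψ ] U →
         V ∣ Γ ⊩ᴳ[ φ ] ν□ ms G ∶ T ⟸ b ∷ c ∷ B ∣[ ψ ] U
  sub□ : ∀ {k Γ₁ Γ₂ φ ψ M T T′ U b} {G : GCtx k (suc n)} {B} → Split Γ (Γ₁ ∘ suc) Γ₂ →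
         Part (just T′) (Γ₁ zero) b → false ◃ V ∣ Γ₁ ⊩ᴳ[ φ ] G ∶ T ⟸ B ∣[ ψ ] U → V ∣ Γ₂ ⊩ M ∶ T′ →
         V ∣ Γ ⊩ᴳ[ φ ] G ⟪ M ⟫ ∶ T ⟸ b ∷ B ∣[ ψ ] U

plugᴳ : ∀ {k n} {V : Vars n} {Θ Γ Ξ : Ctx n} {G : GCtx k n} {B C} → V ∣ Γ ⊩ᴳ[ φ ] G ∶ T ⟸ B ∣[ ψ ] U →
        Split Θ Γ Ξ → extend (falses k) V ∣ extend B Ξ ⊩ᶜ[ ψ ] C ∶ U → V ∣ Θ ⊩ᶜ[ φ ] G [ C ]ᴳ ∶ T
plugᴳ (□ u) s c = weakenᶜ (split-unrˡ s u) c
plugᴳ (par□ t j g d) s c with _ , s′ , t′ ← split-exchange s t = T-Par s′ j (plugᴳ g t′ c) d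
plugᴳ (res□ p q t m g) s c with _ , s′ , t′ ← split-assocʳ (split-cons p s) t =
  T-Res s′ m (plugᴳ g (split-uncons q t′) c)
plugᴳ (sub□ t p g e) s c with _ , s′ , t′ ← split-exchange s t =
  T-ConfSub s′ (plugᴳ g (split-uncons p t′) c) e

record Plugᴳ {k n} (V : Vars n) (Θ : Ctx n) (φ : Marker) (G : GCtx k n) (C : Conf (under k n)) (T : Type) :
       Set where
  constructor plugged
  field
    {Γᶠ Γʰ} : Ctx n
    {Bʰ}    : Vec (Maybe Type) k
    {φʰ}    : Marker
    {Uʰ}    : Type
    parts   : Split Θ Γᶠ Γʰ
    context : V ∣ Γᶠ ⊩ᴳ[ φ ] G ∶ T ⟸ Bʰ ∣[ φʰ ] Uʰ
    hole    : extend (falses k) V ∣ extend Bʰ Γʰ ⊩ᶜ[ φʰ ] C ∶ Uʰ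

unplugᴳ : ∀ {k n} {V : Vars n} {Θ} (G : GCtx k n) {C} → V ∣ Θ ⊩ᶜ[ φ ] G [ C ]ᴳ ∶ T → Plugᴳ V Θ φ G C T
unplugᴳ □ d = plugged (mk λ _ → part-right) (□ λ _ → same) d
unplugᴳ (G ∥□ D) (T-Par s j c d) with plugged t g l ← unplugᴳ G c with _ , s′ , t′ ← split-exchange s t =
  plugged s′ (par□ t′ j g d) l
unplugᴳ (ν□ ms G) (T-Res s b c)
  with plugged {Bʰ = B} t g l ← unplugᴳ G c with _ , s′ , t′ ← split-assocˡ s (split-∘ suc t) =
  plugged (split-∘ suc s′) (res□ (part s′ zero) (part t zero) (split-resp ◃-η t′) b g)
    (weakenᶜ (extend-⊑ B (⊑-reflexive λ { 0F → refl ; 1F → refl ; (suc (suc _)) → refl })) l)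
unplugᴳ (G ⟪ M ⟫) (T-ConfSub s c e)
  with plugged {Bʰ = B} t g l ← unplugᴳ G c with _ , s′ , t′ ← split-exchange s (split-∘ suc t) =
  plugged s′ (sub□ t′ (part t zero) g e) (weakenᶜ (extend-⊑ B (⊑-reflexive ◃-η)) l)

renᴳ⁺ : ∀ {k m n} {ρ : Fin m → Fin n} {V : Vars m} {V′ Γ Γ′} {G : GCtx k m} {B} →
        Renaming ρ V V′ Γ Γ′ → V ∣ Γ ⊩ᴳ[ φ ] G ∶ T ⟸ B ∣[ ψ ] U →
        V′ ∣ Γ′ ⊩ᴳ[ φ ] renᴳ ρ G ∶ T ⟸ B ∣[ ψ ] U
renᴳ⁺ r (□ u) = □ (renaming-unr r u)
renᴳ⁺ r (par□ s j g d) with _ , _ , s′ , r₁ , r₂ ← renaming-split r s =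
  par□ s′ j (renᴳ⁺ r₁ g) (renᶜ⁺ r₂ d)
renᴳ⁺ r (res□ {Γ₂ = Γ₂} p q s b g) with _ , Γ₂′ , s′ , r₁ , r₂ ← renaming-split (renaming-lift₁ r) s =
  res□ {Γ₂ = Γ₂ zero ◃ Γ₂′} p q s′ (renᴮ⁺ (renaming-lift 1 refl r₁) b) (renᴳ⁺ (renaming-lift 1 refl r₂) g)
renᴳ⁺ r (sub□ {Γ₁ = Γ₁} s p g e) with Γ₁′ , _ , s′ , r₁ , r₂ ← renaming-split r s =
  sub□ {Γ₁ = Γ₁ zero ◃ Γ₁′} s′ p (renᴳ⁺ (renaming-lift 0 refl r₁) g) (ren⁺ r₂ e)

renᴳ⁻ : ∀ {k m n} {ρ : Fin m → Fin n} {V : Vars m} {V′ Γ Γ′} (G : GCtx k m) {B} →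
        Pullback ρ V V′ Γ Γ′ → V′ ∣ Γ′ ⊩ᴳ[ φ ] renᴳ ρ G ∶ T ⟸ B ∣[ ψ ] U →
        V ∣ Γ ⊩ᴳ[ φ ] G ∶ T ⟸ B ∣[ ψ ] U × Off ρ Γ′
renᴳ⁻ □ r (□ u) = □ (λ y → subst Unr (env r y) (u _)) , λ y _ → u y
renᴳ⁻ (G ∥□ D) r (par□ s j g d)
  with g′ , o ← renᴳ⁻ G (pullback-of r) g | d′ , o′ ← renᶜ⁻ D (pullback-of r) d =
  par□ (pullback-split r s) j g′ d′ , off-split s o o′
renᴳ⁻ (ν□ ms G) r (res□ p q s b g)
  with r₁ ← pullback-lift₁ r
  with b′ , o ← renᴮ⁻ ms (pullback-lift 1 refl (pullback-of r₁)) b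
     | g′ , o′ ← renᴳ⁻ G (pullback-of (pullback-lift 1 {Γ = nothing ◃ _} {nothing ◃ _} refl r₁)) g =
  res□ p q (pullback-split r₁ s) b′ g′ , off-lift 0 (off-split s (off-lift 1 o) (off-lift 1 o′))
renᴳ⁻ (G ⟪ M ⟫) r (sub□ s p g e)
  with g′ , o ← renᴳ⁻ G (pullback-of (pullback-lift₁ {b = nothing} r)) g | e′ , o′ ← ren⁻ M (pullback-of r) e =
  sub□ (pullback-split r s) p g′ e′ , off-split s (off-lift 0 o) o′

mutual
  dual-involutive : ∀ S → dual (dual S) ≡ S
  dual-involutive (! T ∙ S) = cong (! T ∙_) (dual-involutive S)
  dual-involutive (¿ T ∙ S) = cong (¿ T ∙_) (dual-involutive S)
  dual-involutive (⊕ Ss)    = cong ⊕_ (duals-involutive Ss)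
  dual-involutive (& Ss)    = cong &_ (duals-involutive Ss)
  dual-involutive end       = refl

  duals-involutive : ∀ {j} (Ss : Family Session j) → duals (duals Ss) ≡ Ss
  duals-involutive (last i p S)    = cong (last i p) (dual-involutive S)
  duals-involutive (cons i p S Ss)
    rewrite dual-involutive S | duals-involutive Ss = refl

-- Labels of a family

∈ᶠ⇒≤ : ∀ {A : Set} {i j a} {as : Family A i} → j ↦ a ∈ᶠ as → i ≤ j
∈ᶠ⇒≤ {i = i} {j} (last {p = p}) = recompute (i ≤? j) p
∈ᶠ⇒≤ {i = i} {j} (here {p = p}) = recompute (i ≤? j) p
∈ᶠ⇒≤ {i = i} (there {i = i′} {p = p} j∈) = ≤-trans (recompute (i ≤? i′) p) (<⇒≤ (∈ᶠ⇒≤ j∈))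

pointwise-∈ᶠ : ∀ {A B : Set} {R : A → B → Set} {i j a b} {as : Family A i} {bs : Family B i} →
               Pointwise R as bs → j ↦ a ∈ᶠ as → j ↦ b ∈ᶠ bs → R a b
pointwise-∈ᶠ (last r)    last       last       = r
pointwise-∈ᶠ (cons r rs) here       here       = r
pointwise-∈ᶠ (cons r rs) here       (there j∈) = contradiction (∈ᶠ⇒≤ j∈) (<-irrefl refl)
pointwise-∈ᶠ (cons r rs) (there j∈) here       = contradiction (∈ᶠ⇒≤ j∈) (<-irrefl refl)
pointwise-∈ᶠ (cons r rs) (there j∈) (there j∈′) = pointwise-∈ᶠ rs j∈ j∈′

duals-∈ᶠ : ∀ {i j S} {Ss : Family Session i} → j ↦ S ∈ᶠ Ss → j ↦ dual S ∈ᶠ duals Ss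
duals-∈ᶠ last       = last
duals-∈ᶠ here       = here
duals-∈ᶠ (there j∈) = there (duals-∈ᶠ j∈)

-- Subject congruence for configurations

join-comm : ∀ {φ₁ T₁ φ₂ T₂} → Join φ₁ T₁ φ₂ T₂ φ T → Join φ₂ T₂ φ₁ T₁ φ T
join-comm joinˡ = joinʳ
join-comm joinʳ = joinˡ

join-assocˡ : ∀ {φ₁ T₁ φ₂ T₂ φ₃ T₃ φ₄ T₄} → Join φ₁ T₁ φ₄ T₄ φ T → Join φ₂ T₂ φ₃ T₃ φ₄ T₄ →
              ∃ λ φ₅ → ∃ λ T₅ → Join φ₅ T₅ φ₃ T₃ φ T × Join φ₁ T₁ φ₂ T₂ φ₅ T₅
join-assocˡ joinˡ joinˡ = -, -, joinˡ , joinˡ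
join-assocˡ joinˡ joinʳ = -, -, joinʳ , joinˡ
join-assocˡ joinʳ joinˡ = -, -, joinʳ , joinʳ
join-assocˡ joinʳ joinʳ = -, -, joinʳ , joinʳ

join-assocʳ : ∀ {φ₁ T₁ φ₂ T₂ φ₃ T₃ φ₄ T₄} → Join φ₄ T₄ φ₃ T₃ φ T → Join φ₁ T₁ φ₂ T₂ φ₄ T₄ →
              ∃ λ φ₅ → ∃ λ T₅ → Join φ₁ T₁ φ₅ T₅ φ T × Join φ₂ T₂ φ₃ T₃ φ₅ T₅
join-assocʳ j j′ with _ , _ , i , i′ ← join-assocˡ (join-comm j) (join-comm j′) =
  -, -, join-comm i , join-comm i′

par-comm : V ∣ Γ ⊩ᶜ[ φ ] C ∥ D ∶ T → V ∣ Γ ⊩ᶜ[ φ ] D ∥ C ∶ T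
par-comm (T-Par s j c d) = T-Par (split-swap s) (join-comm j) d c

par-assocˡ : V ∣ Γ ⊩ᶜ[ φ ] C ∥ (D ∥ C′) ∶ T → V ∣ Γ ⊩ᶜ[ φ ] (C ∥ D) ∥ C′ ∶ T
par-assocˡ (T-Par s j c (T-Par t j′ d c′))
  with _ , s′ , t′ ← split-assocˡ s t | _ , _ , i , i′ ← join-assocˡ j j′ = T-Par s′ i (T-Par t′ i′ c d) c′

par-assocʳ : V ∣ Γ ⊩ᶜ[ φ ] (C ∥ D) ∥ C′ ∶ T → V ∣ Γ ⊩ᶜ[ φ ] C ∥ (D ∥ C′) ∶ T
par-assocʳ (T-Par s j (T-Par t j′ c d) c′)
  with _ , s′ , t′ ← split-assocʳ s t | _ , _ , i , i′ ← join-assocʳ j j′ = T-Par s′ i c (T-Par t′ i′ d c′)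

pullback-swap : ∀ {V : Vars n} {Γ} →
                Pullback swap (false ◃ false ◃ V) (false ◃ false ◃ V) (Γ ∘ swap) Γ
pullback-swap = bijective-pullback swap-involutive λ { (suc (suc x)) v → v }

swap₂-involutive : ∀ (x : Fin (suc (suc (suc (suc n))))) → swap₂ (swap₂ x) ≡ x
swap₂-involutive 0F                        = refl
swap₂-involutive 1F                        = refl
swap₂-involutive 2F                        = refl
swap₂-involutive 3F                        = refl
swap₂-involutive (suc (suc (suc (suc x)))) = refl

renaming-swap₂ : ∀ {V : Vars n} {Γ} →
                 Renaming swap₂ (false ◃ false ◃ false ◃ false ◃ V) (false ◃ false ◃ false ◃ false ◃ V)
                   (Γ ∘ swap₂) Γ
renaming-swap₂ = bijective-renaming swap₂-involutive λ { (suc (suc (suc (suc x)))) v → v }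

pullback-swap₂ : ∀ {V : Vars n} {Γ} →
                 Pullback swap₂ (false ◃ false ◃ false ◃ false ◃ V) (false ◃ false ◃ false ◃ false ◃ V)
                   (Γ ∘ swap₂) Γ
pullback-swap₂ = bijective-pullback swap₂-involutive λ { (suc (suc (suc (suc x)))) v → v }

ResSwap : (∀ {S S′ Γ} → false ◃ false ◃ V ∣ just S ◃ just S′ ◃ Γ ⊩ᶜ[ φ ] C ∶ T →
           false ◃ false ◃ V ∣ just S′ ◃ just S ◃ Γ ⊩ᶜ[ φ ] D ∶ T) →
          V ∣ Γ ⊩ᶜ[ φ ] ν [] C ∶ T → V ∣ Γ ⊩ᶜ[ φ ] ν [] D ∶ T
ResSwap {Γ = Γ} f (T-Res {S = S} s ([] u) c) =
  T-Res {Γ₁ = λ _ → nothing} {S = dual S} (mk λ _ → part-right) ([] λ { zero → same ; (suc _) → same })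
    (subst (λ S′ → _ ∣ just (sess (dual S)) ◃ just (sess S′) ◃ Γ ⊩ᶜ[ _ ] _ ∶ _)
      (≡-sym (dual-involutive S)) (f (weakenᶜ (⊑-cons (split-unrˡ s λ x → u (suc x))) c)))

swapped : ∀ {n} {Γ : Ctx n} x → (a ◃ b ◃ Γ) x ≡ (b ◃ a ◃ Γ) (swap x)
swapped 0F            = refl
swapped 1F            = refl
swapped (suc (suc x)) = refl

ResSwap⁺ : V ∣ Γ ⊩ᶜ[ φ ] ν [] C ∶ T → V ∣ Γ ⊩ᶜ[ φ ] ν [] (renᶜ swap C) ∶ T
ResSwap⁺ = ResSwap λ c → renᶜ⁺ renaming-swap (respᶜ swapped c)

ResSwap⁻ : ∀ C → V ∣ Γ ⊩ᶜ[ φ ] ν [] (renᶜ swap C) ∶ T → V ∣ Γ ⊩ᶜ[ φ ] ν [] C ∶ T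
ResSwap⁻ C = ResSwap λ c → respᶜ (λ x → ≡-sym (swapped x)) (proj₁ (renᶜ⁻ C pullback-swap c))

-- The inner buffer ns may have been given the variables of the outer restriction, if
-- they have type end; they go to the configuration, as ns is moved out of their scope.
ResComm : ∀ {n} {V : Vars n} {Γ} ms ns {C D} →
          (∀ {Γ Γ′} → Γ ⊑ Γ′ ∘ swap₂ → false ◃ false ◃ false ◃ false ◃ V ∣ Γ ⊩ᶜ[ φ ] C ∶ T →
           false ◃ false ◃ false ◃ false ◃ V ∣ Γ′ ⊩ᶜ[ φ ] D ∶ T) →
          V ∣ Γ ⊩ᶜ[ φ ] ν ms (ν (renᴮ (lift 2 (2 ↑ʳ_)) ns) C) ∶ T →
          V ∣ Γ ⊩ᶜ[ φ ] ν ns (ν (renᴮ (lift 2 (2 ↑ʳ_)) ms) D) ∶ T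
ResComm {n = n} {Γ = Γ} ms ns f (T-Res {Γ₁ = A} {Γ₂ = E} {S′ = S′} s a (T-Res {Γ₁ = N} {Γ₂ = G} {S′ = R′} t b c))
  with b′ , o ← renᴮ⁻ ns (pullback-lift 1 {Γ = nothing ◃ N 0F ◃ λ x → N (suc (suc (suc x)))} refl
                           (pullback-lift 0 refl pullback-suc²)) b
  with E′ , s′ , t′ ← split-pull (split-∘ suc s) (split-∘ (3 ↑ʳ_) t) =
  T-Res {Γ₂ = G 0F ◃ E′} (split-uncons (part t 0F) s′) b′
    (T-Res {Γ₁ = A 0F ◃ nothing ◃ nothing ◃ (A ∘ suc)} {Γ₂ = E 0F ◃ just (sess R′) ◃ G 0F ◃ (G ∘ (3 ↑ʳ_))}
      (split-cons (part s 0F) (split-cons₂ right part-right t′))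
      (renᴮ⁺ (renaming-lift 1 refl (renaming-lift 0 refl renaming-suc²)) a)
      (f moved c))
  where
  moved : (just (sess R′) ◃ G) ⊑
          (just (sess S′) ◃ E 0F ◃ just (sess R′) ◃ G 0F ◃ (λ x → G (suc (suc (suc x))))) ∘ swap₂
  moved = mk λ
    { 0F → same
    ; 1F → same
    ; 2F → part-unrˡ (part t 1F) (o 2F λ { (suc (suc x)) () })
    ; 3F → part-unrˡ (part t 2F) (o 3F λ { (suc (suc x)) () })
    ; (suc (suc (suc (suc x)))) → same }

ResComm⁺ : ∀ ms ns → V ∣ Γ ⊩ᶜ[ φ ] ν ms (ν (renᴮ (lift 2 (2 ↑ʳ_)) ns) C) ∶ T →
           V ∣ Γ ⊩ᶜ[ φ ] ν ns (ν (renᴮ (lift 2 (2 ↑ʳ_)) ms) (renᶜ swap₂ C)) ∶ T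
ResComm⁺ ms ns = ResComm ms ns λ p c → renᶜ⁺ renaming-swap₂ (weakenᶜ p c)

ResComm⁻ : ∀ ms ns C → V ∣ Γ ⊩ᶜ[ φ ] ν ns (ν (renᴮ (lift 2 (2 ↑ʳ_)) ms) (renᶜ swap₂ C)) ∶ T →
           V ∣ Γ ⊩ᶜ[ φ ] ν ms (ν (renᴮ (lift 2 (2 ↑ʳ_)) ns) C) ∶ T
ResComm⁻ ms ns C = ResComm ns ms λ {Γ} {Γ′} p c →
  weakenᶜ (mk λ x → subst (λ y → Γ (swap₂ x) ⊑₁ Γ′ y) (swap₂-involutive x) (at p (swap₂ x)))
    (proj₁ (renᶜ⁻ C pullback-swap₂ c))

ResExt⁺ : ∀ {n} {V : Vars n} {Γ} ms C D → V ∣ Γ ⊩ᶜ[ φ ] ν ms (renᶜ (2 ↑ʳ_) C ∥ D) ∶ T →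
          V ∣ Γ ⊩ᶜ[ φ ] C ∥ ν ms D ∶ T
ResExt⁺ ms C D (T-Res {Γ₂ = E} s b (T-Par {Γ₁ = E₁} {Γ₂ = E₂} t j c d))
  with c′ , o ← renᶜ⁻ C pullback-suc² c
  with _ , s′ , t′ ← split-pull (split-∘ suc s) (split-∘ (2 ↑ʳ_) t) =
  T-Par s′ j c′ (T-Res (split-uncons (part s zero) t′) b (weakenᶜ kept d))
  where
  kept : E₂ ⊑ (_ ◃ E 0F ◃ λ x → E₂ (suc (suc x)))
  kept = mk λ { 0F → part-unrˡ (part t 0F) (o 0F λ _ ()) ; 1F → part-unrˡ (part t 1F) (o 1F λ _ ())
              ; (suc (suc x)) → same }

ResExt⁻ : V ∣ Γ ⊩ᶜ[ φ ] C ∥ ν ms D ∶ T → V ∣ Γ ⊩ᶜ[ φ ] ν ms (renᶜ (2 ↑ʳ_) C ∥ D) ∶ T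
ResExt⁻ (T-Par s j c (T-Res t b d)) with _ , s′ , t′ ← split-pull (split-cons right s) t =
  T-Res s′ b (T-Par (split-cons right t′) j (renᶜ⁺ renaming-suc² c) d)

ResNil⁺ : ∀ C → V ∣ Γ ⊩ᶜ[ φ ] ν [] (renᶜ (2 ↑ʳ_) C) ∶ T → V ∣ Γ ⊩ᶜ[ φ ] C ∶ T
ResNil⁺ C (T-Res s ([] u) c) =
  weakenᶜ (split-unrˡ (split-∘ suc s) λ x → u (suc (suc x))) (proj₁ (renᶜ⁻ C pullback-suc² c))

ResNil⁻ : V ∣ Γ ⊩ᶜ[ φ ] C ∶ T → V ∣ Γ ⊩ᶜ[ φ ] ν [] (renᶜ (2 ↑ʳ_) C) ∶ T
ResNil⁻ c = T-Res {Γ₁ = λ _ → nothing} {S = end} (mk λ _ → part-right)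
  ([] λ { zero → same ; (suc _) → same })
  (weakenᶜ (mk λ { 0F → drop ; 1F → drop ; (suc (suc x)) → same }) (renᶜ⁺ renaming-suc² c))

ParNil⁺ : V ∣ Γ ⊩ᶜ[ φ ] C ∥ ◇ ▸ unit ∶ T → V ∣ Γ ⊩ᶜ[ φ ] C ∶ T
ParNil⁺ (T-Par s joinˡ c (T-Thread child (T-Unit u))) = weakenᶜ (split-unrˡ (split-swap s) u) c
ParNil⁺ (T-Par s joinʳ c (T-Thread child (T-Unit u))) = weakenᶜ (split-unrˡ (split-swap s) u) c

ParNil⁻ : V ∣ Γ ⊩ᶜ[ φ ] C ∶ T → V ∣ Γ ⊩ᶜ[ φ ] C ∥ ◇ ▸ unit ∶ T
ParNil⁻ c = T-Par (mk λ _ → part-left) joinʳ c (T-Thread child (T-Unit λ _ → same))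

ConfSubExt⁺ : ∀ {k n} {V : Vars n} {Γ} (G : GCtx k n) C M →
              V ∣ Γ ⊩ᶜ[ φ ] (renᴳ suc G [ renᶜ (sink k) C ]ᴳ) ⟪ M ⟫ ∶ T →
              V ∣ Γ ⊩ᶜ[ φ ] G [ C ⟪ ren (wkUnder k) M ⟫ ]ᴳ ∶ T
ConfSubExt⁺ {k = k} G C M (T-ConfSub s c e)
  with plugged {Bʰ = B} t g l ← unplugᴳ (renᴳ suc G) c
  with g′ , o ← renᴳ⁻ G pullback-suc g
  with _ , s′ , t′ ← split-assocʳ s (split-∘ suc t)
  with l′ , _ ← renᶜ⁻ C (pullback-sink k {B = B})
                  (weakenᶜ (extend-⊑ B (⊑-head (part-unrˡ (part t zero) (off-suc o)) refl)) l) =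
  plugᴳ g′ s′ (T-ConfSub (split-extendʳ B t′) l′ (ren⁺ (renaming-wkUnder k) e))

ConfSubExt⁻ : ∀ {k n} {V : Vars n} {Γ} (G : GCtx k n) C M →
              V ∣ Γ ⊩ᶜ[ φ ] G [ C ⟪ ren (wkUnder k) M ⟫ ]ᴳ ∶ T →
              V ∣ Γ ⊩ᶜ[ φ ] (renᴳ suc G [ renᶜ (sink k) C ]ᴳ) ⟪ M ⟫ ∶ T
ConfSubExt⁻ {k = k} G C M d
  with plugged {Bʰ = B} t g (T-ConfSub s l e) ← unplugᴳ G d
  with e′ , o ← ren⁻ M (pullback-wkUnder k) e
  with p , s′ ← split-extend-off B s o
  with _ , t′ , u ← split-assocˡ t s′ =
  T-ConfSub t′ (plugᴳ (renᴳ⁺ renaming-suc g) (split-cons right u)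
                 (renᶜ⁺ (renaming-sink k {B = B}) (weakenᶜ (⊑-cons p) l))) e′

-- Buffers and the threads that use them

extend-unr : ∀ {k n} (B : Vec (Maybe Type) k) {Ξ : Ctx n} {x} → (∀ i → Unr (lookup B i)) →
             (∀ z → z ≢ x → Unr (Ξ z)) → ∀ y → y ≢ wkUnder k x → Unr (extend B Ξ y)
extend-unr {k} B {Ξ} p q y y≢ with underView k y
... | inner i = subst Unr (≡-sym (extend-bound B Ξ i)) (p i)
... | outer z = subst Unr (≡-sym (extend-wkUnder B Ξ z)) (q z λ { refl → y≢ refl })

unsnoc-term : ∀ (ms : Buffer n) → V ∣ Γ ⊩ᴮ ms ∷ʳ term M ∶ S′ > S →
              ∃ λ T → ∃ λ S₀ → S ≡ (! T ∙ S₀) × ∃ λ Γ₁ → ∃ λ Γ₂ → Split Γ Γ₁ Γ₂ ×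
              V ∣ Γ₁ ⊩ M ∶ T × V ∣ Γ₂ ⊩ᴮ ms ∶ S′ > S₀
unsnoc-term [] (term s d ([] u)) = -, -, refl , -, -, s , d , [] u
unsnoc-term (term N ∷ ms) (term s e b) with _ , _ , refl , _ , _ , t , d , b′ ← unsnoc-term ms b
  with _ , s′ , t′ ← split-pull s t = -, -, refl , -, -, s′ , d , term t′ e b′
unsnoc-term (label ℓ ∷ ms) (label j b) with _ , _ , eq , _ , _ , s , d , b′ ← unsnoc-term ms b =
  -, -, eq , -, -, s , d , label j b′

unsnoc-label : ∀ (ms : Buffer n) {j} → V ∣ Γ ⊩ᴮ ms ∷ʳ label j ∶ S′ > S →
               ∃ λ Ss → ∃ λ Sⱼ → S ≡ (⊕ Ss) × j ↦ Sⱼ ∈ᶠ Ss × V ∣ Γ ⊩ᴮ ms ∶ S′ > Sⱼ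
unsnoc-label [] (label j ([] u)) = -, -, refl , j , [] u
unsnoc-label (term N ∷ ms) (term s e b) with _ , _ , eq , j , b′ ← unsnoc-label ms b =
  -, -, eq , j , term s e b′
unsnoc-label (label ℓ ∷ ms) (label i b) with _ , _ , eq , j , b′ ← unsnoc-label ms b =
  -, -, eq , j , label i b′

record Focus {k n} (V : Vars n) (Θ : Ctx n) (φ : Marker) (F : TCtx k n) (L : Term (under k n)) (C : Conf n)
       (T : Type) : Set where
  constructor focused
  field
    {Γᶠ Γʰ} : Ctx n
    {Bʰ}    : Vec (Maybe Type) k
    {Uʰ}    : Type
    parts   : Split Θ Γᶠ Γʰ
    hole    : extend (falses k) V ∣ extend Bʰ Γʰ ⊩ L ∶ Uʰ
    refill  : ∀ {Θ′ Ξ L′} → Split Θ′ Γᶠ Ξ → extend (falses k) V ∣ extend Bʰ Ξ ⊩ L′ ∶ Uʰ →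
              V ∣ Θ′ ⊩ᶜ[ φ ] F [ L′ ]ᶠ ∥ C ∶ T

focus : ∀ {k n} {V : Vars n} {Θ} (F : TCtx k n) {L C} → V ∣ Θ ⊩ᶜ[ φ ] F [ L ]ᶠ ∥ C ∶ T → Focus V Θ φ F L C T
focus F (T-Par s j d e) with plugged {Bʰ = B} t c l ← unplugᶠ F d with _ , s′ , t′ ← split-exchange s t =
  focused {Bʰ = B} s′ l λ u l′ → let _ , u′ , v = split-exchange u t′ in T-Par u′ j (plugᶠ c v l′) e

var-bound : ∀ {x} → V x ≡ false → V ∣ Γ ⊩ var x ∶ T → Γ x ≡ just T × (∀ y → y ≢ x → Unr (Γ y))
var-bound v (T-Var eq u)  = eq , u
var-bound v (T-EndR v′ u) with () ← ≡-trans (≡-sym v) v′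

retype-var : ∀ {x} → (∀ y → y ≢ x → Unr (Γ y)) → V ∣ Γ [ x ≔ T ] ⊩ var x ∶ T
retype-var {Γ = Γ} {x = x} u =
  T-Var ([≔]-here Γ x) λ y y≢x → subst Unr (≡-sym ([≔]-there y≢x)) (u y y≢x)

retype-zero : ∀ x → (Γ [ zero ≔ T ]) x ≡ (just T ◃ Γ ∘ suc) x
retype-zero zero    = refl
retype-zero (suc x) = refl

retype-one : ∀ x → ((b ◃ Γ) [ 1F ≔ T ]) x ≡ (b ◃ Γ [ 0F ≔ T ]) x
retype-one 0F            = refl
retype-one 1F            = refl
retype-one (suc (suc x)) = refl

hole-entry : ∀ {B : Vec (Maybe Type) k} {Ξ : Ctx n} x {T} → extend B Ξ (wkUnder k x) ≡ just T → Ξ x ≡ just T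
hole-entry {B = B} {Ξ} x eq = ≡-trans (≡-sym (extend-wkUnder B Ξ x)) eq

Send′⁺ : ∀ {n} {V : Vars n} {Γ ms C M} (F : TCtx 0 (suc (suc n))) →
         V ∣ Γ ⊩ᶜ[ φ ] ν ms (F [ send′ M (var 0F) ]ᶠ ∥ C) ∶ T →
         V ∣ Γ ⊩ᶜ[ φ ] ν (term M ∷ ms) (F [ var 0F ]ᶠ ∥ C) ∶ T
Send′⁺ F (T-Res s b p) with focused {Bʰ = []} t (T-Send′ u d (T-Var eq un)) refill ← focus F p
  with refl ← split-justʳ t (split-justʳ u eq)
  with _ , t′ , u′ ← split-pull t u
  with _ , s′ , v ← split-assocˡ s (split-∘ suc t′) =
  T-Res s′ (term (split-uncons (part-absent (split-emptyˡ t′ (split-justʳ u′ eq))) (split-swap v)) d b)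
    (respᶜ retype-zero (refill (split-retype u′ eq) (retype-var un)))

Send′⁻ : ∀ {n} {V : Vars n} {Γ ms C M} (F : TCtx 0 (suc (suc n))) →
         V ∣ Γ ⊩ᶜ[ φ ] ν (term M ∷ ms) (F [ var 0F ]ᶠ ∥ C) ∶ T →
         V ∣ Γ ⊩ᶜ[ φ ] ν ms (F [ send′ M (var 0F) ]ᶠ ∥ C) ∶ T
Send′⁻ F (T-Res s (term a d b) p) with focused {Bʰ = []} t l refill ← focus F p
  with eq , un ← var-bound refl l
  with refl ← split-justʳ t eq
  with A₁-empty , A₂-empty ← split-nothing {x = 0F} a refl
  with _ , s′ , u ← split-exchange s (split-∘ suc a)
  with _ , t′ , v ← split-pull (split-uncons (part-absent A₁-empty) u)
                      (split-resp retype-zero (split-retype t eq)) =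
  T-Res (split-swap s′) (weakenᴮ (⊑-head same A₂-empty) b) (refill t′ (T-Send′ v d (retype-var un)))

Select⁺ : ∀ {k n} {V : Vars n} {Γ ms ℓ C} (F : TCtx k (suc (suc n))) →
          V ∣ Γ ⊩ᶜ[ φ ] ν ms (F [ select ℓ (var (wkUnder k 0F)) ]ᶠ ∥ C) ∶ T →
          V ∣ Γ ⊩ᶜ[ φ ] ν (label ℓ ∷ ms) (F [ var (wkUnder k 0F) ]ᶠ ∥ C) ∶ T
Select⁺ F (T-Res s b p) with focused {Bʰ = B} t (T-Select (T-Var eq un) j) refill ← focus F p
  with refl ← split-justʳ t (hole-entry {B = B} 0F eq) =
  T-Res s (label j b) (respᶜ retype-zero (refill (split-retype t (hole-entry {B = B} 0F eq))
    (resp (λ y → ≡-sym (extend-retype B y)) (retype-var un))))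

Select⁻ : ∀ {k n} {V : Vars n} {Γ ms ℓ C} (F : TCtx k (suc (suc n))) →
          V ∣ Γ ⊩ᶜ[ φ ] ν (label ℓ ∷ ms) (F [ var (wkUnder k 0F) ]ᶠ ∥ C) ∶ T →
          V ∣ Γ ⊩ᶜ[ φ ] ν ms (F [ select ℓ (var (wkUnder k 0F)) ]ᶠ ∥ C) ∶ T
Select⁻ {k = k} {V = V} F (T-Res s (label j b) p) with focused {Bʰ = B} t l refill ← focus F p
  with eq , un ← var-bound (extend-wkUnder (falses k) (false ◃ false ◃ V) 0F) l
  with refl ← split-justʳ t (hole-entry {B = B} 0F eq) =
  T-Res s b (respᶜ retype-zero (refill (split-retype t (hole-entry {B = B} 0F eq))
    (T-Select (resp (λ y → ≡-sym (extend-retype B y)) (retype-var un)) j)))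

New : ∀ {k n} {V : Vars n} {Γ} (F : TCtx k n) → V ∣ Γ ⊩ᶜ[ φ ] F [ new ]ᶠ ∶ T →
      V ∣ Γ ⊩ᶜ[ φ ] ν [] (renᶠ (2 ↑ʳ_) F [ pair (var (wkUnder k 0F)) (var (wkUnder k 1F)) ]ᶠ) ∶ T
New {k = k} F d with plugged {Γʰ = Ξ} {Bʰ = B} s c (T-New {S} u) ← unplugᶠ F d =
  T-Res {Γ₁ = λ _ → nothing} {S = S} (mk λ _ → part-right) ([] λ { zero → same ; (suc _) → same })
    (plugᶠ (renᶠ⁺ renaming-suc² c) (split-cons₂ right right s)
      (T-Pair (split-extendʳ B (split-cons₂ left right (mk λ _ → part-left)))
        (T-Var (extend-wkUnder B (_ ◃ nothing ◃ Ξ) 0F) (extend-unr B unr-inner unr-x))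
        (T-Var (extend-wkUnder (nothings k) (nothing ◃ _ ◃ λ _ → nothing) 1F)
          (extend-unr (nothings k) (λ i → ⊑₁-reflexive (≡-sym (lookup-replicate i nothing))) unr-y))))
  where
  unr-inner : ∀ i → Unr (lookup B i)
  unr-inner i = subst Unr (extend-bound B Ξ i) (u (bound k i))
  unr-x : ∀ z → z ≢ 0F → Unr ((a ◃ nothing ◃ Ξ) z)
  unr-x 0F z≢ = contradiction refl z≢
  unr-x 1F _  = same
  unr-x (suc (suc z)) _ = subst Unr (extend-wkUnder B Ξ z) (u (wkUnder k z))
  unr-y : ∀ {n} (z : Fin (suc (suc n))) → z ≢ 1F → Unr ((nothing ◃ a ◃ λ _ → nothing) z)
  unr-y 0F _  = same
  unr-y 1F z≢ = contradiction refl z≢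
  unr-y (suc (suc z)) _ = same

Spawn : (F : TCtx 0 n) → V ∣ Γ ⊩ᶜ[ φ ] F [ spawn (pair M N) ]ᶠ ∶ T → V ∣ Γ ⊩ᶜ[ φ ] F [ N ]ᶠ ∥ ◇ ▸ M ∶ T
Spawn F d with plugged {Bʰ = []} s c (T-Spawn (T-Pair t e l)) ← unplugᶠ F d
  with _ , s′ , t′ ← split-pull s t = T-Par (split-swap s′) joinʳ (plugᶠ c t′ l) (T-Thread child e)

Recv : ∀ {n} {V : Vars n} {Γ} ms {M C} (F : TCtx 0 (suc (suc n))) →
       V ∣ Γ ⊩ᶜ[ φ ] ν (ms ∷ʳ term M) (F [ recv (var 1F) ]ᶠ ∥ C) ∶ T →
       V ∣ Γ ⊩ᶜ[ φ ] ν ms (F [ pair M (var 1F) ]ᶠ ∥ C) ∶ T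
Recv ms F (T-Res s b p)
  with _ , _ , refl , _ , _ , a , d , b′ ← unsnoc-term ms b
  with focused {Bʰ = []} t (T-Recv (T-Var eq un)) refill ← focus F p
  with E₀ ← split-justʳ {x = 1F} t eq
  with refl ← split-justʳ s E₀
  with A₁-empty , A₂-empty ← split-nothing {x = 0F} a refl
  with _ , s′ , u ← split-exchange (split-resp retype-zero (split-retype s E₀)) (split-∘ suc a)
  with _ , t′ , v ← split-pull (split-uncons (part-absent A₁-empty) u)
                      (split-resp retype-one (split-retype t eq)) =
  T-Res (split-swap s′) (weakenᴮ (⊑-head same A₂-empty) b′) (refill t′ (T-Pair v d (retype-var un)))

Case : ∀ {k n} {V : Vars n} {Γ} ms {j Ms Mⱼ C} (F : TCtx k (suc (suc n))) → j ↦ Mⱼ ∈ᶠ Ms →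
       V ∣ Γ ⊩ᶜ[ φ ] ν (ms ∷ʳ label j) (F [ case (var (wkUnder k 1F)) Ms ]ᶠ ∥ C) ∶ T →
       V ∣ Γ ⊩ᶜ[ φ ] ν ms (F [ Mⱼ · var (wkUnder k 1F) ]ᶠ ∥ C) ∶ T
Case ms F j∈ (T-Res s b p)
  with _ , _ , refl , i , b′ ← unsnoc-label ms b
  with focused {Bʰ = B} t (T-Case u (T-Var eq un) bs) refill ← focus F p
  with Ξ₁ ← hole-entry {B = B} 1F (split-justʳ (split-swap u) eq)
  with refl ← split-justʳ s (split-justʳ {x = 1F} t Ξ₁) =
  T-Res (split-resp retype-zero (split-retype s (split-justʳ {x = 1F} t Ξ₁))) b′
    (respᶜ retype-one (refill (split-retype t Ξ₁)
      (T-App (split-resp (λ y → ≡-sym (extend-retype B y)) (split-retype (split-swap u) eq))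
        (pointwise-∈ᶠ bs j∈ (duals-∈ᶠ i)) (retype-var un))))

mutual
  ≡ᶜ⁺ : C ≡ᶜ D → V ∣ Γ ⊩ᶜ[ φ ] C ∶ T → V ∣ Γ ⊩ᶜ[ φ ] D ∶ T
  ≡ᶜ⁺ (SC-TermSC p) (T-Thread t d) = T-Thread t (≡ᴹ⁺ p d)
  ≡ᶜ⁺ SC-ResSwap d = ResSwap⁺ d
  ≡ᶜ⁺ (SC-ResComm {ms} {ns}) d = ResComm⁺ ms ns d
  ≡ᶜ⁺ (SC-ResExt {ms} {C} {D}) d = ResExt⁺ ms C D d
  ≡ᶜ⁺ (SC-ResNil {C}) d = ResNil⁺ C d
  ≡ᶜ⁺ (SC-Send′ F) d = Send′⁺ F d
  ≡ᶜ⁺ (SC-Select F) d = Select⁺ F d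
  ≡ᶜ⁺ SC-ParNil d = ParNil⁺ d
  ≡ᶜ⁺ SC-ParComm d = par-comm d
  ≡ᶜ⁺ SC-ParAssoc d = par-assocˡ d
  ≡ᶜ⁺ SC-ConfSub (T-Thread t (T-Sub s d e)) = T-ConfSub s (T-Thread t d) e
  ≡ᶜ⁺ (SC-ConfSubExt G C M) d = ConfSubExt⁺ G C M d
  ≡ᶜ⁺ refl d = d
  ≡ᶜ⁺ (sym p) d = ≡ᶜ⁻ p d
  ≡ᶜ⁺ (trans p q) d = ≡ᶜ⁺ q (≡ᶜ⁺ p d)
  ≡ᶜ⁺ (p ∥ q) (T-Par s j c d) = T-Par s j (≡ᶜ⁺ p c) (≡ᶜ⁺ q d)
  ≡ᶜ⁺ (ν p) (T-Res s b c) = T-Res s b (≡ᶜ⁺ p c)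
  ≡ᶜ⁺ (p ⟪-⟫) (T-ConfSub s c e) = T-ConfSub s (≡ᶜ⁺ p c) e

  ≡ᶜ⁻ : C ≡ᶜ D → V ∣ Γ ⊩ᶜ[ φ ] D ∶ T → V ∣ Γ ⊩ᶜ[ φ ] C ∶ T
  ≡ᶜ⁻ (SC-TermSC p) (T-Thread t d) = T-Thread t (≡ᴹ⁻ p d)
  ≡ᶜ⁻ (SC-ResSwap {C}) d = ResSwap⁻ C d
  ≡ᶜ⁻ (SC-ResComm {ms} {ns} {C}) d = ResComm⁻ ms ns C d
  ≡ᶜ⁻ SC-ResExt d = ResExt⁻ d
  ≡ᶜ⁻ SC-ResNil d = ResNil⁻ d
  ≡ᶜ⁻ (SC-Send′ F) d = Send′⁻ F d
  ≡ᶜ⁻ (SC-Select F) d = Select⁻ F d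
  ≡ᶜ⁻ SC-ParNil d = ParNil⁻ d
  ≡ᶜ⁻ SC-ParComm d = par-comm d
  ≡ᶜ⁻ SC-ParAssoc d = par-assocʳ d
  ≡ᶜ⁻ SC-ConfSub (T-ConfSub s (T-Thread t d) e) = T-Thread t (T-Sub s d e)
  ≡ᶜ⁻ (SC-ConfSubExt G C M) d = ConfSubExt⁻ G C M d
  ≡ᶜ⁻ refl d = d
  ≡ᶜ⁻ (sym p) d = ≡ᶜ⁺ p d
  ≡ᶜ⁻ (trans p q) d = ≡ᶜ⁻ p (≡ᶜ⁻ q d)
  ≡ᶜ⁻ (p ∥ q) (T-Par s j c d) = T-Par s j (≡ᶜ⁻ p c) (≡ᶜ⁻ q d)
  ≡ᶜ⁻ (ν p) (T-Res s b c) = T-Res s b (≡ᶜ⁻ p c)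
  ≡ᶜ⁻ (p ⟪-⟫) (T-ConfSub s c e) = T-ConfSub s (≡ᶜ⁻ p c) e

⟶ᶜ-preserves : C ⟶ᶜ D → V ∣ Γ ⊩ᶜ[ φ ] C ∶ T → V ∣ Γ ⊩ᶜ[ φ ] D ∶ T
⟶ᶜ-preserves (E-New F) d = New F d
⟶ᶜ-preserves (E-Spawn F) d = Spawn F d
⟶ᶜ-preserves (E-Recv {ms} F) d = Recv ms F d
⟶ᶜ-preserves (E-Case {ms = ms} F j) d = Case ms F j d
⟶ᶜ-preserves (E-LiftC G p) d with plugged s g c ← unplugᴳ G d = plugᴳ g s (⟶ᶜ-preserves p c)
⟶ᶜ-preserves (E-LiftM F p) d with plugged s f l ← unplugᶠ F d = plugᶠ f s (⟶ᴹ-preserves p l)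
⟶ᶜ-preserves (E-ConfLiftSC p q p′) d = ≡ᶜ⁺ p′ (⟶ᶜ-preserves q (≡ᶜ⁺ p d))

-- Translation between the two presentations of typing

lookup-split : ∀ {n} {Θ Γ Δ : Env n} → Θ ≔ Γ , Δ → Split (lookup Θ) (lookup Γ) (lookup Δ)
lookup-split []       = mk λ ()
lookup-split (none s) = mk λ { zero → none  ; (suc x) → part (lookup-split s) x }
lookup-split (inˡ s)  = mk λ { zero → left  ; (suc x) → part (lookup-split s) x }
lookup-split (inʳ s)  = mk λ { zero → right ; (suc x) → part (lookup-split s) x }

tabulate-split : ∀ {n} {Θ Γ Δ : Ctx n} → Split Θ Γ Δ → tabulate Θ ≔ tabulate Γ , tabulate Δ
tabulate-split {zero} s = []
tabulate-split {suc n} s = go (part s zero) (tabulate-split (split-∘ suc s))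
  where
  go : ∀ {Θ Γ Δ : Env n} → Part θ γ δ → Θ ≔ Γ , Δ → θ ∷ Θ ≔ γ ∷ Γ , δ ∷ Δ
  go none  = none
  go left  = inˡ
  go right = inʳ

infix 4 _⊴_

-- Γ ⊴ Γ′ : Γ′ extends Γ by variables of type end, as in repeated uses of T-EndL.
data _⊴_ {n} (Γ : Env n) : Env n → Set where
  done : Γ ⊴ Γ
  more : ∀ {Δ Θ x} → Γ ⊴ Δ → Θ ≔ Δ , x ∶ sess end → Γ ⊴ Θ

≔-∅ : ∀ {n} (Γ : Env n) → Γ ≔ Γ , ∅
≔-∅ []            = []
≔-∅ (nothing ∷ Γ) = none (≔-∅ Γ)
≔-∅ (just T ∷ Γ)  = inˡ (≔-∅ Γ)

⊴-cons : ∀ {n} {Γ Γ′ : Env n} a → Γ ⊴ Γ′ → a ∷ Γ ⊴ a ∷ Γ′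
⊴-cons a done                 = done
⊴-cons nothing  (more p s)    = more {x = suc _} (⊴-cons nothing p) (none s)
⊴-cons (just T) (more p s)    = more {x = suc _} (⊴-cons (just T) p) (inˡ s)

⊑⇒⊴ : ∀ {n} {Γ Γ′ : Ctx n} → Γ ⊑ Γ′ → tabulate Γ ⊴ tabulate Γ′
⊑⇒⊴ {zero}  p = done
⊑⇒⊴ {suc n} {Γ} {Γ′} p = go (at p zero) (⊴-cons (Γ zero) (⊑⇒⊴ (mk λ x → at p (suc x))))
  where
  go : ∀ {Δ : Env (suc n)} {E : Env n} → a ⊑₁ b → Δ ⊴ a ∷ E → Δ ⊴ b ∷ E
  go same q = q
  go {E = E} drop q = more {x = zero} q (inʳ (≔-∅ E))

⊴-weaken : ∀ {n} {V : Subset n} {Γ Γ′ M} → Γ ⊴ Γ′ → V ∣ Γ ⊢ M ∶ T → V ∣ Γ′ ⊢ M ∶ T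
⊴-weaken done d       = d
⊴-weaken (more p s) d = T-EndL s (⊴-weaken p d)

tabulate-∅ : ∀ n → tabulate {n = n} (λ _ → nothing) ≡ ∅ {n}
tabulate-∅ zero    = refl
tabulate-∅ (suc n) = cong (nothing ∷_) (tabulate-∅ n)

∅-⊴ : ∀ {n} {Γ : Ctx n} → (∀ y → Unr (Γ y)) → ∅ ⊴ tabulate Γ
∅-⊴ {n} {Γ} u = subst (_⊴ tabulate Γ) (tabulate-∅ n) (⊑⇒⊴ (mk u))

∶-⊴ : ∀ {n} {Γ : Ctx n} x → Γ x ≡ just T → (∀ y → y ≢ x → Unr (Γ y)) → x ∶ T ⊴ tabulate Γ
∶-⊴ zero eq u rewrite eq = ⊴-cons _ (∅-⊴ λ y → u (suc y) λ ())
∶-⊴ {n = suc n} {Γ} (suc x) eq u =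
  go (u zero λ ()) (∶-⊴ x eq λ y y≢x → u (suc y) (y≢x ∘ suc-injective))
  where
  go : ∀ {Δ E : Env n} → Unr a → Δ ⊴ E → nothing ∷ Δ ⊴ a ∷ E
  go same q = ⊴-cons nothing q
  go drop q = more {x = zero} (⊴-cons nothing q) (inʳ (≔-∅ _))

lookup-∅ : ∀ {n} (y : Fin n) → lookup ∅ y ≡ nothing
lookup-∅ y = lookup-replicate y nothing

infix 4 _⊆ⱽ_

_⊆ⱽ_ : ∀ {n} → Subset n → Vars n → Set
V ⊆ⱽ V′ = ∀ {x} → x ∈ V → V′ x ≡ true

⊆ⱽ-cons : ∀ {n} {V : Subset n} {V′} → V ⊆ⱽ V′ → outside ∷ V ⊆ⱽ false ◃ V′
⊆ⱽ-cons p (there x∈) = p x∈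

lookup-∶ : ∀ {n} (x : Fin n) {T} → lookup (x ∶ T) x ≡ just T
lookup-∶ x = lookup∘update x ∅ _

lookup-∶-other : ∀ {n} {x y : Fin n} {T} → y ≢ x → lookup (x ∶ T) y ≡ nothing
lookup-∶-other {y = y} y≢x = ≡-trans (lookup∘update′ y≢x ∅ _) (lookup-∅ y)

⊑-justˡ : Γ ⊑ Γ′ → ∀ {x} → Γ x ≡ just T → Γ′ x ≡ just T
⊑-justˡ {Γ′ = Γ′} p {x} eq = go (subst (_⊑₁ Γ′ x) eq (at p x))
  where
  go : just T ⊑₁ a → a ≡ just T
  go same = refl

⊑-∅ : ∀ {n} {Γ : Ctx n} → lookup ∅ ⊑ Γ → ∀ y → Unr (Γ y)
⊑-∅ p y = subst (_⊑₁ _) (lookup-∅ y) (at p y)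

⊑-lookup-cons : ∀ {n} {Γ : Env n} {Γ′} → lookup Γ ⊑ Γ′ → lookup (a ∷ Γ) ⊑ (a ◃ Γ′)
⊑-lookup-cons p = mk λ { zero → same ; (suc x) → at p x }

lookup-end : ∀ {n} {Θ Γ : Env n} {x Γ′} → Θ ≔ Γ , x ∶ sess end → lookup Θ ⊑ Γ′ → lookup Γ ⊑ Γ′
lookup-end {x = x} s p = mk λ y → ⊑₁-trans (part-unrˡ (part-swap (part (lookup-split s) y)) (unr y)) (at p y)
  where
  unr : ∀ y → Unr (lookup (x ∶ sess end) y)
  unr y with y ≟ x
  ... | yes refl = subst Unr (≡-sym (lookup-∶ x)) drop
  ... | no y≢x   = subst Unr (≡-sym (lookup-∶-other y≢x)) same

mutual
  ⊢⇒⊩ : ∀ {n} {V : Subset n} {V′ Γ Γ′ M} → V ⊆ⱽ V′ → lookup Γ ⊑ Γ′ → V ∣ Γ ⊢ M ∶ T → V′ ∣ Γ′ ⊩ M ∶ T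
  ⊢⇒⊩ v p (T-Var {x}) = T-Var (⊑-justˡ p (lookup-∶ x))
    λ y y≢x → subst (_⊑₁ _) (lookup-∶-other y≢x) (at p y)
  ⊢⇒⊩ v p (T-Abs d) = T-Abs (⊢⇒⊩ (⊆ⱽ-cons v) (⊑-lookup-cons p) d)
  ⊢⇒⊩ v p (T-App s d e) with _ , q , s′ ← split-weakenˡ (lookup-split s) p =
    T-App s′ (⊢⇒⊩ v q d) (⊢⇒⊩ v (mk λ _ → same) e)
  ⊢⇒⊩ v p T-Unit = T-Unit (⊑-∅ p)
  ⊢⇒⊩ v p (T-Pair s d e) with _ , q , s′ ← split-weakenˡ (lookup-split s) p =
    T-Pair s′ (⊢⇒⊩ v q d) (⊢⇒⊩ v (mk λ _ → same) e)
  ⊢⇒⊩ v p (T-Split s d e) with _ , q , s′ ← split-weakenˡ (lookup-split s) p =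
    T-Split s′ (⊢⇒⊩ v q d)
      (⊢⇒⊩ (⊆ⱽ-cons (⊆ⱽ-cons v)) (⊑-lookup-cons (⊑-lookup-cons (mk λ _ → same))) e)
  ⊢⇒⊩ v p T-New = T-New (⊑-∅ p)
  ⊢⇒⊩ v p (T-Spawn d) = T-Spawn (⊢⇒⊩ v p d)
  ⊢⇒⊩ v p (T-EndL s d) = ⊢⇒⊩ v (lookup-end s p) d
  ⊢⇒⊩ v p (T-EndR x∈V) = T-EndR (v x∈V) (⊑-∅ p)
  ⊢⇒⊩ v p (T-Send d) = T-Send (⊢⇒⊩ v p d)
  ⊢⇒⊩ v p (T-Recv d) = T-Recv (⊢⇒⊩ v p d)
  ⊢⇒⊩ v p (T-Select d j) = T-Select (⊢⇒⊩ v p d) j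
  ⊢⇒⊩ v p (T-Case s d e) with _ , q , s′ ← split-weakenˡ (lookup-split s) p =
    T-Case s′ (⊢⇒⊩ v q d) (⊢⇒⊩s v e)
  ⊢⇒⊩ v p (T-Sub s d e) with _ , q , s′ ← split-weakenˡ (lookup-split s) p =
    T-Sub s′ (⊢⇒⊩ (⊆ⱽ-cons v) (⊑-lookup-cons q) d) (⊢⇒⊩ v (mk λ _ → same) e)
  ⊢⇒⊩ v p (T-Send′ s d e) with _ , q , s′ ← split-weakenˡ (lookup-split s) p =
    T-Send′ s′ (⊢⇒⊩ v q d) (⊢⇒⊩ v (mk λ _ → same) e)

  ⊢⇒⊩s : ∀ {n j} {V : Subset n} {V′ Γ} {Ns : Family (Term n) j} {Ss : Family Session j} → V ⊆ⱽ V′ →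
         Pointwise (λ N S → V ∣ Γ ⊢ N ∶ sess S ⊸ U) Ns Ss → Branches V′ (lookup Γ) U Ns Ss
  ⊢⇒⊩s v (last d)    = last (⊢⇒⊩ v (mk λ _ → same) d)
  ⊢⇒⊩s v (cons d ds) = cons (⊢⇒⊩ v (mk λ _ → same) d) (⊢⇒⊩s v ds)

snoc-term : Split Γ Γ₁ Γ₂ → V ∣ Γ₁ ⊩ M ∶ T → V ∣ Γ₂ ⊩ᴮ ms ∶ S′ > S → V ∣ Γ ⊩ᴮ ms ∷ʳ term M ∶ S′ > ! T ∙ S
snoc-term s d ([] u) = term s d ([] u)
snoc-term s d (term t e b) with _ , s′ , t′ ← split-pull s t = term s′ e (snoc-term t′ d b)
snoc-term s d (label j b) = label j (snoc-term s d b)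

snoc-label : ∀ {j Ss Sⱼ} → V ∣ Γ ⊩ᴮ ms ∶ S′ > Sⱼ → j ↦ Sⱼ ∈ᶠ Ss → V ∣ Γ ⊩ᴮ ms ∷ʳ label j ∶ S′ > ⊕ Ss
snoc-label ([] u)       j = label j ([] u)
snoc-label (term s e b) j = term s e (snoc-label b j)
snoc-label (label i b)  j = label i (snoc-label b j)

⊢⇒⊩ᴮ : ∀ {n} {V : Subset n} {V′ Γ Γ′ ms} → V ⊆ⱽ V′ → lookup Γ ⊑ Γ′ → V ∣ Γ ⊢ᴮ ms ∶ S′ > S → V′ ∣ Γ′ ⊩ᴮ ms ∶ S′ > S
⊢⇒⊩ᴮ v p T-Buf = [] (⊑-∅ p)
⊢⇒⊩ᴮ v p (T-BufSend s d b) with _ , q , s′ ← split-weakenˡ (lookup-split s) p =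
  snoc-term s′ (⊢⇒⊩ v q d) (⊢⇒⊩ᴮ v (mk λ _ → same) b)
⊢⇒⊩ᴮ v p (T-BufSelect b j) = snoc-label (⊢⇒⊩ᴮ v p b) j

◇⊹ : ◇ ⊹ φ ≡ just ψ → φ ≡ ψ
◇⊹ {main} refl = refl
◇⊹ {◇}    refl = refl

⊹◇ : φ ⊹ ◇ ≡ just ψ → φ ≡ ψ
⊹◇ {main} refl = refl
⊹◇ {◇}    refl = refl

⊢⇒⊩ᶜ : ∀ {n} {V : Subset n} {V′ Γ Γ′ C} → V ⊆ⱽ V′ → lookup Γ ⊑ Γ′ → V ∣ Γ ⊢ᶜ[ φ ] C ∶ T → V′ ∣ Γ′ ⊩ᶜ[ φ ] C ∶ T
⊢⇒⊩ᶜ v p (T-Main d) = T-Thread main (⊢⇒⊩ v p d)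
⊢⇒⊩ᶜ v p (T-Child d) = T-Thread child (⊢⇒⊩ v p d)
⊢⇒⊩ᶜ v p (T-ParL s φ≡ c d) with refl ← ◇⊹ φ≡ with _ , q , s′ ← split-weakenˡ (lookup-split s) p =
  T-Par s′ joinˡ (⊢⇒⊩ᶜ v q c) (⊢⇒⊩ᶜ v (mk λ _ → same) d)
⊢⇒⊩ᶜ v p (T-ParR s φ≡ c d) with refl ← ⊹◇ φ≡ with _ , q , s′ ← split-weakenˡ (lookup-split s) p =
  T-Par s′ joinʳ (⊢⇒⊩ᶜ v q c) (⊢⇒⊩ᶜ v (mk λ _ → same) d)
⊢⇒⊩ᶜ v p (T-Res s b c) with _ , q , s′ ← split-weakenʳ (lookup-split s) p =
  T-Res (split-cons right s′)
    (⊢⇒⊩ᴮ (⊆ⱽ-cons (⊆ⱽ-cons v)) (⊑-lookup-cons (⊑-lookup-cons (mk λ _ → same))) b)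
    (⊢⇒⊩ᶜ (⊆ⱽ-cons (⊆ⱽ-cons v)) (⊑-lookup-cons (⊑-lookup-cons q)) c)
⊢⇒⊩ᶜ v p (T-ResBuf s b c) with _ , q , s′ ← split-weakenʳ (lookup-split s) p =
  T-Res (split-cons left s′)
    (⊢⇒⊩ᴮ (⊆ⱽ-cons (⊆ⱽ-cons v)) (⊑-lookup-cons (⊑-lookup-cons (mk λ _ → same))) b)
    (⊢⇒⊩ᶜ (⊆ⱽ-cons (⊆ⱽ-cons v)) (⊑-lookup-cons (⊑-lookup-cons q)) c)
⊢⇒⊩ᶜ v p (T-ConfSub s c e) with _ , q , s′ ← split-weakenˡ (lookup-split s) p =
  T-ConfSub s′ (⊢⇒⊩ᶜ (⊆ⱽ-cons v) (⊑-lookup-cons q) c) (⊢⇒⊩ v (mk λ _ → same) e)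

lookup-∈ : ∀ {n} {V : Vars n} {x} → V x ≡ true → x ∈ tabulate V
lookup-∈ {V = V} {x} eq = lookup⇒[]= x (tabulate V) (≡-trans (lookup∘tabulate V x) eq)

mutual
  ⊩⇒⊢ : V ∣ Γ ⊩ M ∶ T → tabulate V ∣ tabulate Γ ⊢ M ∶ T
  ⊩⇒⊢ (T-Var eq u) = ⊴-weaken (∶-⊴ _ eq u) T-Var
  ⊩⇒⊢ (T-EndR v u) = ⊴-weaken (∅-⊴ u) (T-EndR (lookup-∈ v))
  ⊩⇒⊢ (T-Abs d) = T-Abs (⊩⇒⊢ d)
  ⊩⇒⊢ (T-App s d e) = T-App (tabulate-split s) (⊩⇒⊢ d) (⊩⇒⊢ e)
  ⊩⇒⊢ (T-Unit u) = ⊴-weaken (∅-⊴ u) T-Unit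
  ⊩⇒⊢ (T-Pair s d e) = T-Pair (tabulate-split s) (⊩⇒⊢ d) (⊩⇒⊢ e)
  ⊩⇒⊢ (T-Split s d e) = T-Split (tabulate-split s) (⊩⇒⊢ d) (⊩⇒⊢ e)
  ⊩⇒⊢ (T-New u) = ⊴-weaken (∅-⊴ u) T-New
  ⊩⇒⊢ (T-Spawn d) = T-Spawn (⊩⇒⊢ d)
  ⊩⇒⊢ (T-Send d) = T-Send (⊩⇒⊢ d)
  ⊩⇒⊢ (T-Recv d) = T-Recv (⊩⇒⊢ d)
  ⊩⇒⊢ (T-Select d j) = T-Select (⊩⇒⊢ d) j
  ⊩⇒⊢ (T-Case s d e) = T-Case (tabulate-split s) (⊩⇒⊢ d) (⊩⇒⊢s e)
  ⊩⇒⊢ (T-Sub s d e) = T-Sub (tabulate-split s) (⊩⇒⊢ d) (⊩⇒⊢ e)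
  ⊩⇒⊢ (T-Send′ s d e) = T-Send′ (tabulate-split s) (⊩⇒⊢ d) (⊩⇒⊢ e)

  ⊩⇒⊢s : ∀ {j} {Ns : Family (Term n) j} {Ss : Family Session j} → Branches V Γ U Ns Ss →
         Pointwise (λ N S → tabulate V ∣ tabulate Γ ⊢ N ∶ sess S ⊸ U) Ns Ss
  ⊩⇒⊢s (last d)    = last (⊩⇒⊢ d)
  ⊩⇒⊢s (cons d ds) = cons (⊩⇒⊢ d) (⊩⇒⊢s ds)

≔-pull : ∀ {n} {Θ Γ Δ Δ₁ Δ₂ : Env n} → Θ ≔ Γ , Δ → Δ ≔ Δ₁ , Δ₂ →
         ∃ λ E → Θ ≔ Δ₁ , E × E ≔ Γ , Δ₂
≔-pull []       []       = -, [] , []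
≔-pull (none s) (none t) with _ , s′ , t′ ← ≔-pull s t = -, none s′ , none t′
≔-pull (inˡ s)  (none t) with _ , s′ , t′ ← ≔-pull s t = -, inʳ s′ , inˡ t′
≔-pull (inʳ s)  (inˡ t)  with _ , s′ , t′ ← ≔-pull s t = -, inˡ s′ , none t′
≔-pull (inʳ s)  (inʳ t)  with _ , s′ , t′ ← ≔-pull s t = -, inʳ s′ , inʳ t′

cons-term : ∀ {n} {V : Subset n} {Θ Γ Δ M ms} → Θ ≔ Γ , Δ → V ∣ Γ ⊢ M ∶ T →
            V ∣ Δ ⊢ᴮ ms ∶ ! T ∙ S′ > S → V ∣ Θ ⊢ᴮ term M ∷ ms ∶ S′ > S
cons-term s d T-Buf = T-BufSend s d T-Buf
cons-term s d (T-BufSend t e b) with _ , s′ , t′ ← ≔-pull s t = T-BufSend s′ e (cons-term t′ d b)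
cons-term s d (T-BufSelect b j) = T-BufSelect (cons-term s d b) j

cons-label : ∀ {n} {V : Subset n} {Γ j Ss Sⱼ ms} → j ↦ Sⱼ ∈ᶠ Ss →
             V ∣ Γ ⊢ᴮ ms ∶ ⊕ Ss > S → V ∣ Γ ⊢ᴮ label j ∷ ms ∶ Sⱼ > S
cons-label j T-Buf             = T-BufSelect T-Buf j
cons-label j (T-BufSend s d b) = T-BufSend s d (cons-label j b)
cons-label j (T-BufSelect b i) = T-BufSelect (cons-label j b) i

part-shrink : Part θ γ δ → b ⊑₁ δ → ∃ λ c → Part c γ b × c ⊑₁ θ
part-shrink p     same = -, p , same
part-shrink right drop = -, none , drop

split-shrink : Split Θ Γ Δ → Δ′ ⊑ Δ → ∃ λ Θ′ → Split Θ′ Γ Δ′ × Θ′ ⊑ Θ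
split-shrink s p = (λ x → proj₁ (q x)) , mk (λ x → proj₁ (proj₂ (q x))) , mk (λ x → proj₂ (proj₂ (q x)))
  where q = λ x → part-shrink (part s x) (at p x)

part-give : Part θ γ δ → b ⊑₁ γ → ∃ λ c → Part θ b c × δ ⊑₁ c
part-give p    same = -, p , same
part-give left drop = -, right , drop

split-give : Split Θ Γ Δ → Γ′ ⊑ Γ → ∃ λ Δ′ → Split Θ Γ′ Δ′ × Δ ⊑ Δ′
split-give s p = (λ x → proj₁ (q x)) , mk (λ x → proj₁ (proj₂ (q x))) , mk (λ x → proj₂ (proj₂ (q x)))
  where q = λ x → part-give (part s x) (at p x)

-- Buffers, unlike terms, cannot absorb variables of type end.
⊩⇒⊢ᴮ : ∀ {n} {V : Vars n} {Γ ms} → V ∣ Γ ⊩ᴮ ms ∶ S′ > S → ∃ λ Γ′ → Γ′ ⊑ Γ × tabulate V ∣ tabulate Γ′ ⊢ᴮ ms ∶ S′ > S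
⊩⇒⊢ᴮ {n = n} {V = V} ([] u) = (λ _ → nothing) , mk u ,
  subst (λ Γ → tabulate V ∣ Γ ⊢ᴮ [] ∶ _ > _) (≡-sym (tabulate-∅ n)) T-Buf
⊩⇒⊢ᴮ (term s d b) with _ , p , b′ ← ⊩⇒⊢ᴮ b with _ , s′ , q ← split-shrink s p =
  -, q , cons-term (tabulate-split s′) (⊩⇒⊢ d) b′
⊩⇒⊢ᴮ (label j b) with _ , p , b′ ← ⊩⇒⊢ᴮ b = -, p , cons-label j b′

-- Recursion on the configuration, since the derivation is weakened on the way.
⊩⇒⊢ᶜ : ∀ {n} {V : Vars n} {Γ φ} C → V ∣ Γ ⊩ᶜ[ φ ] C ∶ T → tabulate V ∣ tabulate Γ ⊢ᶜ[ φ ] C ∶ T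
⊩⇒⊢ᶜ (φ ▸ M) (T-Thread main d)  = T-Main (⊩⇒⊢ d)
⊩⇒⊢ᶜ (φ ▸ M) (T-Thread child d) = T-Child (⊩⇒⊢ d)
⊩⇒⊢ᶜ {φ = φ} (C ∥ D) (T-Par s joinˡ c d) = T-ParL (tabulate-split s) (eq φ) (⊩⇒⊢ᶜ C c) (⊩⇒⊢ᶜ D d)
  where
  eq : ∀ φ → ◇ ⊹ φ ≡ just φ
  eq main = refl
  eq ◇    = refl
⊩⇒⊢ᶜ {φ = φ} (C ∥ D) (T-Par s joinʳ c d) = T-ParR (tabulate-split s) (eq φ) (⊩⇒⊢ᶜ C c) (⊩⇒⊢ᶜ D d)
  where
  eq : ∀ φ → φ ⊹ ◇ ≡ just φ
  eq main = refl
  eq ◇    = refl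
⊩⇒⊢ᶜ (ν ms C) (T-Res s b c) with Γ₁ , p , b′ ← ⊩⇒⊢ᴮ b
  with Γ₂ , s′ , q ← split-give s (mk λ x → at p (suc x)) =
  go (Γ₁ zero) (at p zero) (Γ₁ 1F) (part s′ zero) (tabulate-split (split-∘ suc s′)) b′
     (⊩⇒⊢ᶜ C (weakenᶜ (⊑-cons q) c))
  where
  go : ∀ {n} {V : Subset n} {Θ Γ Δ : Env n} {ms C S S′ φ T} a → a ⊑₁ nothing → ∀ b {c} →
       Part (just (sess (dual S))) b c → Θ ≔ Γ , Δ →
       outside ∷ outside ∷ V ∣ a ∷ b ∷ Γ ⊢ᴮ ms ∶ S′ > S →
       outside ∷ outside ∷ V ∣ just (sess S′) ∷ c ∷ Δ ⊢ᶜ[ φ ] C ∶ T → V ∣ Θ ⊢ᶜ[ φ ] ν ms C ∶ T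
  go _ same _ left  s b c = T-ResBuf s b c
  go _ same _ right s b c = T-Res s b c
⊩⇒⊢ᶜ (C ⟪ M ⟫) (T-ConfSub s c e) = T-ConfSub (tabulate-split s) (⊩⇒⊢ᶜ C c) (⊩⇒⊢ e)

tabulate-⊤ : ∀ n → tabulate {n = n} (λ _ → true) ≡ ⊤
tabulate-⊤ zero    = refl
tabulate-⊤ (suc n) = cong (true ∷_) (tabulate-⊤ n)

theorem2p6 : (n : ℕ) (C D : Conf n) (Γ : Env n) (φ : Marker) (T : Type) →
    Γ ⊢[ φ ] C ∶ T → (C ≡ᶜ D ⊎ C ⟶ᶜ D) → Γ ⊢[ φ ] D ∶ T
theorem2p6 n C D Γ φ T c step =
  subst₂ (_∣_⊢ᶜ[ φ ] D ∶ T) (tabulate-⊤ n) (tabulate∘lookup Γ)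
    (⊩⇒⊢ᶜ D (preserves step (⊢⇒⊩ᶜ {V′ = λ _ → true} (λ _ → refl) (mk λ _ → same) c)))
  where
  preserves : ∀ {V Γ} → C ≡ᶜ D ⊎ C ⟶ᶜ D → V ∣ Γ ⊩ᶜ[ φ ] C ∶ T → V ∣ Γ ⊩ᶜ[ φ ] D ∶ T
  preserves (inj₁ p) = ≡ᶜ⁺ p
  preserves (inj₂ r) = ⟶ᶜ-preserves r
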